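{- There is an absolute constant $C>0$ such that the following holds. Let $n,k$ be integers with $2 \le k \le n-2$, let $p = \min(k/n, 1-k/n)$, and let $f\colon \binom{[n]}{k} \to \{0,1\}$. Suppose there are reals $c_1,\ldots,c_n$ such that $\|f - \ell\|^2 \le \epsilon$, where $\ell(x) = \sum_{i=1}^n c_i x_i$. Then there is a set $S \subseteq [n]$ with $|S| \le \max(1, C\sqrt{\epsilon}/p)$ such that either $f$ or $1-f$ satisfies $\|\,\cdot - g\|^2 \le C\epsilon$, where $g(x) = \max_{i \in S} x_i$ if $k \le n/2$, and $g(x) = \min_{i \in S} x_i$ if $k \ge n/2$.
   Context: The slice is $\binom{[n]}{k} = \{x \in \{0,1\}^n : \sum_i x_i = k\}$, equipped with the uniform probability measure; $\|h\|^2 = \mathbb{E}[h^2]$ under this measure. By convention $\max_{i\in\emptyset} x_i = 0$ and $\min_{i \in \emptyset} x_i = 1$. Every affine function on the slice can be written as $\sum_i c_i x_i$.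
   Formalization: The coefficients c_1,…,c_n and the error bound ε are taken to be rational numbers instead of reals (the constant C is rational too), and the bound |S| ≤ max(1, C√ε/p) is stated in squared form. -}

module Defs where

open import Data.Bool using (Bool; true; false; not; _∨_; _∧_)
open import Data.Nat using (ℕ; zero; suc)
open import Data.Integer using (+_)
open import Data.Rational using (ℚ; 0ℚ; 1ℚ; _+_; _-_; _*_; _/_; _⊓_)
open import Data.List using (List; []; _∷_; map; _++_; filter; length)
open import Data.Vec using (Vec; []; _∷_)
open import Relation.Binary.PropositionalEquality using (_≡_)
open import Data.Nat using (_≟_)

toℚ : Bool → ℚ
toℚ true  = 1ℚ
toℚ false = 0ℚ

cube : (n : ℕ) → List (Vec Bool n)
cube zero    = [] ∷ []
cube (suc n) = map (false ∷_) (cube n) ++ map (true ∷_) (cube n)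

weight : ∀ {n} → Vec Bool n → ℕ
weight []          = 0
weight (false ∷ x) = weight x
weight (true ∷ x)  = suc (weight x)

slice : (n k : ℕ) → List (Vec Bool n)
slice n k = filter (λ x → weight x ≟ k) (cube n)

sumℚ : List ℚ → ℚ
sumℚ []       = 0ℚ
sumℚ (q ∷ qs) = q + sumℚ qs

mean : List ℚ → ℚ
mean []       = 0ℚ
mean (q ∷ qs) = sumℚ (q ∷ qs) * (+ 1 / suc (length qs))

normSq : (n k : ℕ) → (Vec Bool n → ℚ) → ℚ
normSq n k h = mean (map (λ x → h x * h x) (slice n k))

linear : ∀ {n} → Vec ℚ n → Vec Bool n → ℚ
linear []       []       = 0ℚ
linear (c ∷ cs) (b ∷ x)  = c * toℚ b + linear cs x

-- S ⊆ [n] is encoded as a characteristic vector (Data.Fin.Subset.Subset n = Vec Bool n)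
-- max_{i∈S} x_i  (max over ∅ is 0)
maxOn : ∀ {n} → Vec Bool n → Vec Bool n → Bool
maxOn []       []      = false
maxOn (s ∷ S)  (b ∷ x) = (s ∧ b) ∨ maxOn S x

-- min_{i∈S} x_i  (min over ∅ is 1)
minOn : ∀ {n} → Vec Bool n → Vec Bool n → Bool
minOn []       []      = true
minOn (s ∷ S)  (b ∷ x) = (not s ∨ b) ∧ minOn S x

-- a / n as a rational (0 if n = 0; irrelevant here since n ≥ 4)
frac : ℕ → ℕ → ℚ
frac a zero    = 0ℚ
frac a (suc m) = + a / suc m

pOf : ℕ → ℕ → ℚ
pOf n k = frac k n ⊓ (1ℚ - frac k n)

distSq : (n k : ℕ) → (Vec Bool n → Bool) → (Vec Bool n → Bool) → ℚ
distSq n k a b = normSq n k (λ x → toℚ (a x) - toℚ (b x))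

{-# OPTIONS --safe #-}
-- Put ℓ = Σ cᵢ xᵢ and p = k/n ≤ 1/2.  Exchanging two coordinates of x preserves the measure, changes
-- ℓ(x) by a difference of two coefficients if they are split, and changes f(x) by 0 or ±1 only.  Pair up
-- the coefficients so that every pair straddles the median μ, and let X = Σ dᵢ zᵢ be the change of ℓ when
-- the pairs of some family are exchanged (dᵢ the differences, zᵢ = ±1 if the i-th pair is split, else 0).
-- If all dᵢ are small, then E X² - 4 E X⁴ ≤ E dist(X, {0, ±1})² = O(ε), and the fourth moment is
-- negligible as long as p Σ dᵢ² is small, so p Σ dᵢ² = O(ε) follows by adding one pair at a time.
-- If all dᵢ are at least θ, exchange two disjoint families of u pairs independently: ℓ is far from
-- Boolean on one of the four resulting points whenever each family has exactly one split pair, which has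
-- probability of order (u p)² as long as u p is small; so (u p)² = O(ε).
-- Hence cᵢ is close to μ off a set T with |T| ≤ 1 or |T| p = O(√ε), and by a variance bound f is
-- O(ε)-close to α + Σ_{i ∈ T} (cᵢ - μ) xᵢ for a constant α.  As x misses T with probability at least 1/2,
-- α is nearly 0 or 1.  As x rarely meets T twice, for α = 0 the sum may be replaced by the maximum of xᵢ
-- over those i ∈ T with cᵢ - μ ≥ 1/2; the case α = 1 concerns 1 - f.  For k ≥ n/2 complement x.
module Submission where

open import Defs
open import Data.Bool using (Bool; true; false; not; _∨_; _∧_; if_then_else_) renaming (T to IsTrue)
open import Data.Bool.Properties using (not-involutive; ∧-zeroʳ)
open import Data.Empty using (⊥-elim)
open import Data.Nat as ℕ using (ℕ; zero; suc; _≤_; _+_; _*_; z≤n; s≤s)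
import Data.Nat.Properties as ℕₚ
import Data.Integer as ℤ
open import Data.Integer using (+_)
import Data.Rational as ℚ
open import Data.Rational using (ℚ; 0ℚ; 1ℚ; ½; _-_; -_; _/_) renaming (_<_ to _<ℚ_; _≤_ to _≤ℚ_; _*_ to _*ℚ_; _+_ to _+ℚ_)
import Data.Rational.Properties as ℚₚ
import Data.Rational.Unnormalised as ℚᵘ
import Data.Rational.Unnormalised.Properties as ℚᵘₚ
import Data.Integer.Properties as ℤₚ
open import Data.Fin.Subset using (Subset; ∣_∣)
open import Data.Vec using (Vec; []; _∷_; fromList; replicate)
open import Data.List using (List; []; _∷_; length; map; _++_; filter)
open import Data.List.Properties using (length-map; map-++; map-∘)
open import Data.List.Relation.Binary.Permutation.Propositional using (_↭_; refl; prep; swap; trans; ↭-sym)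
open import Data.List.Relation.Binary.Permutation.Propositional.Properties using (↭-length; All-resp-↭)
open import Data.List.Relation.Unary.All as All using (All; []; _∷_)
open import Data.Product using (Σ; _×_; ∃; _,_; proj₁; proj₂)
open import Data.Sum as Sum using (_⊎_; inj₁; inj₂)
open import Data.Maybe using (Maybe; just; nothing)
open import Function using (_∘_; id)
open import Relation.Nullary using (yes; no; does)
open import Relation.Binary.PropositionalEquality as ≡ using (_≡_; cong; cong₂; sym; subst; subst₂; module ≡-Reasoning)
open import Tactic.RingSolver using (solve-∀)
open import Tactic.RingSolver.Core.AlmostCommutativeRing using (AlmostCommutativeRing; fromCommutativeRing)

-- A single outlier coefficient cannot be excluded, as f may be a coordinate; hence the 1 in the
-- bound on |S|. It is also why two families are exchanged: one exchange with X near 1 or -1 is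
-- consistent with a Boolean f, whereas the second difference over two exchanges vanishes for ℓ but
-- not for an f that changes under each of them. Two families need two far pairs, so exactly one far
-- pair is a separate case, settled by re-pairing its entries with those of a close pair. The median
-- is the reference point because the entries of a pair lie on opposite sides of it, so that (a -
-- b)² controls both squared deviations at once. Both main estimates are circular: each works only
-- where the quantity it bounds is already below a constant. Induction over the pairs breaks the
-- circle, since one more pair changes the quantity by a controlled amount; this requires ε ≤ `ε₀`.
-- Beyond `ε₀` the claim is trivial, because C is 1 / `ε₀`. Square roots are avoided: |S| ≤ C √ε / p
-- is carried as (|S| p)² ≤ C² ε.

-- Rational arithmetic and inequalities

0≟ : (x : ℚ) → Maybe (0ℚ ≡ x)
0≟ x with 0ℚ ℚₚ.≟ x
... | yes p = just p
... | no _  = nothing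

ℚ-ring : AlmostCommutativeRing _ _
ℚ-ring = fromCommutativeRing ℚₚ.+-*-commutativeRing 0≟

-- Defined by recursion so that `q (suc n)` unfolds to `1ℚ +ℚ q n` inside ring identities; `/1≡q`
-- links it to the fractions of the statement.
q : ℕ → ℚ
q zero    = 0ℚ
q (suc n) = 1ℚ +ℚ q n

infixl 6 _⊕_
infixl 7 _⊗_

_⊕_ : ∀ {a b} → 0ℚ ≤ℚ a → 0ℚ ≤ℚ b → 0ℚ ≤ℚ a +ℚ b
_⊕_ = ℚₚ.+-mono-≤

_⊗_ : ∀ {a b} → 0ℚ ≤ℚ a → 0ℚ ≤ℚ b → 0ℚ ≤ℚ a *ℚ b
_⊗_ {a} {b} 0≤a 0≤b = subst (_≤ℚ a *ℚ b) (ℚₚ.*-zeroʳ a)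
  (ℚₚ.*-monoˡ-≤-nonNeg a {{ℚ.nonNegative 0≤a}} 0≤b)

gap : ∀ {a b} → a ≤ℚ b → 0ℚ ≤ℚ b - a
gap {a} {b} a≤b = subst (_≤ℚ b - a) (ℚₚ.+-inverseʳ a) (ℚₚ.+-monoˡ-≤ (- a) a≤b)

-- Inequalities are proved by exhibiting the difference of the two sides as an
-- expression r that is visibly nonnegative.
by : ∀ {a b r} → b - a ≡ r → 0ℚ ≤ℚ r → a ≤ℚ b
by {a} {b} eq 0≤r = subst (_≤ℚ b) (ℚₚ.+-identityʳ a)
  (subst (a +ℚ 0ℚ ≤ℚ_) (cancel a b) (ℚₚ.+-monoʳ-≤ a (subst (0ℚ ≤ℚ_) (sym eq) 0≤r)))
  where
  cancel : ∀ a b → a +ℚ (b - a) ≡ b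
  cancel = solve-∀ ℚ-ring

0≤* : ∀ {a r} → a ≡ r → 0ℚ ≤ℚ r → 0ℚ ≤ℚ a
0≤* eq 0≤r = subst (0ℚ ≤ℚ_) (sym eq) 0≤r

neg-sq : ∀ a → - a *ℚ - a ≡ a *ℚ a
neg-sq = solve-∀ ℚ-ring

sq≥0 : ∀ a → 0ℚ ≤ℚ a *ℚ a
sq≥0 a with ℚₚ.≤-total 0ℚ a
... | inj₁ 0≤a = 0≤a ⊗ 0≤a
... | inj₂ a≤0 = 0≤* (sym (neg-sq a)) (ℚₚ.neg-antimono-≤ a≤0 ⊗ ℚₚ.neg-antimono-≤ a≤0)

-- Meant for closed constants: the test evaluates to true, so the hidden proof is found by itself.
pos : ∀ {a} {_ : IsTrue (0ℚ ℚ.≤ᵇ a)} → 0ℚ ≤ℚ a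
pos {a} {h} = ℚₚ.≤ᵇ⇒≤ h

sq : ℚ → ℚ
sq a = a *ℚ a

-- Stands in for taking square roots, which do not exist in ℚ.
sq-cancel-≤ : ∀ {a b} → 0ℚ ≤ℚ b → a *ℚ a ≤ℚ b *ℚ b → a ≤ℚ b
sq-cancel-≤ {a} {b} 0≤b a²≤b² with a ℚₚ.≤? b
... | yes a≤b = a≤b
... | no a≰b = ⊥-elim (ℚₚ.<-irrefl ≡.refl (ℚₚ.<-≤-trans strict a²≤b²))
  where
  b<a : b <ℚ a
  b<a = ℚₚ.≰⇒> a≰b
  strict : b *ℚ b <ℚ a *ℚ a
  strict = ℚₚ.≤-<-trans (ℚₚ.*-monoˡ-≤-nonNeg b {{ℚ.nonNegative 0≤b}} (ℚₚ.<⇒≤ b<a))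
    (ℚₚ.*-monoˡ-<-pos a {{ℚ.positive (ℚₚ.≤-<-trans 0≤b b<a)}} b<a)

/1≡q : ∀ n → + n / 1 ≡ q n
/1≡q zero    = ≡.refl
/1≡q (suc n) = ≡.trans (ℚₚ.toℚᵘ-injective (begin
  ℚ.toℚᵘ (+ suc n / 1)             ≈⟨ ℚₚ.toℚᵘ-fromℚᵘ (ℚᵘ.mkℚᵘ (+ suc n) 0) ⟩
  ℚᵘ.mkℚᵘ (+ suc n) 0               ≈⟨ ℚᵘ.*≡* (cong (ℤ._* + 1) lemma) ⟩
  ℚ.toℚᵘ 1ℚ ℚᵘ.+ ℚᵘ.mkℚᵘ (+ n) 0    ≈⟨ ℚᵘₚ.+-congʳ (ℚ.toℚᵘ 1ℚ) (ℚₚ.toℚᵘ-fromℚᵘ (ℚᵘ.mkℚᵘ (+ n) 0)) ⟨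
  ℚ.toℚᵘ 1ℚ ℚᵘ.+ ℚ.toℚᵘ (+ n / 1)   ≈⟨ ℚₚ.toℚᵘ-homo-+ 1ℚ (+ n / 1) ⟨
  ℚ.toℚᵘ (1ℚ +ℚ + n / 1)            ∎)) (cong (1ℚ +ℚ_) (/1≡q n))
  where
  open ℚᵘₚ.≃-Reasoning
  lemma : + suc n ≡ + 1 ℤ.* + 1 ℤ.+ + n ℤ.* + 1
  lemma = cong (λ z → + 1 ℤ.+ z) (sym (ℤₚ.*-identityʳ (+ n)))

q≥0 : ∀ n → 0ℚ ≤ℚ q n
q≥0 zero    = ℚₚ.≤-refl
q≥0 (suc n) = pos {1ℚ} ⊕ q≥0 n

q-+ : ∀ m n → q (m + n) ≡ q m +ℚ q n
q-+ zero    n = sym (ℚₚ.+-identityˡ (q n))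
q-+ (suc m) n = ≡.trans (cong (1ℚ +ℚ_) (q-+ m n)) (sym (ℚₚ.+-assoc 1ℚ (q m) (q n)))

q-* : ∀ m n → q (m * n) ≡ q m *ℚ q n
q-* zero    n = sym (ℚₚ.*-zeroˡ (q n))
q-* (suc m) n = begin
  q (n + m * n)           ≡⟨ q-+ n (m * n) ⟩
  q n +ℚ q (m * n)        ≡⟨ cong (q n +ℚ_) (q-* m n) ⟩
  q n +ℚ q m *ℚ q n       ≡⟨ distrib (q m) (q n) ⟩
  (1ℚ +ℚ q m) *ℚ q n      ∎
  where
  open ≡-Reasoning
  distrib : ∀ a b → b +ℚ a *ℚ b ≡ (1ℚ +ℚ a) *ℚ b
  distrib = solve-∀ ℚ-ring

q-mono : ∀ {m n} → m ≤ n → q m ≤ℚ q n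
q-mono {m} {n} m≤n = by (≡.trans (cong (λ j → q j - q m) (sym (ℕₚ.m+[n∸m]≡n m≤n)))
  (≡.trans (cong (_- q m) (q-+ m (n ℕ.∸ m))) (cancel (q m) (q (n ℕ.∸ m))))) (q≥0 (n ℕ.∸ m))
  where
  cancel : ∀ a b → a +ℚ b - a ≡ b
  cancel = solve-∀ ℚ-ring

-- Weighted sums over the cube

-- ∑ₓ w(|x|) F(x) over the whole cube.  Shifting the weight (w ∘ suc) replaces the
-- passage from k to k - 1, so that no case distinction on k is needed.
E : ∀ n → (ℕ → ℚ) → (Vec Bool n → ℚ) → ℚ
E zero    w F = w 0 *ℚ F []
E (suc n) w F = E n w (F ∘ (false ∷_)) +ℚ E n (w ∘ suc) (F ∘ (true ∷_))

mass : ℕ → (ℕ → ℚ) → ℚ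
mass n w = E n w (λ _ → 1ℚ)

NonNeg : (ℕ → ℚ) → Set
NonNeg w = ∀ j → 0ℚ ≤ℚ w j

E-cong : ∀ n {w F G} → (∀ x → F x ≡ G x) → E n w F ≡ E n w G
E-cong zero    {w} F≗G = cong (w 0 *ℚ_) (F≗G [])
E-cong (suc n) F≗G = cong₂ _+ℚ_ (E-cong n (F≗G ∘ (false ∷_))) (E-cong n (F≗G ∘ (true ∷_)))

E-mono : ∀ n {w F G} → NonNeg w → (∀ x → F x ≤ℚ G x) → E n w F ≤ℚ E n w G
E-mono zero    {w} w≥0 F≤G = ℚₚ.*-monoˡ-≤-nonNeg (w 0) {{ℚ.nonNegative (w≥0 0)}} (F≤G [])
E-mono (suc n) w≥0 F≤G =
  ℚₚ.+-mono-≤ (E-mono n w≥0 (F≤G ∘ (false ∷_))) (E-mono n (w≥0 ∘ suc) (F≤G ∘ (true ∷_)))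

E-lin : ∀ n {w} a b F G → E n w (λ x → a *ℚ F x +ℚ b *ℚ G x) ≡ a *ℚ E n w F +ℚ b *ℚ E n w G
E-lin zero {w} a b F G = ring (w 0) a b (F []) (G [])
  where
  ring : ∀ w a b f g → w *ℚ (a *ℚ f +ℚ b *ℚ g) ≡ a *ℚ (w *ℚ f) +ℚ b *ℚ (w *ℚ g)
  ring = solve-∀ ℚ-ring
E-lin (suc n) {w} a b F G = ≡.trans
  (cong₂ _+ℚ_ (E-lin n a b (F ∘ (false ∷_)) (G ∘ (false ∷_))) (E-lin n a b (F ∘ (true ∷_)) (G ∘ (true ∷_))))
  (ring a b (E n w (F ∘ (false ∷_))) (E n w (G ∘ (false ∷_)))
    (E n (w ∘ suc) (F ∘ (true ∷_))) (E n (w ∘ suc) (G ∘ (true ∷_))))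
  where
  ring : ∀ a b f g f′ g′ → (a *ℚ f +ℚ b *ℚ g) +ℚ (a *ℚ f′ +ℚ b *ℚ g′) ≡ a *ℚ (f +ℚ f′) +ℚ b *ℚ (g +ℚ g′)
  ring = solve-∀ ℚ-ring

E-+ : ∀ n {w} F G → E n w (λ x → F x +ℚ G x) ≡ E n w F +ℚ E n w G
E-+ n {w} F G = begin
  E n w (λ x → F x +ℚ G x)                    ≡⟨ E-cong n (λ x → ring (F x) (G x)) ⟩
  E n w (λ x → 1ℚ *ℚ F x +ℚ 1ℚ *ℚ G x)        ≡⟨ E-lin n 1ℚ 1ℚ F G ⟩
  1ℚ *ℚ E n w F +ℚ 1ℚ *ℚ E n w G              ≡⟨ ring (E n w F) (E n w G) ⟨
  E n w F +ℚ E n w G                          ∎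
  where
  open ≡-Reasoning
  ring : ∀ f g → f +ℚ g ≡ 1ℚ *ℚ f +ℚ 1ℚ *ℚ g
  ring = solve-∀ ℚ-ring

E-* : ∀ n {w} a F → E n w (λ x → a *ℚ F x) ≡ a *ℚ E n w F
E-* n {w} a F = begin
  E n w (λ x → a *ℚ F x)                      ≡⟨ E-cong n (λ x → ring a (F x)) ⟩
  E n w (λ x → a *ℚ F x +ℚ 0ℚ *ℚ F x)         ≡⟨ E-lin n a 0ℚ F F ⟩
  a *ℚ E n w F +ℚ 0ℚ *ℚ E n w F               ≡⟨ ring a (E n w F) ⟨
  a *ℚ E n w F                                ∎
  where
  open ≡-Reasoning
  ring : ∀ a f → a *ℚ f ≡ a *ℚ f +ℚ 0ℚ *ℚ f
  ring = solve-∀ ℚ-ring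

E-const : ∀ n {w} a → E n w (λ _ → a) ≡ a *ℚ mass n w
E-const n {w} a = ≡.trans (E-cong n (λ _ → sym (ℚₚ.*-identityʳ a))) (E-* n a (λ _ → 1ℚ))

E-nonneg : ∀ n {w F} → NonNeg w → (∀ x → 0ℚ ≤ℚ F x) → 0ℚ ≤ℚ E n w F
E-nonneg n {w} {F} w≥0 F≥0 = subst (_≤ℚ E n w F)
  (≡.trans (E-const n 0ℚ) (ℚₚ.*-zeroˡ (mass n w))) (E-mono n w≥0 F≥0)

mass-nonneg : ∀ n {w} → NonNeg w → 0ℚ ≤ℚ mass n w
mass-nonneg n w≥0 = E-nonneg n w≥0 (λ _ → pos {1ℚ})

-- Coefficient lists up to permutation

Bits : List ℚ → Set
Bits c = Vec Bool (length c)

lin : (c : List ℚ) → Bits c → ℚ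
lin c = linear (fromList c)

act : ∀ {c c′ : List ℚ} → c ↭ c′ → Bits c → Bits c′
act refl          x           = x
act (prep _ π)    (b ∷ x)     = b ∷ act π x
act (swap _ _ π)  (a ∷ b ∷ x) = b ∷ a ∷ act π x
act (trans π ρ)   x           = act ρ (act π x)

lin-act : ∀ {c c′} (π : c ↭ c′) x → lin c′ (act π x) ≡ lin c x
lin-act refl x = ≡.refl
lin-act (prep a π) (b ∷ x) = cong (a *ℚ toℚ b +ℚ_) (lin-act π x)
lin-act {_ ∷ _ ∷ c} (swap a a′ π) (b ∷ b′ ∷ x) = ≡.trans
  (cong (λ t → a′ *ℚ toℚ b′ +ℚ (a *ℚ toℚ b +ℚ t)) (lin-act π x))
  (ring (a′ *ℚ toℚ b′) (a *ℚ toℚ b) (lin c x))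
  where
  ring : ∀ a b c → a +ℚ (b +ℚ c) ≡ b +ℚ (a +ℚ c)
  ring = solve-∀ ℚ-ring
lin-act (trans π ρ) x = ≡.trans (lin-act ρ (act π x)) (lin-act π x)

E-act : ∀ {c c′ : List ℚ} (π : c ↭ c′) w F → E (length c) w (F ∘ act π) ≡ E (length c′) w F
E-act refl w F = ≡.refl
E-act (prep _ π) w F = cong₂ _+ℚ_ (E-act π w (F ∘ (false ∷_))) (E-act π (w ∘ suc) (F ∘ (true ∷_)))
E-act {c′ = _ ∷ _ ∷ c′} (swap a a′ π) w F = ≡.trans
  (cong₂ _+ℚ_ (cong₂ _+ℚ_ (E-act π w _) (E-act π (w ∘ suc) _))
              (cong₂ _+ℚ_ (E-act π (w ∘ suc) _) (E-act π (w ∘ suc ∘ suc) _)))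
  (ring (E (length c′) w (λ x → F (false ∷ false ∷ x))) (E (length c′) (w ∘ suc) (λ x → F (true ∷ false ∷ x)))
        (E (length c′) (w ∘ suc) (λ x → F (false ∷ true ∷ x))) (E (length c′) (w ∘ suc ∘ suc) (λ x → F (true ∷ true ∷ x))))
  where
  ring : ∀ a b c d → (a +ℚ b) +ℚ (c +ℚ d) ≡ (a +ℚ c) +ℚ (b +ℚ d)
  ring = solve-∀ ℚ-ring
E-act (trans π ρ) w F = ≡.trans (E-act π w (F ∘ act ρ)) (E-act ρ w F)

err : (c : List ℚ) → (Bits c → Bool) → Bits c → ℚ
err c f x = toℚ (f x) - lin c x

-- The Boolean function is hidden, because reordering the coefficients also reorders its argument;
-- only its existence matters for bounds on the coefficients.
Near : (ℕ → ℚ) → ℚ → List ℚ → Set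
Near w ε c = Σ (Bits c → Bool) λ f → E (length c) w (λ x → sq (err c f x)) ≤ℚ ε

Near-↭ : ∀ {w ε c c′} → c ↭ c′ → Near w ε c → Near w ε c′
Near-↭ {w} {ε} {c} {c′} π (f , bound) = f ∘ act (↭-sym π) ,
  subst (_≤ℚ ε) (≡.trans (sym (E-act (↭-sym π) w (λ x → sq (err c f x))))
    (E-cong (length c′) (λ y → cong (λ t → sq (toℚ (f (act (↭-sym π) y)) - t)) (lin-act (↭-sym π) y)))) bound

-- Exchanging paired coordinates

Pair : Set
Pair = ℚ × ℚ

flat : List Pair → List ℚ → List ℚ
flat []             r = r
flat ((a , b) ∷ ps) r = a ∷ b ∷ flat ps r

rest : ∀ ps {r} → Bits (flat ps r) → Bits r
rest []       x           = x
rest (_ ∷ ps) (_ ∷ _ ∷ x) = rest ps x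

-- The flag lets one family stand still while `g` exchanges a second family behind it; this yields
-- all four points of `two-hits`.
step : Bool → ∀ ps {r} → (Bits r → Bits r) → Bits (flat ps r) → Bits (flat ps r)
step β []       g x           = g x
step false (_ ∷ ps) g (s ∷ t ∷ x) = s ∷ t ∷ step false ps g x
step true  (_ ∷ ps) g (s ∷ t ∷ x) = t ∷ s ∷ step true ps g x

diff : ∀ ps {r} → Bits (flat ps r) → ℚ
diff []             x           = 0ℚ
diff ((a , b) ∷ ps) (s ∷ t ∷ x) = (a - b) *ℚ (toℚ s - toℚ t) +ℚ diff ps x

MassPreserving : ∀ r → (Bits r → Bits r) → Set
MassPreserving r g = ∀ w F → E (length r) w (F ∘ g) ≡ E (length r) w F

-- The states 01 and 10 of a pair both shift the weight by one, so exchanging them only permutes two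
-- equally weighted terms.
step-preserves : ∀ β ps {r g} → MassPreserving r g → MassPreserving (flat ps r) (step β ps g)
step-preserves β     []       pres w F = pres w F
step-preserves false (_ ∷ ps) pres w F =
  cong₂ _+ℚ_ (cong₂ _+ℚ_ (step-preserves false ps pres w _) (step-preserves false ps pres (w ∘ suc) _))
             (cong₂ _+ℚ_ (step-preserves false ps pres (w ∘ suc) _) (step-preserves false ps pres (w ∘ suc ∘ suc) _))
step-preserves true  (_ ∷ ps) {r} pres w F = ≡.trans
  (cong₂ _+ℚ_ (cong₂ _+ℚ_ (step-preserves true ps pres w _) (step-preserves true ps pres (w ∘ suc) _))
              (cong₂ _+ℚ_ (step-preserves true ps pres (w ∘ suc) _) (step-preserves true ps pres (w ∘ suc ∘ suc) _)))
  (ring (E m w (λ x → F (false ∷ false ∷ x))) (E m (w ∘ suc) (λ x → F (true ∷ false ∷ x)))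
        (E m (w ∘ suc) (λ x → F (false ∷ true ∷ x))) (E m (w ∘ suc ∘ suc) (λ x → F (true ∷ true ∷ x))))
  where
  m = length (flat ps r)
  ring : ∀ a b c d → (a +ℚ b) +ℚ (c +ℚ d) ≡ (a +ℚ c) +ℚ (b +ℚ d)
  ring = solve-∀ ℚ-ring

lin-step : ∀ β ps {r} g x →
  lin (flat ps r) (step β ps g x) ≡ lin (flat ps r) x - toℚ β *ℚ diff ps x +ℚ (lin r (g (rest ps x)) - lin r (rest ps x))
lin-step β [] {r} g x = ring (lin r (g x)) (lin r x) (toℚ β)
  where
  ring : ∀ a b c → a ≡ b - c *ℚ 0ℚ +ℚ (a - b)
  ring = solve-∀ ℚ-ring
lin-step false ((a , b) ∷ ps) {r} g (s ∷ t ∷ x) = ≡.trans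
  (cong (λ u → a *ℚ toℚ s +ℚ (b *ℚ toℚ t +ℚ u)) (lin-step false ps g x))
  (ring (a *ℚ toℚ s) (b *ℚ toℚ t) (lin (flat ps r) x) (diff ps x) ((a - b) *ℚ (toℚ s - toℚ t)) (lin r (g (rest ps x)) - lin r (rest ps x)))
  where
  ring : ∀ a b l d e f → a +ℚ (b +ℚ (l - 0ℚ *ℚ d +ℚ f)) ≡ a +ℚ (b +ℚ l) - 0ℚ *ℚ (e +ℚ d) +ℚ f
  ring = solve-∀ ℚ-ring
lin-step true ((a , b) ∷ ps) {r} g (s ∷ t ∷ x) = ≡.trans
  (cong (λ u → a *ℚ toℚ t +ℚ (b *ℚ toℚ s +ℚ u)) (lin-step true ps g x))
  (ring a b (toℚ s) (toℚ t) (lin (flat ps r) x) (diff ps x) (lin r (g (rest ps x)) - lin r (rest ps x)))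
  where
  ring : ∀ a b s t l d f → a *ℚ t +ℚ (b *ℚ s +ℚ (l - 1ℚ *ℚ d +ℚ f)) ≡
    a *ℚ s +ℚ (b *ℚ t +ℚ l) - 1ℚ *ℚ ((a - b) *ℚ (s - t) +ℚ d) +ℚ f
  ring = solve-∀ ℚ-ring

-- Moments of pair differences

2ℚ 4ℚ 12ℚ 24ℚ : ℚ
2ℚ = + 2 / 1
4ℚ = + 4 / 1
12ℚ = + 12 / 1
24ℚ = + 24 / 1

quad : ℚ → ℚ
quad a = sq a *ℚ sq a

gaps² : List Pair → ℚ
gaps² []             = 0ℚ
gaps² ((a , b) ∷ ps) = sq (a - b) +ℚ gaps² ps

-- The second elementary symmetric polynomial of the squared differences; it carries the mixed terms
-- dᵢ² dⱼ² of the fourth moment.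
gaps²² : List Pair → ℚ
gaps²² []             = 0ℚ
gaps²² ((a , b) ∷ ps) = sq (a - b) *ℚ gaps² ps +ℚ gaps²² ps

gaps⁴ : List Pair → ℚ
gaps⁴ []             = 0ℚ
gaps⁴ ((a , b) ∷ ps) = quad (a - b) +ℚ gaps⁴ ps

-- The mass of the points where one (two) prescribed pairs are split in a prescribed way;
-- set to 0 when ps has too few pairs, where it only meets vanishing factors.
split₁ split₂ : List Pair → List ℚ → (ℕ → ℚ) → ℚ
split₁ []           r w = 0ℚ
split₁ (_ ∷ ps)     r w = mass (length (flat ps r)) (w ∘ suc)
split₂ []           r w = 0ℚ
split₂ (_ ∷ [])     r w = 0ℚ
split₂ (_ ∷ _ ∷ ps) r w = mass (length (flat ps r)) (w ∘ suc ∘ suc)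

-- Pascal's rule applied twice: one more pair without prescription adds two free coordinates. The
-- factor `g ps` covers the empty list, where `split₁` is a default 0.
pascal₁ : ∀ (g : List Pair → ℚ) → g [] ≡ 0ℚ → ∀ p ps r w →
  g ps *ℚ (split₁ ps r w +ℚ 2ℚ *ℚ split₁ ps r (w ∘ suc) +ℚ split₁ ps r (w ∘ suc ∘ suc)) ≡ g ps *ℚ split₁ (p ∷ ps) r w
pascal₁ g g[]≡0 p [] r w = ≡.trans (cong (_*ℚ (0ℚ +ℚ 2ℚ *ℚ 0ℚ +ℚ 0ℚ)) g[]≡0)
  (≡.trans (ring (mass (length r) (w ∘ suc))) (cong (_*ℚ mass (length r) (w ∘ suc)) (sym g[]≡0)))
  where
  ring : ∀ a → 0ℚ *ℚ (0ℚ +ℚ 2ℚ *ℚ 0ℚ +ℚ 0ℚ) ≡ 0ℚ *ℚ a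
  ring = solve-∀ ℚ-ring
pascal₁ g g[]≡0 p (p′ ∷ ps) r w = cong (g (p′ ∷ ps) *ℚ_)
  (ring (split₁ (p ∷ ps) r w) (split₁ (p ∷ ps) r (w ∘ suc)) (split₁ (p ∷ ps) r (w ∘ suc ∘ suc)))
  where
  ring : ∀ a b c → a +ℚ 2ℚ *ℚ b +ℚ c ≡ (a +ℚ b) +ℚ (b +ℚ c)
  ring = solve-∀ ℚ-ring

pascal₂ : ∀ p ps r w → gaps²² ps *ℚ (split₂ ps r w +ℚ 2ℚ *ℚ split₂ ps r (w ∘ suc) +ℚ split₂ ps r (w ∘ suc ∘ suc))
  ≡ gaps²² ps *ℚ split₂ (p ∷ ps) r w
pascal₂ p [] r w = ℚₚ.*-zeroˡ 0ℚ
pascal₂ p ((a , b) ∷ []) r w = ring (sq (a - b)) (split₂ (p ∷ (a , b) ∷ []) r w)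
  where
  ring : ∀ d a → (d *ℚ 0ℚ +ℚ 0ℚ) *ℚ (0ℚ +ℚ 2ℚ *ℚ 0ℚ +ℚ 0ℚ) ≡ (d *ℚ 0ℚ +ℚ 0ℚ) *ℚ a
  ring = solve-∀ ℚ-ring
pascal₂ p (p′ ∷ p″ ∷ ps) r w = cong (gaps²² (p′ ∷ p″ ∷ ps) *ℚ_)
  (ring (split₂ (p ∷ p ∷ ps) r w) (split₂ (p ∷ p ∷ ps) r (w ∘ suc)) (split₂ (p ∷ p ∷ ps) r (w ∘ suc ∘ suc)))
  where
  ring : ∀ a b c → a +ℚ 2ℚ *ℚ b +ℚ c ≡ (a +ℚ b) +ℚ (b +ℚ c)
  ring = solve-∀ ℚ-ring

-- The four states of the first pair: equal bits leave the difference alone, split bits shift it by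
-- a - b in either direction.
E-diff : ∀ (φ : ℚ → ℚ) a b ps {r} w → let m = length (flat ps r) in
  E (suc (suc m)) w (φ ∘ diff ((a , b) ∷ ps)) ≡
  E m w (φ ∘ diff ps) +ℚ E m (w ∘ suc) (λ x → φ (diff ps x - (a - b)) +ℚ φ (diff ps x +ℚ (a - b)))
    +ℚ E m (w ∘ suc ∘ suc) (φ ∘ diff ps)
E-diff φ a b ps {r} w = begin
  (E m w _ +ℚ E m (w ∘ suc) _) +ℚ (E m (w ∘ suc) _ +ℚ E m (w ∘ suc ∘ suc) _)
    ≡⟨ cong₂ _+ℚ_ (cong₂ _+ℚ_ (E-cong m (λ x → cong φ (zero₀ (a - b) (diff ps x))))
                              (E-cong m (λ x → cong φ (minus (a - b) (diff ps x)))))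
                  (cong₂ _+ℚ_ (E-cong m (λ x → cong φ (plus (a - b) (diff ps x))))
                              (E-cong m (λ x → cong φ (zero₁ (a - b) (diff ps x))))) ⟩
  (E m w (φ ∘ diff ps) +ℚ E m (w ∘ suc) (λ x → φ (diff ps x - (a - b))))
    +ℚ (E m (w ∘ suc) (λ x → φ (diff ps x +ℚ (a - b))) +ℚ E m (w ∘ suc ∘ suc) (φ ∘ diff ps))
    ≡⟨ assoc (E m w (φ ∘ diff ps)) (E m (w ∘ suc) (λ x → φ (diff ps x - (a - b))))
             (E m (w ∘ suc) (λ x → φ (diff ps x +ℚ (a - b)))) (E m (w ∘ suc ∘ suc) (φ ∘ diff ps)) ⟩
  E m w (φ ∘ diff ps) +ℚ (E m (w ∘ suc) (λ x → φ (diff ps x - (a - b)))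
    +ℚ E m (w ∘ suc) (λ x → φ (diff ps x +ℚ (a - b)))) +ℚ E m (w ∘ suc ∘ suc) (φ ∘ diff ps)
    ≡⟨ cong (λ t → E m w (φ ∘ diff ps) +ℚ t +ℚ E m (w ∘ suc ∘ suc) (φ ∘ diff ps))
         (E-+ m (λ x → φ (diff ps x - (a - b))) (λ x → φ (diff ps x +ℚ (a - b)))) ⟨
  _ ∎
  where
  open ≡-Reasoning
  m = length (flat ps r)
  zero₀ : ∀ d x → d *ℚ (0ℚ - 0ℚ) +ℚ x ≡ x
  zero₀ = solve-∀ ℚ-ring
  zero₁ : ∀ d x → d *ℚ (1ℚ - 1ℚ) +ℚ x ≡ x
  zero₁ = solve-∀ ℚ-ring
  minus : ∀ d x → d *ℚ (0ℚ - 1ℚ) +ℚ x ≡ x - d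
  minus = solve-∀ ℚ-ring
  plus : ∀ d x → d *ℚ (1ℚ - 0ℚ) +ℚ x ≡ x +ℚ d
  plus = solve-∀ ℚ-ring
  assoc : ∀ a b c d → (a +ℚ b) +ℚ (c +ℚ d) ≡ a +ℚ (b +ℚ c) +ℚ d
  assoc = solve-∀ ℚ-ring

-- The two orientations of a split pair have equal mass, so terms odd in some dᵢ cancel and only
-- squares survive. The factor 2 counts the orientations.
diff-moment₂ : ∀ ps r w → E (length (flat ps r)) w (sq ∘ diff ps) ≡ 2ℚ *ℚ gaps² ps *ℚ split₁ ps r w
diff-moment₂ [] r w = ≡.trans (E-const (length r) (sq 0ℚ)) (ring (mass (length r) w))
  where
  ring : ∀ a → 0ℚ *ℚ 0ℚ *ℚ a ≡ 2ℚ *ℚ 0ℚ *ℚ 0ℚ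
  ring = solve-∀ ℚ-ring
diff-moment₂ ((a , b) ∷ ps) r w = begin
  E (suc (suc m)) w (sq ∘ diff ((a , b) ∷ ps))
    ≡⟨ E-diff sq a b ps w ⟩
  E m w (sq ∘ diff ps) +ℚ E m (w ∘ suc) (λ x → sq (diff ps x - d) +ℚ sq (diff ps x +ℚ d)) +ℚ E m (w ∘ suc ∘ suc) (sq ∘ diff ps)
    ≡⟨ cong₂ _+ℚ_ (cong₂ _+ℚ_ (diff-moment₂ ps r w) middle) (diff-moment₂ ps r (w ∘ suc ∘ suc)) ⟩
  2ℚ *ℚ g *ℚ s₀ +ℚ (2ℚ *ℚ (2ℚ *ℚ g *ℚ s₁) +ℚ (2ℚ *ℚ sq d) *ℚ M) +ℚ 2ℚ *ℚ g *ℚ s₂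
    ≡⟨ collect g s₀ s₁ s₂ (sq d) M ⟩
  2ℚ *ℚ (g *ℚ (s₀ +ℚ 2ℚ *ℚ s₁ +ℚ s₂)) +ℚ (2ℚ *ℚ sq d) *ℚ M
    ≡⟨ cong (λ t → 2ℚ *ℚ t +ℚ (2ℚ *ℚ sq d) *ℚ M) (pascal₁ gaps² ≡.refl (a , b) ps r w) ⟩
  2ℚ *ℚ (g *ℚ M) +ℚ (2ℚ *ℚ sq d) *ℚ M
    ≡⟨ factor g (sq d) M ⟩
  2ℚ *ℚ (sq d +ℚ g) *ℚ M ∎
  where
  open ≡-Reasoning
  m = length (flat ps r)
  d = a - b
  g = gaps² ps
  M = mass m (w ∘ suc)
  s₀ = split₁ ps r w
  s₁ = split₁ ps r (w ∘ suc)
  s₂ = split₁ ps r (w ∘ suc ∘ suc)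
  expand : ∀ x d → sq (x - d) +ℚ sq (x +ℚ d) ≡ 2ℚ *ℚ sq x +ℚ (2ℚ *ℚ sq d) *ℚ 1ℚ
  expand = λ x d → ring x d
    where
    ring : ∀ x d → (x - d) *ℚ (x - d) +ℚ (x +ℚ d) *ℚ (x +ℚ d) ≡ 2ℚ *ℚ (x *ℚ x) +ℚ (2ℚ *ℚ (d *ℚ d)) *ℚ 1ℚ
    ring = solve-∀ ℚ-ring
  middle : E m (w ∘ suc) (λ x → sq (diff ps x - d) +ℚ sq (diff ps x +ℚ d)) ≡ 2ℚ *ℚ (2ℚ *ℚ g *ℚ s₁) +ℚ (2ℚ *ℚ sq d) *ℚ M
  middle = begin
    _ ≡⟨ E-cong m (λ x → expand (diff ps x) d) ⟩
    _ ≡⟨ E-lin m 2ℚ (2ℚ *ℚ sq d) (sq ∘ diff ps) (λ _ → 1ℚ) ⟩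
    2ℚ *ℚ E m (w ∘ suc) (sq ∘ diff ps) +ℚ (2ℚ *ℚ sq d) *ℚ M
      ≡⟨ cong (λ t → 2ℚ *ℚ t +ℚ (2ℚ *ℚ sq d) *ℚ M) (diff-moment₂ ps r (w ∘ suc)) ⟩
    _ ∎
  collect : ∀ g a b c d m → 2ℚ *ℚ g *ℚ a +ℚ (2ℚ *ℚ (2ℚ *ℚ g *ℚ b) +ℚ (2ℚ *ℚ d) *ℚ m) +ℚ 2ℚ *ℚ g *ℚ c
    ≡ 2ℚ *ℚ (g *ℚ (a +ℚ 2ℚ *ℚ b +ℚ c)) +ℚ (2ℚ *ℚ d) *ℚ m
  collect = solve-∀ ℚ-ring
  factor : ∀ g d m → 2ℚ *ℚ (g *ℚ m) +ℚ (2ℚ *ℚ d) *ℚ m ≡ 2ℚ *ℚ (d +ℚ g) *ℚ m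
  factor = solve-∀ ℚ-ring

-- By the same symmetry only dᵢ⁴ and dᵢ² dⱼ² survive. The latter has coefficient 6 in the fourth
-- power and four orientations, hence 24.
diff-moment₄ : ∀ ps r w → E (length (flat ps r)) w (quad ∘ diff ps)
  ≡ 2ℚ *ℚ gaps⁴ ps *ℚ split₁ ps r w +ℚ 24ℚ *ℚ gaps²² ps *ℚ split₂ ps r w
diff-moment₄ [] r w = ≡.trans (E-const (length r) (quad 0ℚ)) (ring (mass (length r) w))
  where
  ring : ∀ a → 0ℚ *ℚ 0ℚ *ℚ (0ℚ *ℚ 0ℚ) *ℚ a ≡ 2ℚ *ℚ 0ℚ *ℚ 0ℚ +ℚ 24ℚ *ℚ 0ℚ *ℚ 0ℚ
  ring = solve-∀ ℚ-ring
diff-moment₄ ((a , b) ∷ ps) r w = begin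
  E (suc (suc m)) w (quad ∘ diff ((a , b) ∷ ps))
    ≡⟨ E-diff quad a b ps w ⟩
  E m w (quad ∘ diff ps) +ℚ E m (w ∘ suc) (λ x → quad (diff ps x - d) +ℚ quad (diff ps x +ℚ d)) +ℚ E m (w ∘ suc ∘ suc) (quad ∘ diff ps)
    ≡⟨ cong₂ _+ℚ_ (cong₂ _+ℚ_ (diff-moment₄ ps r w) middle) (diff-moment₄ ps r (w ∘ suc ∘ suc)) ⟩
  (2ℚ *ℚ h *ℚ s₀ +ℚ 24ℚ *ℚ k *ℚ t₀)
    +ℚ (2ℚ *ℚ (2ℚ *ℚ h *ℚ s₁ +ℚ 24ℚ *ℚ k *ℚ t₁) +ℚ 1ℚ *ℚ ((12ℚ *ℚ sq d) *ℚ (2ℚ *ℚ g *ℚ s₁) +ℚ (2ℚ *ℚ quad d) *ℚ M))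
    +ℚ (2ℚ *ℚ h *ℚ s₂ +ℚ 24ℚ *ℚ k *ℚ t₂)
    ≡⟨ collect h k g s₀ s₁ s₂ t₀ t₁ t₂ (sq d) (quad d) M ⟩
  2ℚ *ℚ (h *ℚ (s₀ +ℚ 2ℚ *ℚ s₁ +ℚ s₂)) +ℚ 24ℚ *ℚ (k *ℚ (t₀ +ℚ 2ℚ *ℚ t₁ +ℚ t₂)) +ℚ 24ℚ *ℚ sq d *ℚ (g *ℚ s₁) +ℚ 2ℚ *ℚ quad d *ℚ M
    ≡⟨ cong₂ (λ x y → x +ℚ y +ℚ 2ℚ *ℚ quad d *ℚ M)
         (cong₂ (λ x y → 2ℚ *ℚ x +ℚ 24ℚ *ℚ y) (pascal₁ gaps⁴ ≡.refl (a , b) ps r w) (pascal₂ (a , b) ps r w))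
         (cong (24ℚ *ℚ sq d *ℚ_) (shift ps)) ⟩
  2ℚ *ℚ (h *ℚ M) +ℚ 24ℚ *ℚ (k *ℚ N) +ℚ 24ℚ *ℚ sq d *ℚ (g *ℚ N) +ℚ 2ℚ *ℚ quad d *ℚ M
    ≡⟨ factor h k g (sq d) (quad d) M N ⟩
  2ℚ *ℚ (quad d +ℚ h) *ℚ M +ℚ 24ℚ *ℚ (sq d *ℚ g +ℚ k) *ℚ N ∎
  where
  open ≡-Reasoning
  m = length (flat ps r)
  d = a - b
  g = gaps² ps
  h = gaps⁴ ps
  k = gaps²² ps
  M = mass m (w ∘ suc)
  N = split₂ ((a , b) ∷ ps) r w
  s₀ = split₁ ps r w
  s₁ = split₁ ps r (w ∘ suc)
  s₂ = split₁ ps r (w ∘ suc ∘ suc)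
  t₀ = split₂ ps r w
  t₁ = split₂ ps r (w ∘ suc)
  t₂ = split₂ ps r (w ∘ suc ∘ suc)
  shift : ∀ ps → gaps² ps *ℚ split₁ ps r (w ∘ suc) ≡ gaps² ps *ℚ split₂ ((a , b) ∷ ps) r w
  shift []       = ≡.refl
  shift (_ ∷ ps) = ≡.refl
  expand : ∀ x d → quad (x - d) +ℚ quad (x +ℚ d) ≡ 2ℚ *ℚ quad x +ℚ 1ℚ *ℚ ((12ℚ *ℚ sq d) *ℚ sq x +ℚ (2ℚ *ℚ quad d) *ℚ 1ℚ)
  expand = λ x d → ring x d
    where
    ring : ∀ x d → (x - d) *ℚ (x - d) *ℚ ((x - d) *ℚ (x - d)) +ℚ (x +ℚ d) *ℚ (x +ℚ d) *ℚ ((x +ℚ d) *ℚ (x +ℚ d))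
      ≡ 2ℚ *ℚ (x *ℚ x *ℚ (x *ℚ x)) +ℚ 1ℚ *ℚ ((12ℚ *ℚ (d *ℚ d)) *ℚ (x *ℚ x) +ℚ (2ℚ *ℚ (d *ℚ d *ℚ (d *ℚ d))) *ℚ 1ℚ)
    ring = solve-∀ ℚ-ring
  middle : E m (w ∘ suc) (λ x → quad (diff ps x - d) +ℚ quad (diff ps x +ℚ d))
    ≡ 2ℚ *ℚ (2ℚ *ℚ h *ℚ s₁ +ℚ 24ℚ *ℚ k *ℚ t₁) +ℚ 1ℚ *ℚ ((12ℚ *ℚ sq d) *ℚ (2ℚ *ℚ g *ℚ s₁) +ℚ (2ℚ *ℚ quad d) *ℚ M)
  middle = begin
    _ ≡⟨ E-cong m (λ x → expand (diff ps x) d) ⟩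
    _ ≡⟨ E-lin m 2ℚ 1ℚ (quad ∘ diff ps) (λ x → (12ℚ *ℚ sq d) *ℚ sq (diff ps x) +ℚ (2ℚ *ℚ quad d) *ℚ 1ℚ) ⟩
    _ ≡⟨ cong₂ (λ x y → 2ℚ *ℚ x +ℚ 1ℚ *ℚ y) (diff-moment₄ ps r (w ∘ suc))
          (≡.trans (E-lin m (12ℚ *ℚ sq d) (2ℚ *ℚ quad d) (sq ∘ diff ps) (λ _ → 1ℚ))
            (cong (λ t → (12ℚ *ℚ sq d) *ℚ t +ℚ (2ℚ *ℚ quad d) *ℚ M) (diff-moment₂ ps r (w ∘ suc)))) ⟩
    _ ∎
  collect : ∀ h k g s₀ s₁ s₂ t₀ t₁ t₂ d d′ m →
    (2ℚ *ℚ h *ℚ s₀ +ℚ 24ℚ *ℚ k *ℚ t₀)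
    +ℚ (2ℚ *ℚ (2ℚ *ℚ h *ℚ s₁ +ℚ 24ℚ *ℚ k *ℚ t₁) +ℚ 1ℚ *ℚ ((12ℚ *ℚ d) *ℚ (2ℚ *ℚ g *ℚ s₁) +ℚ (2ℚ *ℚ d′) *ℚ m))
    +ℚ (2ℚ *ℚ h *ℚ s₂ +ℚ 24ℚ *ℚ k *ℚ t₂) ≡
    2ℚ *ℚ (h *ℚ (s₀ +ℚ 2ℚ *ℚ s₁ +ℚ s₂)) +ℚ 24ℚ *ℚ (k *ℚ (t₀ +ℚ 2ℚ *ℚ t₁ +ℚ t₂)) +ℚ 24ℚ *ℚ d *ℚ (g *ℚ s₁) +ℚ 2ℚ *ℚ d′ *ℚ m
  collect = solve-∀ ℚ-ring
  factor : ∀ h k g d d′ m n → 2ℚ *ℚ (h *ℚ m) +ℚ 24ℚ *ℚ (k *ℚ n) +ℚ 24ℚ *ℚ d *ℚ (g *ℚ n) +ℚ 2ℚ *ℚ d′ *ℚ m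
    ≡ 2ℚ *ℚ (d′ +ℚ h) *ℚ m +ℚ 24ℚ *ℚ (d *ℚ g +ℚ k) *ℚ n
  factor = solve-∀ ℚ-ring

gaps²-nonneg : ∀ ps → 0ℚ ≤ℚ gaps² ps
gaps²-nonneg []             = ℚₚ.≤-refl
gaps²-nonneg ((a , b) ∷ ps) = sq≥0 (a - b) ⊕ gaps²-nonneg ps

2gaps²²≤ : ∀ ps → 2ℚ *ℚ gaps²² ps ≤ℚ sq (gaps² ps)
2gaps²²≤ []             = ℚₚ.≤-refl
2gaps²²≤ ((a , b) ∷ ps) = by (ring (sq (a - b)) (gaps² ps) (gaps²² ps)) (gap (2gaps²²≤ ps) ⊕ sq≥0 (sq (a - b)))
  where
  ring : ∀ d g k → (d +ℚ g) *ℚ (d +ℚ g) - 2ℚ *ℚ (d *ℚ g +ℚ k) ≡ (g *ℚ g - 2ℚ *ℚ k) +ℚ d *ℚ d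
  ring = solve-∀ ℚ-ring

GapBelow : ℚ → Pair → Set
GapBelow D (a , b) = sq (a - b) ≤ℚ D

gaps⁴≤ : ∀ {D ps} → All (GapBelow D) ps → gaps⁴ ps ≤ℚ D *ℚ gaps² ps
gaps⁴≤ {D} [] = subst (0ℚ ≤ℚ_) (sym (ℚₚ.*-zeroʳ D)) ℚₚ.≤-refl
gaps⁴≤ {D} {(a , b) ∷ ps} (d≤D ∷ small) =
  by (ring D (sq (a - b)) (gaps² ps) (gaps⁴ ps)) (gap (gaps⁴≤ small) ⊕ sq≥0 (a - b) ⊗ gap d≤D)
  where
  ring : ∀ D d g h → D *ℚ (d +ℚ g) - (d *ℚ d +ℚ h) ≡ (D *ℚ g - h) +ℚ d *ℚ (D - d)
  ring = solve-∀ ℚ-ring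

-- Pairs with close coefficients

-- What the argument uses of the slice weight w(j) = [j = k] / C(n,k) with 2 ≤ k ≤ n/2 and p = k/n.
record SliceWeight (n : ℕ) (w : ℕ → ℚ) (p : ℚ) : Set where
  field
    w≥0      : NonNeg w
    p≥0      : 0ℚ ≤ℚ p
    p≤½      : p ≤ℚ ½
    4≤n      : 4 ≤ n
    mass-n   : mass n w ≡ 1ℚ
    one-in   : ∀ m → 1 + m ≡ n → mass m (w ∘ suc) ≡ p
    two-in≤  : ∀ m → 2 + m ≡ n → mass m (w ∘ suc ∘ suc) ≤ℚ p *ℚ p
    two-in≥  : ∀ m → 2 + m ≡ n → p *ℚ p ≤ℚ 2ℚ *ℚ mass m (w ∘ suc ∘ suc)
    split≥   : ∀ m → 2 + m ≡ n → p ≤ℚ 2ℚ *ℚ mass m (w ∘ suc)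
    three-in : ∀ m → 3 + m ≡ n → mass m (w ∘ suc ∘ suc ∘ suc) ≤ℚ p *ℚ mass (1 + m) (w ∘ suc ∘ suc)
    split₂≤  : ∀ m → 4 + m ≡ n → mass m (w ∘ suc ∘ suc) ≤ℚ p *ℚ mass (2 + m) (w ∘ suc)
    split₂≥  : ∀ m → 4 + m ≡ n → p *ℚ p ≤ℚ + 8 / 1 *ℚ mass m (w ∘ suc ∘ suc)

-- D = (2θ)² and H = θ².
8ℚ ε₀ θ D H : ℚ
8ℚ = + 8 / 1
ε₀ = + 1 / 10000000
θ = + 1 / 20
D = + 1 / 100
H = + 1 / 400

id-preserves : ∀ r → MassPreserving r id
id-preserves r w F = ≡.refl

-- X² - 4X⁴ ≤ dist(X, {0, ±1})², and f(x) - f(x′) is one of 0, ±1.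
dist-bound : ∀ s t l X → sq X - 4ℚ *ℚ quad X ≤ℚ 2ℚ *ℚ sq (toℚ s - l) +ℚ 2ℚ *ℚ sq (toℚ t - (l - X))
dist-bound true true l X = by (ring l X) (sq≥0 (2ℚ *ℚ (1ℚ - l) +ℚ X) ⊕ pos {4ℚ} ⊗ sq≥0 (X *ℚ X))
  where
  ring : ∀ l X → 2ℚ *ℚ ((1ℚ - l) *ℚ (1ℚ - l)) +ℚ 2ℚ *ℚ ((1ℚ - (l - X)) *ℚ (1ℚ - (l - X))) - (X *ℚ X - 4ℚ *ℚ (X *ℚ X *ℚ (X *ℚ X)))
    ≡ (2ℚ *ℚ (1ℚ - l) +ℚ X) *ℚ (2ℚ *ℚ (1ℚ - l) +ℚ X) +ℚ 4ℚ *ℚ ((X *ℚ X) *ℚ (X *ℚ X))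
  ring = solve-∀ ℚ-ring
dist-bound false false l X = by (ring l X) (sq≥0 (2ℚ *ℚ (0ℚ - l) +ℚ X) ⊕ pos {4ℚ} ⊗ sq≥0 (X *ℚ X))
  where
  ring : ∀ l X → 2ℚ *ℚ ((0ℚ - l) *ℚ (0ℚ - l)) +ℚ 2ℚ *ℚ ((0ℚ - (l - X)) *ℚ (0ℚ - (l - X))) - (X *ℚ X - 4ℚ *ℚ (X *ℚ X *ℚ (X *ℚ X)))
    ≡ (2ℚ *ℚ (0ℚ - l) +ℚ X) *ℚ (2ℚ *ℚ (0ℚ - l) +ℚ X) +ℚ 4ℚ *ℚ ((X *ℚ X) *ℚ (X *ℚ X))
  ring = solve-∀ ℚ-ring
dist-bound true false l X = by (ring l X)
  (sq≥0 ((1ℚ - l) - (l - X)) ⊕ sq≥0 (2ℚ *ℚ (X *ℚ X) - ½) ⊕ pos {2ℚ} ⊗ sq≥0 (X - ½) ⊕ pos {+ 1 / 4})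
  where
  ring : ∀ l X → 2ℚ *ℚ ((1ℚ - l) *ℚ (1ℚ - l)) +ℚ 2ℚ *ℚ ((0ℚ - (l - X)) *ℚ (0ℚ - (l - X))) - (X *ℚ X - 4ℚ *ℚ (X *ℚ X *ℚ (X *ℚ X)))
    ≡ ((1ℚ - l) - (l - X)) *ℚ ((1ℚ - l) - (l - X)) +ℚ (2ℚ *ℚ (X *ℚ X) - ½) *ℚ (2ℚ *ℚ (X *ℚ X) - ½)
      +ℚ 2ℚ *ℚ ((X - ½) *ℚ (X - ½)) +ℚ + 1 / 4
  ring = solve-∀ ℚ-ring
dist-bound false true l X = by (ring l X)
  (sq≥0 ((0ℚ - l) +ℚ (1ℚ - (l - X))) ⊕ sq≥0 (2ℚ *ℚ (X *ℚ X) - ½) ⊕ pos {2ℚ} ⊗ sq≥0 (X +ℚ ½) ⊕ pos {+ 1 / 4})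
  where
  ring : ∀ l X → 2ℚ *ℚ ((0ℚ - l) *ℚ (0ℚ - l)) +ℚ 2ℚ *ℚ ((1ℚ - (l - X)) *ℚ (1ℚ - (l - X))) - (X *ℚ X - 4ℚ *ℚ (X *ℚ X *ℚ (X *ℚ X)))
    ≡ ((0ℚ - l) +ℚ (1ℚ - (l - X))) *ℚ ((0ℚ - l) +ℚ (1ℚ - (l - X))) +ℚ (2ℚ *ℚ (X *ℚ X) - ½) *ℚ (2ℚ *ℚ (X *ℚ X) - ½)
      +ℚ 2ℚ *ℚ ((X +ℚ ½) *ℚ (X +ℚ ½)) +ℚ + 1 / 4
  ring = solve-∀ ℚ-ring

sq-err-swap : ∀ ps r f x → sq (diff ps x) - 4ℚ *ℚ quad (diff ps x) ≤ℚ
  2ℚ *ℚ sq (err (flat ps r) f x) +ℚ 2ℚ *ℚ sq (err (flat ps r) f (step true ps id x))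
sq-err-swap ps r f x = subst
  (λ t → sq X - 4ℚ *ℚ quad X ≤ℚ 2ℚ *ℚ sq (toℚ (f x) - lin (flat ps r) x) +ℚ 2ℚ *ℚ sq (toℚ (f x′) - t))
  (sym (≡.trans (lin-step true ps id x) (ring (lin (flat ps r) x) X (lin r (rest ps x)))))
  (dist-bound (f x) (f x′) (lin (flat ps r) x) X)
  where
  X = diff ps x
  x′ = step true ps id x
  ring : ∀ l X m → l - 1ℚ *ℚ X +ℚ (m - m) ≡ l - X
  ring = solve-∀ ℚ-ring

Near-ε≥0 : ∀ {w ε c} → NonNeg w → Near w ε c → 0ℚ ≤ℚ ε
Near-ε≥0 {c = c} w≥0 (f , near) = ℚₚ.≤-trans (E-nonneg (length c) w≥0 (λ x → sq≥0 (err c f x))) near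

-- Integrates `dist-bound`: the exchange preserves the measure, so both errors on its right side
-- have mean at most ε, while both moments on its left side are known exactly.
moments-bound : ∀ {w ε} ps r → NonNeg w → Near w ε (flat ps r) →
  2ℚ *ℚ gaps² ps *ℚ split₁ ps r w - 4ℚ *ℚ (2ℚ *ℚ gaps⁴ ps *ℚ split₁ ps r w +ℚ 24ℚ *ℚ gaps²² ps *ℚ split₂ ps r w) ≤ℚ 4ℚ *ℚ ε
moments-bound {w} {ε} ps r w≥0 (f , near) = begin
  2ℚ *ℚ gaps² ps *ℚ split₁ ps r w - 4ℚ *ℚ (2ℚ *ℚ gaps⁴ ps *ℚ split₁ ps r w +ℚ 24ℚ *ℚ gaps²² ps *ℚ split₂ ps r w)
    ≡⟨ cong₂ (λ a b → a - 4ℚ *ℚ b) (diff-moment₂ ps r w) (diff-moment₄ ps r w) ⟨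
  E n w (sq ∘ diff ps) - 4ℚ *ℚ E n w (quad ∘ diff ps)
    ≡⟨ coeffs (E n w (sq ∘ diff ps)) (E n w (quad ∘ diff ps)) ⟩
  1ℚ *ℚ E n w (sq ∘ diff ps) +ℚ (- 4ℚ) *ℚ E n w (quad ∘ diff ps)
    ≡⟨ E-lin n 1ℚ (- 4ℚ) (sq ∘ diff ps) (quad ∘ diff ps) ⟨
  E n w (λ x → 1ℚ *ℚ sq (diff ps x) +ℚ (- 4ℚ) *ℚ quad (diff ps x))
    ≤⟨ E-mono n w≥0 (λ x → subst (_≤ℚ bound x) (coeffs (sq (diff ps x)) (quad (diff ps x))) (sq-err-swap ps r f x)) ⟩
  E n w bound
    ≡⟨ E-lin n 2ℚ 2ℚ e² (e² ∘ step true ps id) ⟩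
  2ℚ *ℚ E n w e² +ℚ 2ℚ *ℚ E n w (e² ∘ step true ps id)
    ≡⟨ cong (λ t → 2ℚ *ℚ E n w e² +ℚ 2ℚ *ℚ t) (step-preserves true ps {r} (id-preserves r) w e²) ⟩
  2ℚ *ℚ E n w e² +ℚ 2ℚ *ℚ E n w e²
    ≤⟨ by (ring ε (E n w e²)) (pos {4ℚ} ⊗ gap near) ⟩
  4ℚ *ℚ ε ∎
  where
  open ℚₚ.≤-Reasoning
  n = length (flat ps r)
  e² = λ x → sq (err (flat ps r) f x)
  bound = λ x → 2ℚ *ℚ e² x +ℚ 2ℚ *ℚ e² (step true ps id x)
  coeffs : ∀ a b → a - 4ℚ *ℚ b ≡ 1ℚ *ℚ a +ℚ (- 4ℚ) *ℚ b
  coeffs = solve-∀ ℚ-ring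
  ring : ∀ ε e → 4ℚ *ℚ ε - (2ℚ *ℚ e +ℚ 2ℚ *ℚ e) ≡ 4ℚ *ℚ (ε - e)
  ring = solve-∀ ℚ-ring

flat-↭ : ∀ ps {r r′} → r ↭ r′ → flat ps r ↭ flat ps r′
flat-↭ []             π = π
flat-↭ ((a , b) ∷ ps) π = prep a (prep b (flat-↭ ps π))

flat-shift : ∀ a b ps {r} → a ∷ b ∷ flat ps r ↭ flat ps (a ∷ b ∷ r)
flat-shift a b []             = refl
flat-shift a b ((a′ , b′) ∷ ps) {r} = trans (prep a (swap b a′ refl)) (trans (swap a a′ (swap b b′ refl))
  (prep a′ (trans (swap a b′ refl) (prep b′ (flat-shift a b ps)))))

gaps²²-nonneg : ∀ ps → 0ℚ ≤ℚ gaps²² ps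
gaps²²-nonneg []             = ℚₚ.≤-refl
gaps²²-nonneg ((a , b) ∷ ps) = sq≥0 (a - b) ⊗ gaps²-nonneg ps ⊕ gaps²²-nonneg ps

module Light {n w p ε} (S : SliceWeight n w p) (ε≤ε₀ : ε ≤ℚ ε₀) where
  open SliceWeight S

  split₂≤split₁ : ∀ ps r → length (flat ps r) ≡ n → split₂ ps r w ≤ℚ p *ℚ split₁ ps r w
  split₂≤split₁ []           r len = subst (0ℚ ≤ℚ_) (sym (ℚₚ.*-zeroʳ p)) ℚₚ.≤-refl
  split₂≤split₁ (_ ∷ [])     r len = p≥0 ⊗ mass-nonneg (length r) (w≥0 ∘ suc)
  split₂≤split₁ (_ ∷ _ ∷ ps) r len = split₂≤ (length (flat ps r)) len

  -- Splitting off one pair, the bound for the others keeps p Σ d² below an absolute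
  -- constant, where the fourth moment is dominated by the second.
  light-pairs : ∀ ps r → length (flat ps r) ≡ n → Near w ε (flat ps r) → All (GapBelow D) ps →
    p *ℚ gaps² ps ≤ℚ 8ℚ *ℚ ε
  light-pairs [] r len near [] = subst (_≤ℚ 8ℚ *ℚ ε) (sym (ℚₚ.*-zeroʳ p)) (pos {8ℚ} ⊗ Near-ε≥0 {c = r} w≥0 near)
  light-pairs ((a , b) ∷ ps) r len near (d≤D ∷ small) = by
    (final p G (gaps⁴ qs) (gaps²² qs) s (split₂ qs r w) ε)
    -- Twice the moment bound reads 4 G s ≤ 8 ε + 16 h s + 192 k t, with h and k the values of
    -- `gaps⁴` and `gaps²²` and t that of `split₂`. The last two terms are at most 16 D G s and 96 p
    -- G · G s, that is, (4/25) G s and G s; finally p G ≤ 2 G s.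
    (pos {2ℚ} ⊗ gap (moments-bound qs r w≥0 near)
      ⊕ pos {+ 16 / 1} ⊗ s≥0 ⊗ gap (gaps⁴≤ {ps = qs} (d≤D ∷ small))
      ⊕ pos {+ 192 / 1} ⊗ gaps²²-nonneg qs ⊗ gap (split₂≤split₁ qs r len)
      ⊕ pos {+ 96 / 1} ⊗ p≥0 ⊗ s≥0 ⊗ gap (2gaps²²≤ qs)
      ⊕ pos {+ 96 / 1} ⊗ G≥0 ⊗ s≥0 ⊗ gap pG≤
      ⊕ pos {+ 21 / 25} ⊗ G≥0 ⊗ s≥0
      ⊕ G≥0 ⊗ gap (split≥ (length (flat ps r)) len))
    where
    qs = (a , b) ∷ ps
    G = gaps² qs
    s = split₁ qs r w
    s≥0 : 0ℚ ≤ℚ s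
    s≥0 = mass-nonneg (length (flat ps r)) (w≥0 ∘ suc)
    G≥0 = gaps²-nonneg qs
    ih : p *ℚ gaps² ps ≤ℚ 8ℚ *ℚ ε
    ih = light-pairs ps (a ∷ b ∷ r) (≡.trans (sym (↭-length (flat-shift a b ps))) len)
      (Near-↭ (flat-shift a b ps) near) small
    -- The other pairs contribute at most 8 ε by induction and the new one at most p D ≤ D / 2 = 1 /
    -- 200.
    pG≤ : p *ℚ G ≤ℚ + 1 / 96
    pG≤ = by (ring p (sq (a - b)) (gaps² ps) ε (+ 1 / 96) D ε₀)
      (gap ih ⊕ p≥0 ⊗ gap d≤D ⊕ pos {D} ⊗ gap p≤½ ⊕ pos {8ℚ} ⊗ gap ε≤ε₀ ⊕ pos {+ 1 / 96 - D *ℚ ½ - 8ℚ *ℚ ε₀})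
      where
      ring : ∀ p d g ε c D ε₀ → c - p *ℚ (d +ℚ g) ≡
        (8ℚ *ℚ ε - p *ℚ g) +ℚ p *ℚ (D - d) +ℚ D *ℚ (½ - p) +ℚ 8ℚ *ℚ (ε₀ - ε) +ℚ (c - D *ℚ ½ - 8ℚ *ℚ ε₀)
      ring = solve-∀ ℚ-ring
    final : ∀ p G h k s t ε → 8ℚ *ℚ ε - p *ℚ G ≡
      2ℚ *ℚ (4ℚ *ℚ ε - (2ℚ *ℚ G *ℚ s - 4ℚ *ℚ (2ℚ *ℚ h *ℚ s +ℚ 24ℚ *ℚ k *ℚ t)))
      +ℚ + 16 / 1 *ℚ s *ℚ (D *ℚ G - h)
      +ℚ + 192 / 1 *ℚ k *ℚ (p *ℚ s - t)
      +ℚ + 96 / 1 *ℚ p *ℚ s *ℚ (G *ℚ G - 2ℚ *ℚ k)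
      +ℚ + 96 / 1 *ℚ G *ℚ s *ℚ (+ 1 / 96 - p *ℚ G)
      +ℚ + 21 / 25 *ℚ G *ℚ s
      +ℚ G *ℚ (2ℚ *ℚ s - p)
    final = solve-∀ ℚ-ring

-- Pairs with distant coefficients

-- Indicators that all pairs read 00, and that one pair is split while all others read 00. Pairs 11
-- are excluded too, so that every bit but the split one is prescribed to be 0 and the mass of the
-- event is a mass on the remaining coordinates.
none one : ∀ ps {r} → Bits (flat ps r) → ℚ
none []       _                   = 1ℚ
none (_ ∷ ps) (false ∷ false ∷ x) = none ps x
none (_ ∷ ps) (false ∷ true ∷ x)  = 0ℚ
none (_ ∷ ps) (true ∷ _ ∷ x)      = 0ℚ
one []       _                   = 0ℚ
one (_ ∷ ps) (false ∷ false ∷ x) = one ps x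
one (_ ∷ ps) (false ∷ true ∷ x)  = none ps x
one (_ ∷ ps) (true ∷ false ∷ x)  = none ps x
one (_ ∷ ps) (true ∷ true ∷ x)   = 0ℚ

E-0* : ∀ n {w} F → E n w (λ x → 0ℚ *ℚ F x) ≡ 0ℚ
E-0* n {w} F = ≡.trans (E-* n 0ℚ F) (ℚₚ.*-zeroˡ (E n w F))

E-none : ∀ ps {r} w G → E (length (flat ps r)) w (λ x → none ps x *ℚ G (rest ps x)) ≡ E (length r) w G
E-none []       {r} w G = E-cong (length r) (λ x → ℚₚ.*-identityˡ (G x))
E-none (_ ∷ ps) {r} w G = begin
  _ ≡⟨ cong₂ _+ℚ_ (cong₂ _+ℚ_ (E-none ps w G) (E-0* m (G ∘ rest ps))) (cong₂ _+ℚ_ (E-0* m (G ∘ rest ps)) (E-0* m (G ∘ rest ps))) ⟩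
  (E (length r) w G +ℚ 0ℚ) +ℚ (0ℚ +ℚ 0ℚ) ≡⟨ ring (E (length r) w G) ⟩
  E (length r) w G ∎
  where
  open ≡-Reasoning
  m = length (flat ps r)
  ring : ∀ a → (a +ℚ 0ℚ) +ℚ (0ℚ +ℚ 0ℚ) ≡ a
  ring = solve-∀ ℚ-ring

-- The factor counts the choices of the split pair and of its orientation; each of them prescribes a
-- single 1.
E-one : ∀ ps {r} w G → E (length (flat ps r)) w (λ x → one ps x *ℚ G (rest ps x)) ≡ 2ℚ *ℚ q (length ps) *ℚ E (length r) (w ∘ suc) G
E-one []       {r} w G = ≡.trans (E-0* (length r) G) (ring (E (length r) (w ∘ suc) G))
  where
  ring : ∀ a → 0ℚ ≡ 2ℚ *ℚ 0ℚ *ℚ a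
  ring = solve-∀ ℚ-ring
E-one (_ ∷ ps) {r} w G = begin
  _ ≡⟨ cong₂ _+ℚ_ (cong₂ _+ℚ_ (E-one ps w G) (E-none ps (w ∘ suc) G)) (cong₂ _+ℚ_ (E-none ps (w ∘ suc) G) (E-0* m (G ∘ rest ps))) ⟩
  (2ℚ *ℚ q (length ps) *ℚ e +ℚ e) +ℚ (e +ℚ 0ℚ) ≡⟨ ring (q (length ps)) e ⟩
  2ℚ *ℚ (1ℚ +ℚ q (length ps)) *ℚ e ∎
  where
  open ≡-Reasoning
  m = length (flat ps r)
  e = E (length r) (w ∘ suc) G
  ring : ∀ l a → (2ℚ *ℚ l *ℚ a +ℚ a) +ℚ (a +ℚ 0ℚ) ≡ 2ℚ *ℚ (1ℚ +ℚ l) *ℚ a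
  ring = solve-∀ ℚ-ring

GapAbove : ℚ → Pair → Set
GapAbove h (a , b) = h ≤ℚ sq (a - b)

none-diff : ∀ ps {r} (x : Bits (flat ps r)) → none ps x ≡ 0ℚ ⊎ (none ps x ≡ 1ℚ × diff ps x ≡ 0ℚ)
none-diff []       x = inj₂ (≡.refl , ≡.refl)
none-diff ((a , b) ∷ ps) (false ∷ false ∷ x) with none-diff ps x
... | inj₁ z       = inj₁ z
... | inj₂ (o , d) = inj₂ (o , ≡.trans (cong ((a - b) *ℚ (0ℚ - 0ℚ) +ℚ_) d) (ring (a - b)))
  where
  ring : ∀ d → d *ℚ (0ℚ - 0ℚ) +ℚ 0ℚ ≡ 0ℚ
  ring = solve-∀ ℚ-ring
none-diff (_ ∷ ps) (false ∷ true ∷ x)  = inj₁ ≡.refl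
none-diff (_ ∷ ps) (true ∷ _ ∷ x)      = inj₁ ≡.refl

one-diff : ∀ {h ps} → All (GapAbove h) ps → ∀ {r} (x : Bits (flat ps r)) → one ps x ≡ 0ℚ ⊎ (one ps x ≡ 1ℚ × h ≤ℚ sq (diff ps x))
one-diff [] x = inj₁ ≡.refl
one-diff {h} {(a , b) ∷ ps} (big ∷ bigs) (false ∷ false ∷ x) with one-diff bigs x
... | inj₁ z       = inj₁ z
... | inj₂ (o , d) = inj₂ (o , subst (h ≤ℚ_) (cong sq (ring (a - b) (diff ps x))) d)
  where
  ring : ∀ d y → y ≡ d *ℚ (0ℚ - 0ℚ) +ℚ y
  ring = solve-∀ ℚ-ring
one-diff {h} {(a , b) ∷ ps} (big ∷ bigs) (false ∷ true ∷ x) with none-diff ps x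
... | inj₁ z       = inj₁ z
... | inj₂ (o , d) = inj₂ (o , subst (h ≤ℚ_)
  (≡.trans (ring (a - b)) (cong (λ t → sq ((a - b) *ℚ (0ℚ - 1ℚ) +ℚ t)) (sym d))) big)
  where
  ring : ∀ d → d *ℚ d ≡ (d *ℚ (0ℚ - 1ℚ) +ℚ 0ℚ) *ℚ (d *ℚ (0ℚ - 1ℚ) +ℚ 0ℚ)
  ring = solve-∀ ℚ-ring
one-diff {h} {(a , b) ∷ ps} (big ∷ bigs) (true ∷ false ∷ x) with none-diff ps x
... | inj₁ z       = inj₁ z
... | inj₂ (o , d) = inj₂ (o , subst (h ≤ℚ_)
  (≡.trans (ring (a - b)) (cong (λ t → sq ((a - b) *ℚ (1ℚ - 0ℚ) +ℚ t)) (sym d))) big)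
  where
  ring : ∀ d → d *ℚ d ≡ (d *ℚ (1ℚ - 0ℚ) +ℚ 0ℚ) *ℚ (d *ℚ (1ℚ - 0ℚ) +ℚ 0ℚ)
  ring = solve-∀ ℚ-ring
one-diff (_ ∷ _) (true ∷ true ∷ x) = inj₁ ≡.refl

four : ℚ → ℚ → ℚ → ℚ → ℚ
four a b c d = sq a +ℚ sq b +ℚ sq c +ℚ sq d

-- If f agrees at two points where ℓ differs by X, the two errors differ by X and their squares add
-- up to at least X² / 2; likewise for Y. Otherwise f changes under both exchanges, and then its
-- second difference is a nonzero integer, while that of ℓ is 0.
four-points : ∀ s t u v l X Y → H ≤ℚ sq X → H ≤ℚ sq Y →
  ½ *ℚ H ≤ℚ four (toℚ s - l) (toℚ t - (l - X)) (toℚ u - (l - Y)) (toℚ v - (l - X - Y))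
four-points s t u v l X Y H≤X² H≤Y² = cases s t u v
  where
  same₁₂ : ∀ a c d → ½ *ℚ H ≤ℚ four (a - l) (a - (l - X)) (c - (l - Y)) (d - (l - X - Y))
  same₁₂ a c d = by (ring a c d l X Y H)
    (pos {½} ⊗ gap H≤X² ⊕ pos {½} ⊗ sq≥0 ((a - l) +ℚ (a - (l - X))) ⊕ sq≥0 (c - (l - Y)) ⊕ sq≥0 (d - (l - X - Y)))
    where
    ring : ∀ a c d l X Y H →
      (a - l) *ℚ (a - l) +ℚ (a - (l - X)) *ℚ (a - (l - X)) +ℚ (c - (l - Y)) *ℚ (c - (l - Y)) +ℚ (d - (l - X - Y)) *ℚ (d - (l - X - Y)) - ½ *ℚ H
      ≡ ½ *ℚ (X *ℚ X - H) +ℚ ½ *ℚ (((a - l) +ℚ (a - (l - X))) *ℚ ((a - l) +ℚ (a - (l - X))))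
        +ℚ (c - (l - Y)) *ℚ (c - (l - Y)) +ℚ (d - (l - X - Y)) *ℚ (d - (l - X - Y))
    ring = solve-∀ ℚ-ring
  same₁₃ : ∀ a b d → ½ *ℚ H ≤ℚ four (a - l) (b - (l - X)) (a - (l - Y)) (d - (l - X - Y))
  same₁₃ a b d = by (ring a b d l X Y H)
    (pos {½} ⊗ gap H≤Y² ⊕ pos {½} ⊗ sq≥0 ((a - l) +ℚ (a - (l - Y))) ⊕ sq≥0 (b - (l - X)) ⊕ sq≥0 (d - (l - X - Y)))
    where
    ring : ∀ a b d l X Y H →
      (a - l) *ℚ (a - l) +ℚ (b - (l - X)) *ℚ (b - (l - X)) +ℚ (a - (l - Y)) *ℚ (a - (l - Y)) +ℚ (d - (l - X - Y)) *ℚ (d - (l - X - Y)) - ½ *ℚ H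
      ≡ ½ *ℚ (Y *ℚ Y - H) +ℚ ½ *ℚ (((a - l) +ℚ (a - (l - Y))) *ℚ ((a - l) +ℚ (a - (l - Y))))
        +ℚ (b - (l - X)) *ℚ (b - (l - X)) +ℚ (d - (l - X - Y)) *ℚ (d - (l - X - Y))
    ring = solve-∀ ℚ-ring
  -- The second difference a - b - c + d does not see l, X, Y.
  second : ∀ a b c d → 0ℚ ≤ℚ + 1 / 4 *ℚ sq (a - b - c +ℚ d) - ½ *ℚ H →
    ½ *ℚ H ≤ℚ four (a - l) (b - (l - X)) (c - (l - Y)) (d - (l - X - Y))
  second a b c d h = ℚₚ.≤-trans (by ≡.refl h)
    (by (≡.trans (cong (λ t → four e₁ e₂ e₃ e₄ - + 1 / 4 *ℚ sq t) (cancel a b c d l X Y)) (ring e₁ e₂ e₃ e₄))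
      (pos {+ 1 / 4} ⊗ (sq≥0 (e₁ +ℚ e₂) ⊕ sq≥0 (e₁ +ℚ e₃) ⊕ sq≥0 (e₁ - e₄) ⊕ sq≥0 (e₂ - e₃) ⊕ sq≥0 (e₂ +ℚ e₄) ⊕ sq≥0 (e₃ +ℚ e₄))))
    where
    e₁ = a - l
    e₂ = b - (l - X)
    e₃ = c - (l - Y)
    e₄ = d - (l - X - Y)
    cancel : ∀ a b c d l X Y → a - b - c +ℚ d ≡ (a - l) - (b - (l - X)) - (c - (l - Y)) +ℚ (d - (l - X - Y))
    cancel = solve-∀ ℚ-ring
    ring : ∀ a b c d → a *ℚ a +ℚ b *ℚ b +ℚ c *ℚ c +ℚ d *ℚ d - + 1 / 4 *ℚ ((a - b - c +ℚ d) *ℚ (a - b - c +ℚ d))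
      ≡ + 1 / 4 *ℚ ((a +ℚ b) *ℚ (a +ℚ b) +ℚ (a +ℚ c) *ℚ (a +ℚ c) +ℚ (a - d) *ℚ (a - d)
        +ℚ (b - c) *ℚ (b - c) +ℚ (b +ℚ d) *ℚ (b +ℚ d) +ℚ (c +ℚ d) *ℚ (c +ℚ d))
    ring = solve-∀ ℚ-ring
  cases : ∀ s t u v → ½ *ℚ H ≤ℚ four (toℚ s - l) (toℚ t - (l - X)) (toℚ u - (l - Y)) (toℚ v - (l - X - Y))
  cases true  true  u v = same₁₂ 1ℚ (toℚ u) (toℚ v)
  cases false false u v = same₁₂ 0ℚ (toℚ u) (toℚ v)
  cases true  false true v = same₁₃ 1ℚ 0ℚ (toℚ v)
  cases false true  false v = same₁₃ 0ℚ 1ℚ (toℚ v)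
  cases true  false false true  = second 1ℚ 0ℚ 0ℚ 1ℚ pos
  cases true  false false false = second 1ℚ 0ℚ 0ℚ 0ℚ pos
  cases false true  true  true  = second 0ℚ 1ℚ 1ℚ 1ℚ pos
  cases false true  true  false = second 0ℚ 1ℚ 1ℚ 0ℚ pos

-- `four-points` is integrated over the event that both families have exactly one split pair and 00
-- elsewhere. All four points are equally distributed, so their errors sum to at most 4 ε.
two-hits : ∀ {w ε} us vs r → NonNeg w → Near w ε (flat us (flat vs r)) → All (GapAbove H) us → All (GapAbove H) vs →
  ½ *ℚ H *ℚ (2ℚ *ℚ q (length us) *ℚ (2ℚ *ℚ q (length vs) *ℚ mass (length r) (w ∘ suc ∘ suc))) ≤ℚ 4ℚ *ℚ ε
two-hits {w} {ε} us vs r w≥0 (f , near) big-us big-vs = begin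
  ½ *ℚ H *ℚ (2ℚ *ℚ q (length us) *ℚ (2ℚ *ℚ q (length vs) *ℚ mass (length r) (w ∘ suc ∘ suc)))
    ≡⟨ cong (λ t → ½ *ℚ H *ℚ (2ℚ *ℚ q (length us) *ℚ t)) (E-one vs {r} (w ∘ suc) (λ _ → 1ℚ)) ⟨
  ½ *ℚ H *ℚ (2ℚ *ℚ q (length us) *ℚ E (length (flat vs r)) (w ∘ suc) (λ y → one vs y *ℚ 1ℚ))
    ≡⟨ cong (½ *ℚ H *ℚ_) (E-one us w (λ y → one vs y *ℚ 1ℚ)) ⟨
  ½ *ℚ H *ℚ E n w (λ x → one us x *ℚ (one vs (rest us x) *ℚ 1ℚ))
    ≡⟨ E-* n (½ *ℚ H) (λ x → one us x *ℚ (one vs (rest us x) *ℚ 1ℚ)) ⟨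
  E n w (λ x → ½ *ℚ H *ℚ (one us x *ℚ (one vs (rest us x) *ℚ 1ℚ)))
    ≤⟨ E-mono n w≥0 pointwise ⟩
  E n w (λ x → e² x +ℚ e² (σ x) +ℚ e² (τ x) +ℚ e² (στ x))
    ≡⟨ ≡.trans (E-+ n (λ x → e² x +ℚ e² (σ x) +ℚ e² (τ x)) (e² ∘ στ))
        (cong (_+ℚ E n w (e² ∘ στ)) (≡.trans (E-+ n (λ x → e² x +ℚ e² (σ x)) (e² ∘ τ))
        (cong (_+ℚ E n w (e² ∘ τ)) (E-+ n e² (e² ∘ σ))))) ⟩
  E n w e² +ℚ E n w (e² ∘ σ) +ℚ E n w (e² ∘ τ) +ℚ E n w (e² ∘ στ)
    ≡⟨ cong₂ _+ℚ_ (cong₂ _+ℚ_ (cong (E n w e² +ℚ_) (step-preserves true us (id-preserves (flat vs r)) w e²))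
         (step-preserves false us τ-preserves w e²)) (step-preserves true us τ-preserves w e²) ⟩
  E n w e² +ℚ E n w e² +ℚ E n w e² +ℚ E n w e²
    ≤⟨ by (ring ε (E n w e²)) (pos {4ℚ} ⊗ gap near) ⟩
  4ℚ *ℚ ε ∎
  where
  open ℚₚ.≤-Reasoning
  c = flat us (flat vs r)
  n = length c
  e² = λ x → sq (err c f x)
  swap-vs : Bits (flat vs r) → Bits (flat vs r)
  swap-vs = step true vs id
  σ = step true us {flat vs r} id
  τ = step false us {flat vs r} swap-vs
  στ = step true us {flat vs r} swap-vs
  τ-preserves : MassPreserving (flat vs r) swap-vs
  τ-preserves = step-preserves true vs (id-preserves r)
  ring : ∀ ε e → 4ℚ *ℚ ε - (e +ℚ e +ℚ e +ℚ e) ≡ 4ℚ *ℚ (ε - e)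
  ring = solve-∀ ℚ-ring
  at-σ : ∀ x → lin c (σ x) ≡ lin c x - diff us x
  at-σ x = ≡.trans (lin-step true us id x) (ring′ (lin c x) (diff us x) (lin (flat vs r) (rest us x)))
    where
    ring′ : ∀ l X m → l - 1ℚ *ℚ X +ℚ (m - m) ≡ l - X
    ring′ = solve-∀ ℚ-ring
  shift-vs : ∀ y → lin (flat vs r) (swap-vs y) - lin (flat vs r) y ≡ - diff vs y
  shift-vs y = ≡.trans (cong (_- lin (flat vs r) y) (lin-step true vs id y)) (ring′ (lin (flat vs r) y) (diff vs y) (lin r (rest vs y)))
    where
    ring′ : ∀ l X m → l - 1ℚ *ℚ X +ℚ (m - m) - l ≡ - X
    ring′ = solve-∀ ℚ-ring
  at-τ : ∀ x → lin c (τ x) ≡ lin c x - diff vs (rest us x)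
  at-τ x = ≡.trans (lin-step false us swap-vs x) (≡.trans (cong (lin c x - 0ℚ *ℚ diff us x +ℚ_) (shift-vs (rest us x)))
    (ring′ (lin c x) (diff us x) (diff vs (rest us x))))
    where
    ring′ : ∀ l X Y → l - 0ℚ *ℚ X +ℚ - Y ≡ l - Y
    ring′ = solve-∀ ℚ-ring
  at-στ : ∀ x → lin c (στ x) ≡ lin c x - diff us x - diff vs (rest us x)
  at-στ x = ≡.trans (lin-step true us swap-vs x) (≡.trans (cong (lin c x - 1ℚ *ℚ diff us x +ℚ_) (shift-vs (rest us x)))
    (ring′ (lin c x) (diff us x) (diff vs (rest us x))))
    where
    ring′ : ∀ l X Y → l - 1ℚ *ℚ X +ℚ - Y ≡ l - X - Y
    ring′ = solve-∀ ℚ-ring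
  total : Bits c → ℚ
  total x = e² x +ℚ e² (σ x) +ℚ e² (τ x) +ℚ e² (στ x)
  total≥0 : ∀ x → 0ℚ ≤ℚ total x
  total≥0 x = sq≥0 (err c f x) ⊕ sq≥0 (err c f (σ x)) ⊕ sq≥0 (err c f (τ x)) ⊕ sq≥0 (err c f (στ x))
  pointwise : ∀ x → ½ *ℚ H *ℚ (one us x *ℚ (one vs (rest us x) *ℚ 1ℚ)) ≤ℚ total x
  pointwise x with one-diff big-us x | one-diff big-vs (rest us x)
  ... | inj₁ z | _ = subst (_≤ℚ total x)
    (≡.trans (ring₀ H (one vs (rest us x))) (cong (λ t → ½ *ℚ H *ℚ (t *ℚ (one vs (rest us x) *ℚ 1ℚ))) (sym z))) (total≥0 x)
    where
    ring₀ : ∀ h a → 0ℚ ≡ ½ *ℚ h *ℚ (0ℚ *ℚ (a *ℚ 1ℚ))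
    ring₀ = solve-∀ ℚ-ring
  ... | inj₂ _ | inj₁ z = subst (_≤ℚ total x)
    (≡.trans (ring₀ H (one us x)) (cong (λ t → ½ *ℚ H *ℚ (one us x *ℚ (t *ℚ 1ℚ))) (sym z))) (total≥0 x)
    where
    ring₀ : ∀ h a → 0ℚ ≡ ½ *ℚ h *ℚ (a *ℚ (0ℚ *ℚ 1ℚ))
    ring₀ = solve-∀ ℚ-ring
  ... | inj₂ (o , X²) | inj₂ (o′ , Y²) = subst (_≤ℚ total x)
    (≡.trans (ring₀ H) (cong₂ (λ s t → ½ *ℚ H *ℚ (s *ℚ (t *ℚ 1ℚ))) (sym o) (sym o′)))
    (subst (½ *ℚ H ≤ℚ_) (≡.trans (cong₂ (λ a b → four (err c f x) (toℚ (f (σ x)) - a) (toℚ (f (τ x)) - b)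
        (toℚ (f (στ x)) - (lin c x - diff us x - diff vs (rest us x)))) (sym (at-σ x)) (sym (at-τ x)))
      (cong (λ a → four (err c f x) (err c f (σ x)) (err c f (τ x)) (toℚ (f (στ x)) - a)) (sym (at-στ x))))
      (four-points (f x) (f (σ x)) (f (τ x)) (f (στ x)) (lin c x) (diff us x) (diff vs (rest us x)) X² Y²))
    where
    ring₀ : ∀ h → ½ *ℚ h ≡ ½ *ℚ h *ℚ (1ℚ *ℚ (1ℚ *ℚ 1ℚ))
    ring₀ = solve-∀ ℚ-ring

-- Union bound over the s + 1 coordinates that are prescribed to be 0.
mass-zeros : ∀ s r {v} → NonNeg v → mass (suc s + r) v ≤ℚ mass r v +ℚ q (suc s) *ℚ mass (s + r) (v ∘ suc)
mass-zeros zero r {v} v≥0 = ℚₚ.≤-reflexive (ring (mass r v) (mass r (v ∘ suc)))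
  where
  ring : ∀ a b → a +ℚ b ≡ a +ℚ (1ℚ +ℚ 0ℚ) *ℚ b
  ring = solve-∀ ℚ-ring
mass-zeros (suc s) r {v} v≥0 = by (ring (mass (suc s + r) v) (mass r v) (q (suc s)) (mass (s + r) (v ∘ suc)) (mass (s + r) (v ∘ suc ∘ suc)))
  (gap (mass-zeros s r v≥0) ⊕ q≥0 (suc s) ⊗ mass-nonneg (s + r) (v≥0 ∘ suc ∘ suc))
  where
  ring : ∀ m b q c d → b +ℚ (1ℚ +ℚ q) *ℚ (c +ℚ d) - (m +ℚ (c +ℚ d)) ≡ (b +ℚ q *ℚ c - m) +ℚ q *ℚ d
  ring = solve-∀ ℚ-ring

length-flat : ∀ ps r → length (flat ps r) ≡ 2 * length ps + length r
length-flat []       r = ≡.refl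
length-flat (_ ∷ ps) r = begin
  suc (suc (length (flat ps r)))                ≡⟨ cong (suc ∘ suc) (length-flat ps r) ⟩
  2 + 2 * length ps + length r                  ≡⟨ cong (_+ length r) (ℕₚ.*-suc 2 (length ps)) ⟨
  2 * suc (length ps) + length r                ∎
  where open ≡-Reasoning

800ℚ 6400ℚ : ℚ
800ℚ = + 800 / 1
6400ℚ = 8ℚ *ℚ 800ℚ

-- The constant is 800 = 2 / `H`.
sq*mass≤ : ∀ u B ε → ½ *ℚ H *ℚ (2ℚ *ℚ u *ℚ (2ℚ *ℚ u *ℚ B)) ≤ℚ 4ℚ *ℚ ε → sq u *ℚ B ≤ℚ 800ℚ *ℚ ε
sq*mass≤ u B ε h = by
  (≡.trans (cong (λ t → 800ℚ *ℚ ε - t) (sym (ℚₚ.*-identityˡ (sq u *ℚ B)))) (ring u B ε H (+ 400 / 1)))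
  (pos {½ *ℚ (+ 400 / 1)} ⊗ gap h)
  where
  ring : ∀ u B ε h k → 2ℚ *ℚ k *ℚ ε - k *ℚ h *ℚ (u *ℚ u *ℚ B) ≡
    ½ *ℚ k *ℚ (4ℚ *ℚ ε - ½ *ℚ h *ℚ (2ℚ *ℚ u *ℚ (2ℚ *ℚ u *ℚ B)))
  ring = solve-∀ ℚ-ring

module Heavy {n w p ε} (S : SliceWeight n w p) (ε≤ε₀ : ε ≤ℚ ε₀) where
  open SliceWeight S

  -- As for light pairs, the bound without the first pairs makes u p small,
  -- so that the event of exactly two hits has probability of order (u p)².
  heavy-pairs : ∀ us vs r → length us ≡ length vs → length (flat us (flat vs r)) ≡ n →
    Near w ε (flat us (flat vs r)) → All (GapAbove H) us → All (GapAbove H) vs →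
    sq (q (length us) *ℚ p) ≤ℚ 6400ℚ *ℚ ε
  heavy-pairs [] vs r same len near _ _ = subst (_≤ℚ 6400ℚ *ℚ ε) (ring p)
    (pos {6400ℚ} ⊗ Near-ε≥0 {c = flat vs r} w≥0 near)
    where
    ring : ∀ p → 0ℚ ≡ 0ℚ *ℚ p *ℚ (0ℚ *ℚ p)
    ring = solve-∀ ℚ-ring
  -- With one pair in each family the union bound of the next case would require 2 p ≤ 1/2, which
  -- can fail; the mass of two split pairs is bounded below directly. The factor 8 of `split₂≥`
  -- gives 6400 = 8 · 800.
  heavy-pairs (u ∷ []) (v ∷ []) r same len near big-us big-vs = by (ring p (mass (length r) (w ∘ suc ∘ suc)) ε 800ℚ)
    (pos {8ℚ} ⊗ gap (sq*mass≤ (1ℚ +ℚ 0ℚ) (mass (length r) (w ∘ suc ∘ suc)) ε (two-hits (u ∷ []) (v ∷ []) r w≥0 near big-us big-vs)) ⊕ gap (split₂≥ (length r) len))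
    where
    ring : ∀ p B ε k → 8ℚ *ℚ k *ℚ ε - ((1ℚ +ℚ 0ℚ) *ℚ p) *ℚ ((1ℚ +ℚ 0ℚ) *ℚ p) ≡
      8ℚ *ℚ (k *ℚ ε - (1ℚ +ℚ 0ℚ) *ℚ (1ℚ +ℚ 0ℚ) *ℚ B) +ℚ (8ℚ *ℚ B - p *ℚ p)
    ring = solve-∀ ℚ-ring
  heavy-pairs ((a , b) ∷ us@(_ ∷ us′)) ((a′ , b′) ∷ vs) r same len near big-us@(_ ∷ bigs-u) big-vs@(_ ∷ bigs-v) =
    -- The union bound gives B ≥ M - (s + 1) N ≥ (1 - (s + 1) p) M ≥ M / 2. With p² ≤ 2 M this
    -- yields (l + 1)² p² ≤ 4 (l + 1)² B.
    by (ring p (q (suc l)) (q (suc s)) B M N ε 800ℚ)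
      (pos {4ℚ} ⊗ gap (sq*mass≤ (q (suc l)) B ε hits)
        ⊕ pos {4ℚ} ⊗ sq≥0 (q (suc l)) ⊗ gap (mass-zeros s (length r) {w ∘ suc ∘ suc} (w≥0 ∘ suc ∘ suc))
        ⊕ pos {4ℚ} ⊗ sq≥0 (q (suc l)) ⊗ q≥0 (suc s) ⊗ gap (three-in (s + length r) (≡.trans count len))
        ⊕ pos {4ℚ} ⊗ sq≥0 (q (suc l)) ⊗ gap sp≤½ ⊗ mass-nonneg (suc s + length r) (w≥0 ∘ suc ∘ suc)
        ⊕ sq≥0 (q (suc l)) ⊗ gap (two-in≥ (suc s + length r) (≡.trans count len))
        ⊕ pos {4ℚ *ℚ 800ℚ} ⊗ Near-ε≥0 {c = flat ((a , b) ∷ us) (flat ((a′ , b′) ∷ vs) r)} w≥0 near)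
    where
    l = length us
    -- The two families cover 4 l + 4 coordinates, of which two are prescribed to be 1 and the other
    -- s + 1 to be 0.
    s = 1 + 4 * l
    B = mass (length r) (w ∘ suc ∘ suc)
    M = mass (suc s + length r) (w ∘ suc ∘ suc)
    N = mass (s + length r) (w ∘ suc ∘ suc ∘ suc)
    hits : ½ *ℚ H *ℚ (2ℚ *ℚ q (suc l) *ℚ (2ℚ *ℚ q (suc l) *ℚ B)) ≤ℚ 4ℚ *ℚ ε
    hits = subst (λ j → ½ *ℚ H *ℚ (2ℚ *ℚ q (suc l) *ℚ (2ℚ *ℚ q j *ℚ B)) ≤ℚ 4ℚ *ℚ ε) (sym same)
      (two-hits ((a , b) ∷ us) ((a′ , b′) ∷ vs) r w≥0 near big-us big-vs)
    regroup : flat ((a , b) ∷ us) (flat ((a′ , b′) ∷ vs) r) ↭ flat us (flat vs (a ∷ b ∷ a′ ∷ b′ ∷ r))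
    regroup = trans (flat-shift a b us) (flat-↭ us
      (trans (prep a (prep b (flat-shift a′ b′ vs))) (flat-shift a b vs)))
    ih : sq (q l *ℚ p) ≤ℚ 6400ℚ *ℚ ε
    ih = heavy-pairs us vs (a ∷ b ∷ a′ ∷ b′ ∷ r) (ℕₚ.suc-injective same) (≡.trans (sym (↭-length regroup)) len)
      (Near-↭ regroup near) bigs-u bigs-v
    lp≤ : q l *ℚ p ≤ℚ + 1 / 12
    lp≤ = sq-cancel-≤ pos (ℚₚ.≤-trans ih (ℚₚ.≤-trans
      (ℚₚ.*-monoˡ-≤-nonNeg 6400ℚ ε≤ε₀) (by {6400ℚ *ℚ ε₀} {sq (+ 1 / 12)} ≡.refl pos)))
    -- Here l ≥ 1, so s + 1 = 2 + 4 l ≤ 6 l, and l p ≤ 1/12 suffices.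
    sp≤½ : q (suc s) *ℚ p ≤ℚ ½
    sp≤½ = by (≡.trans (cong (λ t → ½ - (1ℚ +ℚ (1ℚ +ℚ t)) *ℚ p) (q-* 4 l)) (ring₁ (q (length us′)) p))
      (pos {+ 6 / 1} ⊗ gap lp≤ ⊕ pos {2ℚ} ⊗ q≥0 (length us′) ⊗ p≥0)
      where
      ring₁ : ∀ l p → ½ - (1ℚ +ℚ (1ℚ +ℚ 4ℚ *ℚ (1ℚ +ℚ l))) *ℚ p ≡ + 6 / 1 *ℚ (+ 1 / 12 - (1ℚ +ℚ l) *ℚ p) +ℚ 2ℚ *ℚ l *ℚ p
      ring₁ = solve-∀ ℚ-ring
    count : 3 + (s + length r) ≡ length (flat ((a , b) ∷ us) (flat ((a′ , b′) ∷ vs) r))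
    count = cong (suc ∘ suc) (begin
      suc (suc (4 * l + length r))                ≡⟨ cong (λ t → suc (suc (t + length r))) (ℕₚ.*-distribʳ-+ l 2 2) ⟩
      suc (suc ((2 * l + 2 * l) + length r))      ≡⟨ cong (λ j → suc (suc ((2 * l + 2 * j) + length r))) (ℕₚ.suc-injective same) ⟩
      suc (suc ((2 * l + 2 * length vs) + length r)) ≡⟨ cong (suc ∘ suc) (ℕₚ.+-assoc (2 * l) (2 * length vs) (length r)) ⟩
      suc (suc (2 * l + (2 * length vs + length r))) ≡⟨ cong (λ j → suc (suc (2 * l + j))) (length-flat vs r) ⟨
      suc (suc (2 * l + length (flat vs r)))      ≡⟨ cong suc (ℕₚ.+-suc (2 * l) (length (flat vs r))) ⟨
      suc (2 * l + suc (length (flat vs r)))      ≡⟨ ℕₚ.+-suc (2 * l) (suc (length (flat vs r))) ⟨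
      2 * l + suc (suc (length (flat vs r)))      ≡⟨ length-flat us (a′ ∷ b′ ∷ flat vs r) ⟨
      length (flat us (a′ ∷ b′ ∷ flat vs r))      ∎)
      where open ≡-Reasoning
    ring : ∀ p u s B M N ε k → 8ℚ *ℚ k *ℚ ε - (u *ℚ p) *ℚ (u *ℚ p) ≡
      4ℚ *ℚ (k *ℚ ε - u *ℚ u *ℚ B)
      +ℚ 4ℚ *ℚ (u *ℚ u) *ℚ (B +ℚ s *ℚ N - M)
      +ℚ 4ℚ *ℚ (u *ℚ u) *ℚ s *ℚ (p *ℚ M - N)
      +ℚ 4ℚ *ℚ (u *ℚ u) *ℚ (½ - s *ℚ p) *ℚ M
      +ℚ u *ℚ u *ℚ (2ℚ *ℚ M - p *ℚ p)
      +ℚ 4ℚ *ℚ k *ℚ ε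
    ring = solve-∀ ℚ-ring

-- Structure of the coefficients

sq-mono : ∀ {a b} → 0ℚ ≤ℚ a → a ≤ℚ b → sq a ≤ℚ sq b
sq-mono {a} {b} 0≤a a≤b = by (ring a b) (gap a≤b ⊗ gap a≤b ⊕ pos {2ℚ} ⊗ 0≤a ⊗ gap a≤b)
  where
  ring : ∀ a b → b *ℚ b - a *ℚ a ≡ (b - a) *ℚ (b - a) +ℚ 2ℚ *ℚ a *ℚ (b - a)
  ring = solve-∀ ℚ-ring

min-out : ∀ x xs → ∃ λ m → ∃ λ ys → (x ∷ xs ↭ m ∷ ys) × All (m ≤ℚ_) ys
min-out x []       = x , [] , refl , []
min-out x (y ∷ xs) with min-out y xs
... | m , ys , π , m≤ with ℚₚ.≤-total x m
...   | inj₁ x≤m = x , m ∷ ys , prep x π , x≤m ∷ All.map (ℚₚ.≤-trans x≤m) m≤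
...   | inj₂ m≤x = m , x ∷ ys , trans (prep x π) (swap x m refl) , m≤x ∷ m≤

max-out : ∀ x xs → ∃ λ m → ∃ λ ys → (x ∷ xs ↭ m ∷ ys) × All (_≤ℚ m) ys
max-out x []       = x , [] , refl , []
max-out x (y ∷ xs) with max-out y xs
... | m , ys , π , ≤m with ℚₚ.≤-total x m
...   | inj₁ x≤m = m , x ∷ ys , trans (prep x π) (swap x m refl) , x≤m ∷ ≤m
...   | inj₂ m≤x = x , m ∷ ys , prep x π , m≤x ∷ All.map (λ y≤m → ℚₚ.≤-trans y≤m m≤x) ≤m

Straddles : ℚ → Pair → Set
Straddles μ (a , b) = b ≤ℚ μ × μ ≤ℚ a

-- The bounds `lo≤μ` and `μ≤hi` are carried along so that the extremes put around an inner list are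
-- known to straddle its μ.
record Paired (c : List ℚ) (lo hi : ℚ) : Set where
  constructor paired
  field
    {μ}      : ℚ
    pairs    : List Pair
    middle   : List ℚ
    perm     : c ↭ flat pairs middle
    straddle : All (Straddles μ) pairs
    middle≡μ : All (_≡ μ) middle
    short    : length middle ≤ 1
    lo≤μ     : lo ≤ℚ μ
    μ≤hi     : μ ≤ℚ hi

-- Repeatedly pairing the largest with the smallest element leaves the median.
pair-up : ∀ k c → length c ≤ k → ∀ lo hi → lo ≤ℚ hi → All (lo ≤ℚ_) c → All (_≤ℚ hi) c → Paired c lo hi
pair-up k [] _ lo hi lo≤hi _ _ = paired [] [] refl [] [] z≤n ℚₚ.≤-refl lo≤hi
pair-up (suc k) (x ∷ xs) (s≤s len) lo hi _ lo≤ ≤hi with min-out x xs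
... | m , [] , π , _ with All-resp-↭ π lo≤ | All-resp-↭ π ≤hi
...   | lo≤m ∷ _ | m≤hi ∷ _ = paired [] (m ∷ []) π [] (≡.refl ∷ []) (s≤s z≤n) lo≤m m≤hi
pair-up (suc k) (x ∷ xs) (s≤s len) lo hi _ lo≤ ≤hi
    | m , y ∷ ys , π , m≤ with max-out y ys
...   | M , zs , ρ , ≤M with All-resp-↭ π lo≤ | All-resp-↭ (trans π (prep m ρ)) ≤hi | All-resp-↭ ρ m≤
...     | lo≤m ∷ _ | _ ∷ M≤hi ∷ _ | m≤M ∷ m≤zs
        with pair-up k zs shorter m M m≤M m≤zs ≤M
        where
        shorter : length zs ≤ k
        shorter = ℕₚ.≤-trans (ℕₚ.n≤1+n (length zs))
          (ℕₚ.≤-trans (ℕₚ.≤-reflexive (ℕₚ.suc-injective (sym (↭-length (trans π (prep m ρ)))))) len)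
...       | paired ps ms τ str mid short m≤μ μ≤M =
  paired ((M , m) ∷ ps) ms (trans π (trans (prep m ρ) (trans (swap m M refl) (prep M (prep m τ)))))
    ((m≤μ , μ≤M) ∷ str) mid short (ℚₚ.≤-trans lo≤m m≤μ) (ℚₚ.≤-trans μ≤M M≤hi)

bounds : ∀ c → ∃ λ lo → ∃ λ hi → lo ≤ℚ hi × All (lo ≤ℚ_) c × All (_≤ℚ hi) c
bounds [] = 0ℚ , 0ℚ , ℚₚ.≤-refl , [] , []
bounds (x ∷ c) with bounds c
... | lo , hi , lo≤hi , lo≤ , ≤hi = lo ℚ.⊓ x , hi ℚ.⊔ x
  , ℚₚ.≤-trans (ℚₚ.p⊓q≤p lo x) (ℚₚ.≤-trans lo≤hi (ℚₚ.p≤p⊔q hi x))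
  , ℚₚ.p⊓q≤q lo x ∷ All.map (ℚₚ.≤-trans (ℚₚ.p⊓q≤p lo x)) lo≤
  , ℚₚ.p≤q⊔p hi x ∷ All.map (λ y≤ → ℚₚ.≤-trans y≤ (ℚₚ.p≤p⊔q hi x)) ≤hi

Close Far : ℚ → Pair → Set
Close μ (a , b) = a - μ ≤ℚ θ × μ - b ≤ℚ θ
Far μ (a , b) = θ ≤ℚ a - μ ⊎ θ ≤ℚ μ - b

θ≤⇒H≤ : ∀ {a b} → θ ≤ℚ a - b → H ≤ℚ sq (a - b)
θ≤⇒H≤ {a} {b} θ≤ = sq-mono {θ} {a - b} pos θ≤

close-gap : ∀ {μ a b} → Straddles μ (a , b) → a - μ ≤ℚ θ → μ - b ≤ℚ θ → GapBelow D (a , b)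
close-gap {μ} {a} {b} (b≤μ , μ≤a) a-μ≤θ μ-b≤θ = sq-mono {a - b} {θ +ℚ θ}
  (0≤* (ring₀ μ a b) (gap μ≤a ⊕ gap b≤μ)) (by (ring μ a b θ) (gap a-μ≤θ ⊕ gap μ-b≤θ))
  where
  ring₀ : ∀ μ a b → a - b ≡ (a - μ) +ℚ (μ - b)
  ring₀ = solve-∀ ℚ-ring
  ring : ∀ μ a b t → (t +ℚ t) - (a - b) ≡ (t - (a - μ)) +ℚ (t - (μ - b))
  ring = solve-∀ ℚ-ring

close-gap′ : ∀ {μ pr} → Straddles μ pr × Close μ pr → GapBelow D pr
close-gap′ {μ} {a , b} (str , h , h′) = close-gap {μ} {a} {b} str h h′

far-gap : ∀ {μ a b} → Straddles μ (a , b) → Far μ (a , b) → GapAbove H (a , b)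
far-gap {μ} {a} {b} (b≤μ , μ≤a) (inj₁ θ≤) = θ≤⇒H≤ {a} {b} (by (ring θ μ a b) (gap θ≤ ⊕ gap b≤μ))
  where
  ring : ∀ t μ a b → (a - b) - t ≡ ((a - μ) - t) +ℚ (μ - b)
  ring = solve-∀ ℚ-ring
far-gap {μ} {a} {b} (b≤μ , μ≤a) (inj₂ θ≤) = θ≤⇒H≤ {a} {b} (by (ring θ μ a b) (gap θ≤ ⊕ gap μ≤a))
  where
  ring : ∀ t μ a b → (a - b) - t ≡ ((μ - b) - t) +ℚ (a - μ)
  ring = solve-∀ ℚ-ring

close-or-far : ∀ μ p → Close μ p ⊎ Far μ p
close-or-far μ (a , b) with ℚₚ.≤-total (a - μ) θ | ℚₚ.≤-total (μ - b) θ
... | inj₁ h | inj₁ h′ = inj₁ (h , h′)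
... | inj₂ h | _       = inj₂ (inj₁ h)
... | inj₁ _ | inj₂ h  = inj₂ (inj₂ h)

record Sorted (μ : ℚ) (ps : List Pair) (ms : List ℚ) : Set where
  constructor sorted
  field
    far close  : List Pair
    perm       : flat ps ms ↭ flat far (flat close ms)
    all-far    : All (λ p → Straddles μ p × Far μ p) far
    all-close  : All (λ p → Straddles μ p × Close μ p) close

sort-pairs : ∀ {μ} ps ms → All (Straddles μ) ps → Sorted μ ps ms
sort-pairs [] ms [] = sorted [] [] refl [] []
sort-pairs {μ} ((a , b) ∷ ps) ms (str ∷ strs) with sort-pairs ps ms strs | close-or-far μ (a , b)
... | sorted hs ls π far close | inj₁ c = sorted hs ((a , b) ∷ ls)
  (trans (prep a (prep b π)) (flat-shift a b hs)) far ((str , c) ∷ close)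
... | sorted hs ls π far close | inj₂ f = sorted ((a , b) ∷ hs) ls (prep a (prep b π)) ((str , f) ∷ far) close

flat-comm : ∀ ps qs {r} → flat ps (flat qs r) ↭ flat qs (flat ps r)
flat-comm []             qs = refl
flat-comm ((a , b) ∷ ps) qs = trans (prep a (prep b (flat-comm ps qs))) (flat-shift a b qs)

-- `os` holds the pair left over when the number of pairs is odd.
record Halves (hs : List Pair) (r : List ℚ) : Set where
  constructor halves
  field
    us vs os : List Pair
    perm     : flat hs r ↭ flat us (flat vs (flat os r))
    same     : length us ≡ length vs
    half     : length hs ≤ 1 + 2 * length us
    big-us   : All (GapAbove H) us
    big-vs   : All (GapAbove H) vs

halve : ∀ hs r → All (GapAbove H) hs → Halves hs r
halve []       r _ = halves [] [] [] refl ≡.refl z≤n [] []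
halve (h ∷ []) r _ = halves [] [] (h ∷ []) refl ≡.refl (s≤s z≤n) [] []
halve ((a , b) ∷ (a′ , b′) ∷ hs) r (big ∷ big′ ∷ bigs) with halve hs r bigs
... | halves us vs os π same half big-us big-vs = halves ((a , b) ∷ us) ((a′ , b′) ∷ vs) os
  (prep a (prep b (trans (prep a′ (prep b′ π)) (flat-shift a′ b′ us))))
  (cong suc same)
  (ℕₚ.≤-trans (s≤s (s≤s half)) (ℕₚ.≤-reflexive (cong suc (sym (ℕₚ.*-suc 2 (length us))))))
  (big ∷ big-us) (big′ ∷ big-vs)

off : ℚ → ∀ c → Bits c → ℚ
off μ []      []          = 0ℚ
off μ (a ∷ c) (true ∷ T)  = off μ c T
off μ (a ∷ c) (false ∷ T) = sq (a - μ) +ℚ off μ c T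

weight-act : ∀ {c c′} (π : c ↭ c′) x → weight (act π x) ≡ weight x
weight-act refl x = ≡.refl
weight-act (prep _ π) (false ∷ x) = weight-act π x
weight-act (prep _ π) (true ∷ x)  = cong suc (weight-act π x)
weight-act (swap _ _ π) (false ∷ false ∷ x) = weight-act π x
weight-act (swap _ _ π) (false ∷ true ∷ x)  = cong suc (weight-act π x)
weight-act (swap _ _ π) (true ∷ false ∷ x)  = cong suc (weight-act π x)
weight-act (swap _ _ π) (true ∷ true ∷ x)   = cong (suc ∘ suc) (weight-act π x)
weight-act (trans π ρ) x = ≡.trans (weight-act ρ (act π x)) (weight-act π x)

off-act : ∀ μ {c c′} (π : c ↭ c′) T → off μ c′ (act π T) ≡ off μ c T
off-act μ refl T = ≡.refl
off-act μ (prep a π) (false ∷ T) = cong (sq (a - μ) +ℚ_) (off-act μ π T)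
off-act μ (prep _ π) (true ∷ T)  = off-act μ π T
off-act μ {_ ∷ _ ∷ c} (swap a b π) (false ∷ false ∷ T) = ≡.trans
  (cong (λ t → sq (b - μ) +ℚ (sq (a - μ) +ℚ t)) (off-act μ π T)) (ring (sq (a - μ)) (sq (b - μ)) (off μ c T))
  where
  ring : ∀ a b c → b +ℚ (a +ℚ c) ≡ a +ℚ (b +ℚ c)
  ring = solve-∀ ℚ-ring
off-act μ (swap a b π) (false ∷ true ∷ T)  = cong (sq (a - μ) +ℚ_) (off-act μ π T)
off-act μ (swap a b π) (true ∷ false ∷ T)  = cong (sq (b - μ) +ℚ_) (off-act μ π T)
off-act μ (swap a b π) (true ∷ true ∷ T)   = off-act μ π T
off-act μ (trans π ρ) T = ≡.trans (off-act μ ρ (act π T)) (off-act μ π T)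

-- The 36 comes from `few-far`: there |T| = 2 t with t ≤ 3 u, so (|T| p)² ≤ 36 (u p)².
opaque
  K : ℚ
  K = + 36 / 1 *ℚ 6400ℚ

  K≡ : K ≡ + 36 / 1 *ℚ 6400ℚ
  K≡ = ≡.refl

  K≥0 : 0ℚ ≤ℚ K
  K≥0 = pos

  Kε₀≤¼ : K *ℚ ε₀ ≤ℚ sq ½
  Kε₀≤¼ = by {K *ℚ ε₀} {sq ½} ≡.refl pos

-- T collects the outliers. `sparse` has its own field because its source varies: p ≤ 1/2 for a
-- single outlier, `Kε₀≤¼` otherwise. It makes x miss T with probability at least 1/2.
record Concentrated (p η δ : ℚ) (c : List ℚ) : Set where
  constructor concentrated
  field
    μ      : ℚ
    T      : Bits c
    small  : weight T ≤ 1 ⊎ sq (q (weight T) *ℚ p) ≤ℚ η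
    sparse : q (weight T) *ℚ p ≤ℚ ½
    off≤   : p *ℚ off μ c T ≤ℚ δ

Concentrated-↭ : ∀ {p η δ c c′} → c ↭ c′ → Concentrated p η δ c → Concentrated p η δ c′
Concentrated-↭ {p} {η} {δ} π (concentrated μ T small sparse off≤) = concentrated μ (act π T)
  (subst (λ j → j ≤ 1 ⊎ sq (q j *ℚ p) ≤ℚ η) (sym (weight-act π T)) small)
  (subst (λ j → q j *ℚ p ≤ℚ ½) (sym (weight-act π T)) sparse)
  (subst (λ t → p *ℚ t ≤ℚ δ) (sym (off-act μ π T)) off≤)

zeros : ∀ c → Bits c
zeros []      = []
zeros (_ ∷ c) = false ∷ zeros c

weight-zeros : ∀ c → weight (zeros c) ≡ 0
weight-zeros []      = ≡.refl
weight-zeros (_ ∷ c) = weight-zeros c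

mark : ∀ hs {r} → Bits r → Bits (flat hs r)
mark []       T = T
mark (_ ∷ hs) {r} T = true ∷ true ∷ mark hs {r} T

weight-mark : ∀ hs {r} (T : Bits r) → weight (mark hs {r} T) ≡ 2 * length hs + weight T
weight-mark []       T = ≡.refl
weight-mark (_ ∷ hs) {r} T = ≡.trans (cong (suc ∘ suc) (weight-mark hs {r} T)) (cong (_+ weight T) (sym (ℕₚ.*-suc 2 (length hs))))

off-mark : ∀ μ hs {r} (T : Bits r) → off μ (flat hs r) (mark hs {r} T) ≡ off μ r T
off-mark μ []       T = ≡.refl
off-mark μ (_ ∷ hs) {r} T = off-mark μ hs {r} T

-- As a - μ and μ - b are both nonnegative, the square of their sum a - b dominates the sum of their
-- squares. The middle entry equals μ and adds nothing.
off-zeros≤ : ∀ {μ} ls {ms} → All (Straddles μ) ls → All (_≡ μ) ms → off μ (flat ls ms) (zeros (flat ls ms)) ≤ℚ gaps² ls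
off-zeros≤ {μ} [] [] [] = ℚₚ.≤-refl
off-zeros≤ {μ} [] {m ∷ ms} [] (≡.refl ∷ mid) = subst (_≤ℚ 0ℚ)
  (ring μ (off μ ms (zeros ms))) (off-zeros≤ [] [] mid)
  where
  ring : ∀ m t → t ≡ (m - m) *ℚ (m - m) +ℚ t
  ring = solve-∀ ℚ-ring
off-zeros≤ {μ} ((a , b) ∷ ls) {ms} ((b≤μ , μ≤a) ∷ str) mid =
  by (ring μ a b (off μ (flat ls ms) (zeros (flat ls ms))) (gaps² ls))
    (gap (off-zeros≤ ls str mid) ⊕ pos {2ℚ} ⊗ gap μ≤a ⊗ gap b≤μ)
  where
  ring : ∀ m a b t g → (a - b) *ℚ (a - b) +ℚ g - ((a - m) *ℚ (a - m) +ℚ ((b - m) *ℚ (b - m) +ℚ t))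
    ≡ (g - t) +ℚ 2ℚ *ℚ (a - m) *ℚ (m - b)
  ring = solve-∀ ℚ-ring

16ℚ : ℚ
16ℚ = + 16 / 1

module Structure {n w p ε} (S : SliceWeight n w p) (ε≤ε₀ : ε ≤ℚ ε₀) where
  open SliceWeight S
  open Light S ε≤ε₀
  open Heavy S ε≤ε₀

  η δ : ℚ
  η = K *ℚ ε
  -- Twice the bound of `light-pairs`: in `single` the close pairs and the re-paired entry of the
  -- far pair use it once each.
  δ = 16ℚ *ℚ ε

  at-most-½ : ∀ {s} → sq s ≤ℚ η → s ≤ℚ ½
  at-most-½ {s} h = sq-cancel-≤ pos (ℚₚ.≤-trans h (ℚₚ.≤-trans
    (ℚₚ.*-monoˡ-≤-nonNeg K {{ℚ.nonNegative K≥0}} ε≤ε₀) Kε₀≤¼))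

  light : ∀ ls r c → c ↭ flat ls r → length c ≡ n → Near w ε c → All (GapBelow D) ls → p *ℚ gaps² ls ≤ℚ 8ℚ *ℚ ε
  light ls r c π len near = light-pairs ls r (≡.trans (sym (↭-length π)) len) (Near-↭ π near)

  cover : ∀ {μ} hs ls ms → let c = flat hs (flat ls ms) in length c ≡ n → Near w ε c →
    All (λ pr → Straddles μ pr × Close μ pr) ls → All (_≡ μ) ms →
    sq (q (2 * length hs) *ℚ p) ≤ℚ η → Concentrated p η δ c
  cover {μ} hs ls ms len near close mid few = concentrated μ T
    (inj₂ (subst (λ j → sq (q j *ℚ p) ≤ℚ η) (sym weight-T) few))
    (subst (λ j → q j *ℚ p ≤ℚ ½) (sym weight-T) (at-most-½ few))
    (subst (λ t → p *ℚ t ≤ℚ δ) (sym (off-mark μ hs {flat ls ms} (zeros (flat ls ms))))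
      (by (ring p (off μ (flat ls ms) (zeros (flat ls ms))) (gaps² ls) ε)
        (p≥0 ⊗ gap (off-zeros≤ ls (All.map proj₁ close) mid)
         ⊕ gap (light ls (flat hs ms) c (flat-comm hs ls) len near (All.map (close-gap′ {μ}) close))
         ⊕ pos {8ℚ} ⊗ Near-ε≥0 {c = c} w≥0 near)))
    where
    c = flat hs (flat ls ms)
    T : Bits c
    T = mark hs {flat ls ms} (zeros (flat ls ms))
    weight-T : weight T ≡ 2 * length hs
    weight-T = ≡.trans (weight-mark hs {flat ls ms} (zeros (flat ls ms)))
      (≡.trans (cong (_+_ (2 * length hs)) (weight-zeros (flat ls ms))) (ℕₚ.+-identityʳ (2 * length hs)))
    ring : ∀ p o g ε → 16ℚ *ℚ ε - p *ℚ o ≡ p *ℚ (g - o) +ℚ (8ℚ *ℚ ε - p *ℚ g) +ℚ 8ℚ *ℚ ε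
    ring = solve-∀ ℚ-ring

  -- Two far pairs suffice for two nonempty families of u pairs each, and then a leftover pair is
  -- absorbed by t ≤ 1 + 2 u ≤ 3 u.
  few-far : ∀ hs r → length (flat hs r) ≡ n → Near w ε (flat hs r) → All (GapAbove H) hs → 2 ≤ length hs →
    sq (q (2 * length hs) *ℚ p) ≤ℚ η
  few-far hs r len near bigs 2≤t = go (halve hs r bigs)
    where
    t = length hs
    ring : ∀ t u p ε k → + 36 / 1 *ℚ k *ℚ ε - (2ℚ *ℚ t *ℚ p) *ℚ (2ℚ *ℚ t *ℚ p) ≡
      + 36 / 1 *ℚ (k *ℚ ε - (u *ℚ p) *ℚ (u *ℚ p))
      +ℚ 4ℚ *ℚ ((+ 3 / 1 *ℚ (u *ℚ p)) *ℚ (+ 3 / 1 *ℚ (u *ℚ p)) - (t *ℚ p) *ℚ (t *ℚ p))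
    ring = solve-∀ ℚ-ring
    ring₁ : ∀ a b p → a *ℚ p - b *ℚ p ≡ (a - b) *ℚ p
    ring₁ = solve-∀ ℚ-ring
    tp≤ : ∀ u → t ≤ 3 * u → q t *ℚ p ≤ℚ + 3 / 1 *ℚ (q u *ℚ p)
    tp≤ u t≤3u = by (≡.trans (cong (λ s → s - q t *ℚ p) (sym (ℚₚ.*-assoc (+ 3 / 1) (q u) p)))
        (≡.trans (cong (λ s → s *ℚ p - q t *ℚ p) (sym (q-* 3 u))) (ring₁ (q (3 * u)) (q t) p)))
      (gap (q-mono t≤3u) ⊗ p≥0)
    combine : ∀ u → t ≤ 3 * u → sq (q u *ℚ p) ≤ℚ 6400ℚ *ℚ ε → sq (q (2 * t) *ℚ p) ≤ℚ η
    combine u t≤3u main = by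
      (≡.trans (cong₂ (λ k t → k *ℚ ε - sq (t *ℚ p)) K≡ (q-* 2 t)) (ring (q t) (q u) p ε 6400ℚ))
      (pos {+ 36 / 1} ⊗ gap main ⊕ pos {4ℚ} ⊗ gap (sq-mono (q≥0 t ⊗ p≥0) (tp≤ u t≤3u)))
    go : Halves hs r → sq (q (2 * t) *ℚ p) ≤ℚ η
    go (halves [] vs os π same half _ _) = ⊥-elim (ℕₚ.<⇒≱ 2≤t half)
    go (halves us@(_ ∷ _) vs os π same half big-us big-vs) = combine (length us)
      (ℕₚ.≤-trans half (ℕₚ.+-monoˡ-≤ (2 * length us) (s≤s z≤n)))
      (heavy-pairs us vs (flat os r) same (≡.trans (sym (↭-length π)) len) (Near-↭ π near) big-us big-vs)

  -- If only one entry of the far pair is an outlier, it alone forms T, and the other entry makes a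
  -- close pair with the entry of (a′, b′) on the opposite side of μ, so `light-pairs` bounds its
  -- deviation. If both are outliers, T consists of both, and p² = O(ε) has to be shown.
  single : ∀ {μ} a b a′ b′ ls ms → let c = a ∷ b ∷ flat ((a′ , b′) ∷ ls) ms in length c ≡ n → Near w ε c →
    Straddles μ (a , b) → Far μ (a , b) →
    All (λ pr → Straddles μ pr × Close μ pr) ((a′ , b′) ∷ ls) → All (_≡ μ) ms → Concentrated p η δ c
  single {μ} a b a′ b′ ls ms len near (b≤μ , μ≤a) far close@(((b′≤μ , μ≤a′) , a′-μ≤θ , μ-b′≤θ) ∷ _) mid =
    go (ℚₚ.≤-total (a - μ) θ) (ℚₚ.≤-total (μ - b) θ) far
    where
    c = a ∷ b ∷ flat ((a′ , b′) ∷ ls) ms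
    rest′ = flat ((a′ , b′) ∷ ls) ms
    G = gaps² ((a′ , b′) ∷ ls)
    o = off μ rest′ (zeros rest′)
    others : p *ℚ G ≤ℚ 8ℚ *ℚ ε
    others = light ((a′ , b′) ∷ ls) (a ∷ b ∷ ms) c (flat-shift a b ((a′ , b′) ∷ ls)) len near (All.map (close-gap′ {μ}) close)
    o≤G : o ≤ℚ G
    o≤G = off-zeros≤ ((a′ , b′) ∷ ls) (All.map proj₁ close) mid
    one-weight : ∀ j → j ≡ 0 → suc j ≤ 1 ⊎ sq (q (suc j) *ℚ p) ≤ℚ η
    one-weight _ ≡.refl = inj₁ (s≤s z≤n)
    one-sparse : ∀ j → j ≡ 0 → q (suc j) *ℚ p ≤ℚ ½
    one-sparse _ ≡.refl = subst (_≤ℚ ½) (ring p) p≤½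
      where
      ring : ∀ p → p ≡ (1ℚ +ℚ 0ℚ) *ℚ p
      ring = solve-∀ ℚ-ring
    off-one : ∀ y g → sq (y - μ) ≤ℚ g → p *ℚ (g +ℚ 0ℚ) ≤ℚ 8ℚ *ℚ ε → p *ℚ (sq (y - μ) +ℚ o) ≤ℚ δ
    off-one y g y≤g pg = by (ring p (sq (y - μ)) o g G ε) (p≥0 ⊗ gap y≤g ⊕ p≥0 ⊗ gap o≤G ⊕ gap pg ⊕ gap others)
      where
      ring : ∀ p y o g G ε → 16ℚ *ℚ ε - p *ℚ (y +ℚ o) ≡
        p *ℚ (g - y) +ℚ p *ℚ (G - o) +ℚ (8ℚ *ℚ ε - p *ℚ (g +ℚ 0ℚ)) +ℚ (8ℚ *ℚ ε - p *ℚ G)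
      ring = solve-∀ ℚ-ring
    go : a - μ ≤ℚ θ ⊎ θ ≤ℚ a - μ → μ - b ≤ℚ θ ⊎ θ ≤ℚ μ - b → Far μ (a , b) → Concentrated p η δ c
    only-a : μ - b ≤ℚ θ → Concentrated p η δ c
    only-a μ-b≤θ = concentrated μ (true ∷ false ∷ zeros rest′)
      (one-weight (weight (zeros rest′)) (weight-zeros rest′)) (one-sparse (weight (zeros rest′)) (weight-zeros rest′))
      (off-one b (sq (a′ - b))
        (by (ring μ a′ b) (gap μ≤a′ ⊗ gap μ≤a′ ⊕ pos {2ℚ} ⊗ gap μ≤a′ ⊗ gap b≤μ))
        (light ((a′ , b) ∷ []) (a ∷ b′ ∷ flat ls ms) c
          (trans (prep a (swap b a′ refl)) (trans (swap a a′ refl) (prep a′ (swap a b refl)))) len near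
          (close-gap {μ} {a′} {b} (b≤μ , μ≤a′) a′-μ≤θ μ-b≤θ ∷ [])))
      where
      ring : ∀ m a b → (a - b) *ℚ (a - b) - (b - m) *ℚ (b - m) ≡ (a - m) *ℚ (a - m) +ℚ 2ℚ *ℚ (a - m) *ℚ (m - b)
      ring = solve-∀ ℚ-ring
    only-b : a - μ ≤ℚ θ → Concentrated p η δ c
    only-b a-μ≤θ = concentrated μ (false ∷ true ∷ zeros rest′)
      (one-weight (weight (zeros rest′)) (weight-zeros rest′)) (one-sparse (weight (zeros rest′)) (weight-zeros rest′))
      (off-one a (sq (a - b′))
        (by (ring μ a b′) (gap b′≤μ ⊗ gap b′≤μ ⊕ pos {2ℚ} ⊗ gap μ≤a ⊗ gap b′≤μ))
        (light ((a , b′) ∷ []) (b ∷ a′ ∷ flat ls ms) c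
          (prep a (trans (prep b (swap a′ b′ refl)) (swap b b′ refl))) len near
          (close-gap {μ} {a} {b′} (b′≤μ , μ≤a) a-μ≤θ μ-b′≤θ ∷ [])))
      where
      ring : ∀ m a b → (a - b) *ℚ (a - b) - (a - m) *ℚ (a - m) ≡ (m - b) *ℚ (m - b) +ℚ 2ℚ *ℚ (a - m) *ℚ (m - b)
      ring = solve-∀ ℚ-ring
    -- Both entries are outliers, so re-pairing them gives two far pairs.
    both : θ ≤ℚ a - μ → θ ≤ℚ μ - b → Concentrated p η δ c
    both θ≤a-μ θ≤μ-b = cover ((a , b) ∷ []) ((a′ , b′) ∷ ls) ms len near close mid
      (by (≡.trans (cong (λ k → k *ℚ ε - sq (q 2 *ℚ p)) K≡) (ring p ε 6400ℚ)) (pos {4ℚ} ⊗ gap (heavy-pairs ((a , b′) ∷ []) ((a′ , b) ∷ []) (flat ls ms) ≡.refl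
        (≡.trans (sym (↭-length π)) len) (Near-↭ π near)
        (far-gap {μ} {a} {b′} (b′≤μ , μ≤a) (inj₁ θ≤a-μ) ∷ []) (far-gap {μ} {a′} {b} (b≤μ , μ≤a′) (inj₂ θ≤μ-b) ∷ []))
        ⊕ pos {+ 32 / 1 *ℚ 6400ℚ} ⊗ Near-ε≥0 {c = c} w≥0 near))
      where
      π : c ↭ a ∷ b′ ∷ a′ ∷ b ∷ flat ls ms
      π = prep a (trans (prep b (swap a′ b′ refl)) (trans (swap b b′ refl) (prep b′ (swap b a′ refl))))
      ring : ∀ p ε k → + 36 / 1 *ℚ k *ℚ ε - ((1ℚ +ℚ (1ℚ +ℚ 0ℚ)) *ℚ p) *ℚ ((1ℚ +ℚ (1ℚ +ℚ 0ℚ)) *ℚ p) ≡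
        4ℚ *ℚ (k *ℚ ε - ((1ℚ +ℚ 0ℚ) *ℚ p) *ℚ ((1ℚ +ℚ 0ℚ) *ℚ p)) +ℚ + 32 / 1 *ℚ k *ℚ ε
      ring = solve-∀ ℚ-ring
    -- `Close` and `Far` overlap where a deviation equals θ, so these first two cases do occur.
    go (inj₁ h)  (inj₁ h′)  (inj₁ _) = only-a h′
    go (inj₁ h)  (inj₁ h′)  (inj₂ _) = only-b h
    go (inj₂ h)  (inj₁ h′)  _        = only-a h′
    go (inj₁ h)  (inj₂ h′)  _        = only-b h
    go (inj₂ h)  (inj₂ h′)  _        = both h h′

  by-far-pairs : ∀ {μ} hs ls ms → length ms ≤ 1 → All (_≡ μ) ms → All (λ pr → Straddles μ pr × Far μ pr) hs → All (λ pr → Straddles μ pr × Close μ pr) ls →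
    length (flat hs (flat ls ms)) ≡ n → Near w ε (flat hs (flat ls ms)) → Concentrated p η δ (flat hs (flat ls ms))
  by-far-pairs [] ls ms short mid _ close len near = cover [] ls ms len near close mid
    (subst (_≤ℚ η) (ring p) (K≥0 ⊗ Near-ε≥0 {c = flat ls ms} w≥0 near))
    where
    ring : ∀ p → 0ℚ ≡ 0ℚ *ℚ p *ℚ (0ℚ *ℚ p)
    ring = solve-∀ ℚ-ring
  -- The list would have at most three entries; so a close pair to re-pair with is always present.
  by-far-pairs ((a , b) ∷ []) [] ms short mid _ _ len near = ⊥-elim (ℕₚ.<⇒≱ {3} {4} ℕₚ.≤-refl
    (ℕₚ.≤-trans 4≤n (ℕₚ.≤-trans (ℕₚ.≤-reflexive (sym len)) (s≤s (s≤s short)))))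
  by-far-pairs ((a , b) ∷ []) ((a′ , b′) ∷ ls) ms short mid ((str , far) ∷ []) close len near =
    single a b a′ b′ ls ms len near str far close mid
  by-far-pairs {μ} hs@(_ ∷ _ ∷ _) ls ms short mid far close len near = cover hs ls ms len near close mid
    (few-far hs (flat ls ms) len near (All.map far-gap′ far) (s≤s (s≤s z≤n)))
    where
    far-gap′ : ∀ {pr} → Straddles μ pr × Far μ pr → GapAbove H pr
    far-gap′ {a , b} (str , h) = far-gap {μ} {a} {b} str h

  concentration : ∀ c → length c ≡ n → Near w ε c → Concentrated p η δ c
  concentration c len near = from-bounds (bounds c)
    where
    from-sorted : ∀ {μ ps ms} → c ↭ flat ps ms → length ms ≤ 1 → All (_≡ μ) ms → Sorted μ ps ms → Concentrated p η δ c
    from-sorted {ms = ms} π short mid (sorted hs ls ρ far close) = Concentrated-↭ (↭-sym (trans π ρ))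
      (by-far-pairs hs ls ms short mid far close (≡.trans (sym (↭-length (trans π ρ))) len) (Near-↭ (trans π ρ) near))
    from-paired : ∀ {lo hi} → Paired c lo hi → Concentrated p η δ c
    from-paired (paired ps ms π str mid short _ _) = from-sorted π short mid (sort-pairs ps ms str)
    from-bounds : (∃ λ lo → ∃ λ hi → lo ≤ℚ hi × All (lo ≤ℚ_) c × All (_≤ℚ hi) c) → Concentrated p η δ c
    from-bounds (lo , hi , lo≤hi , lo≤ , ≤hi) = from-paired (pair-up (length c) c ℕₚ.≤-refl lo hi lo≤hi lo≤ ≤hi)

-- Rounding to a maximum

-- `cross` is the second elementary symmetric polynomial, half of the mixed part of the squared sum.
sum sumsq cross : ∀ {n} → Vec ℚ n → ℚ
sum []        = 0ℚ
sum (a ∷ v)   = a +ℚ sum v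
sumsq []      = 0ℚ
sumsq (a ∷ v) = sq a +ℚ sumsq v
cross []      = 0ℚ
cross (a ∷ v) = a *ℚ sum v +ℚ cross v

sum-sq : ∀ {n} (v : Vec ℚ n) → sq (sum v) ≡ sumsq v +ℚ 2ℚ *ℚ cross v
sum-sq []      = ≡.refl
sum-sq (a ∷ v) = ≡.trans (ring a (sum v)) (≡.trans (cong (λ t → sq a +ℚ 2ℚ *ℚ (a *ℚ sum v) +ℚ t) (sum-sq v))
  (ring′ (sq a) (a *ℚ sum v) (sumsq v) (cross v)))
  where
  ring : ∀ a s → (a +ℚ s) *ℚ (a +ℚ s) ≡ a *ℚ a +ℚ 2ℚ *ℚ (a *ℚ s) +ℚ s *ℚ s
  ring = solve-∀ ℚ-ring
  ring′ : ∀ a b s c → a +ℚ 2ℚ *ℚ b +ℚ (s +ℚ 2ℚ *ℚ c) ≡ (a +ℚ s) +ℚ 2ℚ *ℚ (b +ℚ c)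
  ring′ = solve-∀ ℚ-ring

-- The mass of the points with a one at one (two) prescribed places, again 0 for small n.
in₁ in₂ : ℕ → (ℕ → ℚ) → ℚ
in₁ zero    w = 0ℚ
in₁ (suc n) w = mass n (w ∘ suc)
in₂ zero    w = 0ℚ
in₂ (suc n) w = in₁ n (w ∘ suc)

in₁-pascal : ∀ (g : ∀ {n} → Vec ℚ n → ℚ) → g [] ≡ 0ℚ → ∀ {n} (v : Vec ℚ n) w →
  g v *ℚ (in₁ n w +ℚ in₁ n (w ∘ suc)) ≡ g v *ℚ mass n (w ∘ suc)
in₁-pascal g g[]≡0 [] w = ≡.trans (ℚₚ.*-zeroʳ (g []))
  (sym (≡.trans (cong (_*ℚ mass 0 (w ∘ suc)) g[]≡0) (ℚₚ.*-zeroˡ (mass 0 (w ∘ suc)))))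
in₁-pascal g g[]≡0 (_ ∷ _) w = ≡.refl

cross-pascal : ∀ {n} (v : Vec ℚ n) w → cross v *ℚ (in₂ n w +ℚ in₂ n (w ∘ suc)) ≡ cross v *ℚ in₁ n (w ∘ suc)
cross-pascal []                     w = ≡.refl
cross-pascal (a ∷ [])               w = ring a (mass 0 (w ∘ suc ∘ suc))
  where
  ring : ∀ a m → (a *ℚ 0ℚ +ℚ 0ℚ) *ℚ (0ℚ +ℚ 0ℚ) ≡ (a *ℚ 0ℚ +ℚ 0ℚ) *ℚ m
  ring = solve-∀ ℚ-ring
cross-pascal (_ ∷ _ ∷ _) w = ≡.refl

linear-moment₁ : ∀ {n} (v : Vec ℚ n) w → E n w (linear v) ≡ sum v *ℚ in₁ n w
linear-moment₁ []      w = ≡.trans (ℚₚ.*-zeroʳ (w 0)) (sym (ℚₚ.*-zeroˡ 0ℚ))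
linear-moment₁ {suc n} (a ∷ v) w = begin
  E n w (λ x → a *ℚ 0ℚ +ℚ linear v x) +ℚ E n (w ∘ suc) (λ x → a *ℚ 1ℚ +ℚ linear v x)
    ≡⟨ cong₂ _+ℚ_ (E-cong n (λ x → ring₀ a (linear v x))) (E-cong n (λ x → ring₁ a (linear v x))) ⟩
  E n w (linear v) +ℚ E n (w ∘ suc) (λ x → a *ℚ 1ℚ +ℚ 1ℚ *ℚ linear v x)
    ≡⟨ cong₂ _+ℚ_ (linear-moment₁ v w) (≡.trans (E-lin n a 1ℚ (λ _ → 1ℚ) (linear v))
         (cong (λ t → a *ℚ mass n (w ∘ suc) +ℚ 1ℚ *ℚ t) (linear-moment₁ v (w ∘ suc)))) ⟩
  sum v *ℚ in₁ n w +ℚ (a *ℚ mass n (w ∘ suc) +ℚ 1ℚ *ℚ (sum v *ℚ in₁ n (w ∘ suc)))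
    ≡⟨ collect (sum v) (in₁ n w) (in₁ n (w ∘ suc)) a (mass n (w ∘ suc)) ⟩
  a *ℚ mass n (w ∘ suc) +ℚ sum v *ℚ (in₁ n w +ℚ in₁ n (w ∘ suc))
    ≡⟨ cong (a *ℚ mass n (w ∘ suc) +ℚ_) (in₁-pascal sum ≡.refl v w) ⟩
  a *ℚ mass n (w ∘ suc) +ℚ sum v *ℚ mass n (w ∘ suc)
    ≡⟨ ℚₚ.*-distribʳ-+ (mass n (w ∘ suc)) a (sum v) ⟨
  (a +ℚ sum v) *ℚ mass n (w ∘ suc) ∎
  where
  open ≡-Reasoning
  ring₀ : ∀ a l → a *ℚ 0ℚ +ℚ l ≡ l
  ring₀ = solve-∀ ℚ-ring
  ring₁ : ∀ a l → a *ℚ 1ℚ +ℚ l ≡ a *ℚ 1ℚ +ℚ 1ℚ *ℚ l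
  ring₁ = solve-∀ ℚ-ring
  collect : ∀ s i j a m → s *ℚ i +ℚ (a *ℚ m +ℚ 1ℚ *ℚ (s *ℚ j)) ≡ a *ℚ m +ℚ s *ℚ (i +ℚ j)
  collect = solve-∀ ℚ-ring

linear-moment₂ : ∀ {n} (v : Vec ℚ n) w → E n w (sq ∘ linear v) ≡ sumsq v *ℚ in₁ n w +ℚ 2ℚ *ℚ cross v *ℚ in₂ n w
linear-moment₂ []      w = ring (w 0)
  where
  ring : ∀ w → w *ℚ (0ℚ *ℚ 0ℚ) ≡ 0ℚ *ℚ 0ℚ +ℚ 2ℚ *ℚ 0ℚ *ℚ 0ℚ
  ring = solve-∀ ℚ-ring
linear-moment₂ {suc n} (a ∷ v) w = begin
  E n w (λ x → sq (a *ℚ 0ℚ +ℚ linear v x)) +ℚ E n (w ∘ suc) (λ x → sq (a *ℚ 1ℚ +ℚ linear v x))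
    ≡⟨ cong₂ _+ℚ_ (E-cong n (λ x → ring₀ a (linear v x))) (E-cong n (λ x → ring₁ a (linear v x))) ⟩
  E n w (sq ∘ linear v) +ℚ E n (w ∘ suc) (λ x → 1ℚ *ℚ sq (linear v x) +ℚ 1ℚ *ℚ (2ℚ *ℚ a *ℚ linear v x +ℚ sq a *ℚ 1ℚ))
    ≡⟨ cong₂ _+ℚ_ (linear-moment₂ v w) (≡.trans (E-lin n 1ℚ 1ℚ (sq ∘ linear v) (λ x → 2ℚ *ℚ a *ℚ linear v x +ℚ sq a *ℚ 1ℚ))
         (cong₂ (λ s t → 1ℚ *ℚ s +ℚ 1ℚ *ℚ t) (linear-moment₂ v (w ∘ suc))
           (≡.trans (E-lin n (2ℚ *ℚ a) (sq a) (linear v) (λ _ → 1ℚ))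
             (cong (λ t → 2ℚ *ℚ a *ℚ t +ℚ sq a *ℚ m) (linear-moment₁ v (w ∘ suc)))))) ⟩
  Q *ℚ in₁ n w +ℚ 2ℚ *ℚ X *ℚ in₂ n w +ℚ
    (1ℚ *ℚ (Q *ℚ in₁ n (w ∘ suc) +ℚ 2ℚ *ℚ X *ℚ in₂ n (w ∘ suc)) +ℚ 1ℚ *ℚ (2ℚ *ℚ a *ℚ (sum v *ℚ in₁ n (w ∘ suc)) +ℚ sq a *ℚ m))
    ≡⟨ collect Q X (sum v) a (sq a) (in₁ n w) (in₁ n (w ∘ suc)) (in₂ n w) (in₂ n (w ∘ suc)) m ⟩
  sq a *ℚ m +ℚ Q *ℚ (in₁ n w +ℚ in₁ n (w ∘ suc)) +ℚ 2ℚ *ℚ (a *ℚ sum v *ℚ in₁ n (w ∘ suc) +ℚ X *ℚ (in₂ n w +ℚ in₂ n (w ∘ suc)))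
    ≡⟨ cong₂ (λ s t → sq a *ℚ m +ℚ s +ℚ 2ℚ *ℚ (a *ℚ sum v *ℚ in₁ n (w ∘ suc) +ℚ t)) (in₁-pascal sumsq ≡.refl v w) (cross-pascal v w) ⟩
  sq a *ℚ m +ℚ Q *ℚ m +ℚ 2ℚ *ℚ (a *ℚ sum v *ℚ in₁ n (w ∘ suc) +ℚ X *ℚ in₁ n (w ∘ suc))
    ≡⟨ factor Q X (a *ℚ sum v) (sq a) (in₁ n (w ∘ suc)) m ⟩
  (sq a +ℚ Q) *ℚ m +ℚ 2ℚ *ℚ (a *ℚ sum v +ℚ X) *ℚ in₁ n (w ∘ suc) ∎
  where
  open ≡-Reasoning
  m = mass n (w ∘ suc)
  Q = sumsq v
  X = cross v
  ring₀ : ∀ a l → (a *ℚ 0ℚ +ℚ l) *ℚ (a *ℚ 0ℚ +ℚ l) ≡ l *ℚ l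
  ring₀ = solve-∀ ℚ-ring
  ring₁ : ∀ a l → (a *ℚ 1ℚ +ℚ l) *ℚ (a *ℚ 1ℚ +ℚ l) ≡ 1ℚ *ℚ (l *ℚ l) +ℚ 1ℚ *ℚ (2ℚ *ℚ a *ℚ l +ℚ a *ℚ a *ℚ 1ℚ)
  ring₁ = solve-∀ ℚ-ring
  collect : ∀ Q X s a a² i i′ j j′ m → Q *ℚ i +ℚ 2ℚ *ℚ X *ℚ j +ℚ
    (1ℚ *ℚ (Q *ℚ i′ +ℚ 2ℚ *ℚ X *ℚ j′) +ℚ 1ℚ *ℚ (2ℚ *ℚ a *ℚ (s *ℚ i′) +ℚ a² *ℚ m)) ≡
    a² *ℚ m +ℚ Q *ℚ (i +ℚ i′) +ℚ 2ℚ *ℚ (a *ℚ s *ℚ i′ +ℚ X *ℚ (j +ℚ j′))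
  collect = solve-∀ ℚ-ring
  factor : ∀ Q X b a² i m → a² *ℚ m +ℚ Q *ℚ m +ℚ 2ℚ *ℚ (b *ℚ i +ℚ X *ℚ i) ≡ (a² +ℚ Q) *ℚ m +ℚ 2ℚ *ℚ (b +ℚ X) *ℚ i
  factor = solve-∀ ℚ-ring

shift : ℚ → (c : List ℚ) → Vec ℚ (length c)
shift μ []      = []
shift μ (a ∷ c) = a - μ ∷ shift μ c

mask unmask : ∀ {n} → Vec Bool n → Vec ℚ n → Vec ℚ n
mask   []          []      = []
mask   (true ∷ T)  (a ∷ u) = a ∷ mask T u
mask   (false ∷ T) (a ∷ u) = 0ℚ ∷ mask T u
unmask []          []      = []
unmask (true ∷ T)  (a ∷ u) = 0ℚ ∷ unmask T u
unmask (false ∷ T) (a ∷ u) = a ∷ unmask T u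

negate : ∀ {n} → Vec ℚ n → Vec ℚ n
negate []      = []
negate (a ∷ u) = - a ∷ negate u

-- Subtracting μ from every coefficient costs μ |x|, which is constant on the slice; the rest is
-- divided into the part off T and the part on T.
lin-split : ∀ μ c T x → lin c x ≡ μ *ℚ q (weight x) +ℚ linear (unmask T (shift μ c)) x +ℚ linear (mask T (shift μ c)) x
lin-split μ []      []          []          = ring μ
  where
  ring : ∀ m → 0ℚ ≡ m *ℚ 0ℚ +ℚ 0ℚ +ℚ 0ℚ
  ring = solve-∀ ℚ-ring
lin-split μ (a ∷ c) (true ∷ T) (true ∷ x) = ≡.trans (cong (a *ℚ 1ℚ +ℚ_) (lin-split μ c T x))
  (ring μ a (q (weight x)) (linear (unmask T (shift μ c)) x) (linear (mask T (shift μ c)) x))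
  where
  ring : ∀ m a k l l′ → a *ℚ 1ℚ +ℚ (m *ℚ k +ℚ l +ℚ l′) ≡ m *ℚ (1ℚ +ℚ k) +ℚ (0ℚ *ℚ 1ℚ +ℚ l) +ℚ ((a - m) *ℚ 1ℚ +ℚ l′)
  ring = solve-∀ ℚ-ring
lin-split μ (a ∷ c) (true ∷ T) (false ∷ x) = ≡.trans (cong (a *ℚ 0ℚ +ℚ_) (lin-split μ c T x))
  (ring μ a (q (weight x)) (linear (unmask T (shift μ c)) x) (linear (mask T (shift μ c)) x))
  where
  ring : ∀ m a k l l′ → a *ℚ 0ℚ +ℚ (m *ℚ k +ℚ l +ℚ l′) ≡ m *ℚ k +ℚ (0ℚ *ℚ 0ℚ +ℚ l) +ℚ ((a - m) *ℚ 0ℚ +ℚ l′)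
  ring = solve-∀ ℚ-ring
lin-split μ (a ∷ c) (false ∷ T) (true ∷ x) = ≡.trans (cong (a *ℚ 1ℚ +ℚ_) (lin-split μ c T x))
  (ring μ a (q (weight x)) (linear (unmask T (shift μ c)) x) (linear (mask T (shift μ c)) x))
  where
  ring : ∀ m a k l l′ → a *ℚ 1ℚ +ℚ (m *ℚ k +ℚ l +ℚ l′) ≡ m *ℚ (1ℚ +ℚ k) +ℚ ((a - m) *ℚ 1ℚ +ℚ l) +ℚ (0ℚ *ℚ 1ℚ +ℚ l′)
  ring = solve-∀ ℚ-ring
lin-split μ (a ∷ c) (false ∷ T) (false ∷ x) = ≡.trans (cong (a *ℚ 0ℚ +ℚ_) (lin-split μ c T x))
  (ring μ a (q (weight x)) (linear (unmask T (shift μ c)) x) (linear (mask T (shift μ c)) x))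
  where
  ring : ∀ m a k l l′ → a *ℚ 0ℚ +ℚ (m *ℚ k +ℚ l +ℚ l′) ≡ m *ℚ k +ℚ ((a - m) *ℚ 0ℚ +ℚ l) +ℚ (0ℚ *ℚ 0ℚ +ℚ l′)
  ring = solve-∀ ℚ-ring

sumsq-unmask : ∀ μ c T → sumsq (unmask T (shift μ c)) ≡ off μ c T
sumsq-unmask μ []      []          = ≡.refl
sumsq-unmask μ (a ∷ c) (true ∷ T)  = ≡.trans (ℚₚ.+-identityˡ _) (sumsq-unmask μ c T)
sumsq-unmask μ (a ∷ c) (false ∷ T) = cong (sq (a - μ) +ℚ_) (sumsq-unmask μ c T)

linear-negate : ∀ {n} T (u : Vec ℚ n) x → linear (mask T (negate u)) x ≡ - linear (mask T u) x
linear-negate []          []      []      = ≡.refl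
linear-negate (true ∷ T)  (a ∷ u) (b ∷ x) = ≡.trans (cong (- a *ℚ toℚ b +ℚ_) (linear-negate T u x)) (ring a (toℚ b) (linear (mask T u) x))
  where
  ring : ∀ a b l → - a *ℚ b +ℚ - l ≡ - (a *ℚ b +ℚ l)
  ring = solve-∀ ℚ-ring
linear-negate (false ∷ T) (a ∷ u) (b ∷ x) = ≡.trans (cong (0ℚ *ℚ toℚ b +ℚ_) (linear-negate T u x)) (ring (toℚ b) (linear (mask T u) x))
  where
  ring : ∀ b l → 0ℚ *ℚ b +ℚ - l ≡ - (0ℚ *ℚ b +ℚ l)
  ring = solve-∀ ℚ-ring

indicator : ∀ {n} → Vec Bool n → Vec ℚ n
indicator []      = []
indicator (b ∷ T) = toℚ b ∷ indicator T

sum-indicator : ∀ {n} (T : Vec Bool n) → sum (indicator T) ≡ q (weight T)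
sum-indicator []          = ≡.refl
sum-indicator (true ∷ T)  = cong (1ℚ +ℚ_) (sum-indicator T)
sum-indicator (false ∷ T) = ≡.trans (ℚₚ.+-identityˡ _) (sum-indicator T)

sumsq-indicator : ∀ {n} (T : Vec Bool n) → sumsq (indicator T) ≡ q (weight T)
sumsq-indicator []          = ≡.refl
sumsq-indicator (true ∷ T)  = cong (1ℚ +ℚ_) (sumsq-indicator T)
sumsq-indicator (false ∷ T) = ≡.trans (ℚₚ.+-identityˡ _) (sumsq-indicator T)

hits : ∀ {n} → Vec Bool n → Vec Bool n → ℕ
hits []          []          = 0
hits (true ∷ T)  (true ∷ x)  = suc (hits T x)
hits (true ∷ T)  (false ∷ x) = hits T x
hits (false ∷ T) (_ ∷ x)     = hits T x

linear-indicator : ∀ {n} (T : Vec Bool n) x → linear (indicator T) x ≡ q (hits T x)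
linear-indicator []          []          = ≡.refl
linear-indicator (true ∷ T)  (true ∷ x)  = cong (1ℚ +ℚ_) (linear-indicator T x)
linear-indicator (true ∷ T)  (false ∷ x) = ≡.trans (ℚₚ.+-identityˡ _) (linear-indicator T x)
linear-indicator (false ∷ T) (true ∷ x)  = ≡.trans (ℚₚ.+-identityˡ _) (linear-indicator T x)
linear-indicator (false ∷ T) (false ∷ x) = ≡.trans (ℚₚ.+-identityˡ _) (linear-indicator T x)

½≤ᵇ_ : ℚ → Bool
½≤ᵇ a with ℚₚ.≤-total ½ a
... | inj₁ _ = true
... | inj₂ _ = false

large : ∀ {n} → Vec Bool n → Vec ℚ n → Vec Bool n
large []          []      = []
large (true ∷ T)  (a ∷ u) = (½≤ᵇ a) ∷ large T u
large (false ∷ T) (_ ∷ u) = false ∷ large T u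

weight-large : ∀ {n} T (u : Vec ℚ n) → weight (large T u) ≤ weight T
weight-large []          []      = z≤n
weight-large (false ∷ T) (_ ∷ u) = weight-large T u
weight-large (true ∷ T)  (a ∷ u) with ½≤ᵇ a
... | true  = s≤s (weight-large T u)
... | false = ℕₚ.m≤n⇒m≤1+n (weight-large T u)

-- With at most one hit the sum over T is 0 or a single coefficient, and the maximum over `large` is
-- its rounding. Points with more hits are rare and only counted, by `double-hits≤`.
data Hits {n} (T : Vec Bool n) (u : Vec ℚ n) (x : Vec Bool n) : Set where
  miss : hits T x ≡ 0 → linear (mask T u) x ≡ 0ℚ → maxOn (large T u) x ≡ false → Hits T u x
  high : hits T x ≡ 1 → ½ ≤ℚ linear (mask T u) x → maxOn (large T u) x ≡ true → Hits T u x
  low  : hits T x ≡ 1 → linear (mask T u) x ≤ℚ ½ → maxOn (large T u) x ≡ false → Hits T u x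
  many : ∀ j → hits T x ≡ 2 + j → Hits T u x

classify : ∀ {n} T (u : Vec ℚ n) x → Hits T u x
classify []          []      []          = miss ≡.refl ≡.refl ≡.refl
classify (false ∷ T) (a ∷ u) (b ∷ x) with classify T u x
... | miss h l m = miss h (≡.trans (skip (toℚ b) _) l) m
  where
  skip : ∀ b l → 0ℚ *ℚ b +ℚ l ≡ l
  skip = solve-∀ ℚ-ring
... | high h l m = high h (subst (½ ≤ℚ_) (skip (toℚ b) _) l) m
  where
  skip : ∀ b l → l ≡ 0ℚ *ℚ b +ℚ l
  skip = solve-∀ ℚ-ring
... | low h l m  = low h (subst (_≤ℚ ½) (skip (toℚ b) _) l) m
  where
  skip : ∀ b l → l ≡ 0ℚ *ℚ b +ℚ l
  skip = solve-∀ ℚ-ring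
... | many j h   = many j h
classify (true ∷ T)  (a ∷ u) (false ∷ x) with classify T u x
... | miss h l m = miss h (≡.trans (skip a _) l) (≡.trans (cong (_∨ maxOn (large T u) x) (∧-zeroʳ (½≤ᵇ a))) m)
  where
  skip : ∀ a l → a *ℚ 0ℚ +ℚ l ≡ l
  skip = solve-∀ ℚ-ring
... | high h l m = high h (subst (½ ≤ℚ_) (skip a _) l) (≡.trans (cong (_∨ maxOn (large T u) x) (∧-zeroʳ (½≤ᵇ a))) m)
  where
  skip : ∀ a l → l ≡ a *ℚ 0ℚ +ℚ l
  skip = solve-∀ ℚ-ring
... | low h l m  = low h (subst (_≤ℚ ½) (skip a _) l) (≡.trans (cong (_∨ maxOn (large T u) x) (∧-zeroʳ (½≤ᵇ a))) m)
  where
  skip : ∀ a l → l ≡ a *ℚ 0ℚ +ℚ l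
  skip = solve-∀ ℚ-ring
... | many j h   = many j h
classify (true ∷ T)  (a ∷ u) (true ∷ x) with classify T u x
... | high h _ _ = many 0 (cong suc h)
... | low h _ _  = many 0 (cong suc h)
... | many j h   = many (suc j) (cong suc h)
... | miss h l m with ℚₚ.≤-total ½ a in eq
...   | inj₁ ½≤a = high (cong suc h) (subst (½ ≤ℚ_) value ½≤a) (cong (λ s → (s ∧ true) ∨ maxOn (large T u) x) (up eq))
  where
  value : a ≡ a *ℚ 1ℚ +ℚ linear (mask T u) x
  value = ≡.trans (ring a) (cong (a *ℚ 1ℚ +ℚ_) (sym l))
    where
    ring : ∀ a → a ≡ a *ℚ 1ℚ +ℚ 0ℚ
    ring = solve-∀ ℚ-ring
  up : ∀ {h} → ℚₚ.≤-total ½ a ≡ inj₁ h → ½≤ᵇ a ≡ true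
  up eq rewrite eq = ≡.refl
...   | inj₂ a≤½ = low (cong suc h) (subst (_≤ℚ ½) value a≤½) (≡.trans (cong (λ s → (s ∧ true) ∨ maxOn (large T u) x) (down eq)) m)
  where
  value : a ≡ a *ℚ 1ℚ +ℚ linear (mask T u) x
  value = ≡.trans (ring a) (cong (a *ℚ 1ℚ +ℚ_) (sym l))
    where
    ring : ∀ a → a ≡ a *ℚ 1ℚ +ℚ 0ℚ
    ring = solve-∀ ℚ-ring
  down : ∀ {h} → ℚₚ.≤-total ½ a ≡ inj₂ h → ½≤ᵇ a ≡ false
  down eq rewrite eq = ≡.refl

bool-dist≤1 : ∀ s t → sq (toℚ s - toℚ t) ≤ℚ 1ℚ
bool-dist≤1 true  true  = pos {1ℚ}
bool-dist≤1 true  false = ℚₚ.≤-refl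
bool-dist≤1 false true  = ℚₚ.≤-refl
bool-dist≤1 false false = pos {1ℚ}

-- With at most one hit, a wrong rounding means that the sum is at least 1/2 away from f, which
-- explains the 4. With j ≥ 2 hits the left side is at most 1, hence at most j² - j; this term is 0
-- for j = 0 and j = 1.
round-error : ∀ {n} f T (u : Vec ℚ n) x →
  sq (toℚ f - toℚ (maxOn (large T u) x)) ≤ℚ 4ℚ *ℚ sq (toℚ f - linear (mask T u) x) +ℚ (sq (q (hits T x)) - q (hits T x))
round-error f T u x with classify T u x
... | miss h l m = subst (λ s → sq (toℚ f - toℚ s) ≤ℚ 4ℚ *ℚ sq (toℚ f - linear (mask T u) x) +ℚ (sq (q (hits T x)) - q (hits T x))) (sym m)
  (by (≡.trans (cong₂ (λ l j → 4ℚ *ℚ sq (toℚ f - l) +ℚ (sq (q j) - q j) - sq (toℚ f - 0ℚ)) l h) (ring (toℚ f)))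
    (pos {+ 3 / 1} ⊗ sq≥0 (toℚ f)))
  where
  ring : ∀ f → 4ℚ *ℚ ((f - 0ℚ) *ℚ (f - 0ℚ)) +ℚ (0ℚ *ℚ 0ℚ - 0ℚ) - (f - 0ℚ) *ℚ (f - 0ℚ) ≡ + 3 / 1 *ℚ (f *ℚ f)
  ring = solve-∀ ℚ-ring
... | high h ½≤l m = subst₂ (λ s j → sq (toℚ f - toℚ s) ≤ℚ 4ℚ *ℚ sq (toℚ f - l) +ℚ (sq (q j) - q j)) (sym m) (sym h) (go f)
  where
  l = linear (mask T u) x
  go : ∀ f → sq (toℚ f - 1ℚ) ≤ℚ 4ℚ *ℚ sq (toℚ f - l) +ℚ (sq (1ℚ +ℚ 0ℚ) - (1ℚ +ℚ 0ℚ))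
  go true = by (ring l) (pos {4ℚ} ⊗ sq≥0 (1ℚ - l))
    where
    ring : ∀ l → 4ℚ *ℚ ((1ℚ - l) *ℚ (1ℚ - l)) +ℚ ((1ℚ +ℚ 0ℚ) *ℚ (1ℚ +ℚ 0ℚ) - (1ℚ +ℚ 0ℚ)) - (1ℚ - 1ℚ) *ℚ (1ℚ - 1ℚ) ≡ 4ℚ *ℚ ((1ℚ - l) *ℚ (1ℚ - l))
    ring = solve-∀ ℚ-ring
  go false = by (ring l) (pos {4ℚ} ⊗ gap ½≤l ⊗ gap ½≤l ⊕ pos {4ℚ} ⊗ gap ½≤l)
    where
    ring : ∀ l → 4ℚ *ℚ ((0ℚ - l) *ℚ (0ℚ - l)) +ℚ ((1ℚ +ℚ 0ℚ) *ℚ (1ℚ +ℚ 0ℚ) - (1ℚ +ℚ 0ℚ)) - (0ℚ - 1ℚ) *ℚ (0ℚ - 1ℚ) ≡ 4ℚ *ℚ (l - ½) *ℚ (l - ½) +ℚ 4ℚ *ℚ (l - ½)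
    ring = solve-∀ ℚ-ring
... | low h l≤½ m = subst₂ (λ s j → sq (toℚ f - toℚ s) ≤ℚ 4ℚ *ℚ sq (toℚ f - l) +ℚ (sq (q j) - q j)) (sym m) (sym h) (go f)
  where
  l = linear (mask T u) x
  go : ∀ f → sq (toℚ f - 0ℚ) ≤ℚ 4ℚ *ℚ sq (toℚ f - l) +ℚ (sq (1ℚ +ℚ 0ℚ) - (1ℚ +ℚ 0ℚ))
  go false = by (ring l) (pos {4ℚ} ⊗ sq≥0 (0ℚ - l))
    where
    ring : ∀ l → 4ℚ *ℚ ((0ℚ - l) *ℚ (0ℚ - l)) +ℚ ((1ℚ +ℚ 0ℚ) *ℚ (1ℚ +ℚ 0ℚ) - (1ℚ +ℚ 0ℚ)) - (0ℚ - 0ℚ) *ℚ (0ℚ - 0ℚ) ≡ 4ℚ *ℚ ((0ℚ - l) *ℚ (0ℚ - l))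
    ring = solve-∀ ℚ-ring
  go true = by (ring l) (pos {4ℚ} ⊗ gap l≤½ ⊗ gap l≤½ ⊕ pos {4ℚ} ⊗ gap l≤½)
    where
    ring : ∀ l → 4ℚ *ℚ ((1ℚ - l) *ℚ (1ℚ - l)) +ℚ ((1ℚ +ℚ 0ℚ) *ℚ (1ℚ +ℚ 0ℚ) - (1ℚ +ℚ 0ℚ)) - (1ℚ - 0ℚ) *ℚ (1ℚ - 0ℚ) ≡ 4ℚ *ℚ (½ - l) *ℚ (½ - l) +ℚ 4ℚ *ℚ (½ - l)
    ring = solve-∀ ℚ-ring
... | many j h = subst (λ i → sq (toℚ f - toℚ (maxOn (large T u) x)) ≤ℚ 4ℚ *ℚ sq (toℚ f - l) +ℚ (sq (q i) - q i)) (sym h)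
  (by (ring (sq (toℚ f - toℚ (maxOn (large T u) x))) (sq (toℚ f - l)) (q j))
    (gap (bool-dist≤1 f (maxOn (large T u) x)) ⊕ pos {4ℚ} ⊗ sq≥0 (toℚ f - l) ⊕ sq≥0 (q j) ⊕ pos {+ 3 / 1} ⊗ q≥0 j ⊕ pos {1ℚ}))
  where
  l = linear (mask T u) x
  ring : ∀ d e j → 4ℚ *ℚ e +ℚ ((1ℚ +ℚ (1ℚ +ℚ j)) *ℚ (1ℚ +ℚ (1ℚ +ℚ j)) - (1ℚ +ℚ (1ℚ +ℚ j))) - d ≡
    (1ℚ - d) +ℚ 4ℚ *ℚ e +ℚ j *ℚ j +ℚ + 3 / 1 *ℚ j +ℚ 1ℚ
  ring = solve-∀ ℚ-ring

-- Only the points missing T are used; there the approximation is the constant α, so α is nearly 0 or 1.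
miss-error : ∀ {n} f T (u : Vec ℚ n) x α d → (∀ b → d ≤ℚ sq (toℚ b - α)) → 0ℚ ≤ℚ d →
  d *ℚ (1ℚ - q (hits T x)) ≤ℚ sq (toℚ f - α - linear (mask T u) x)
miss-error f T u x α d d≤ 0≤d with classify T u x
... | miss h l m = by (≡.trans (cong₂ (λ l j → sq (toℚ f - α - l) - d *ℚ (1ℚ - q j)) l h) (ring (toℚ f) α d)) (gap (d≤ f))
  where
  ring : ∀ f a d → (f - a - 0ℚ) *ℚ (f - a - 0ℚ) - d *ℚ (1ℚ - 0ℚ) ≡ (f - a) *ℚ (f - a) - d
  ring = solve-∀ ℚ-ring
... | high h _ _ = by (≡.trans (cong (λ j → sq (toℚ f - α - linear (mask T u) x) - d *ℚ (1ℚ - q j)) h) (ring (toℚ f - α - linear (mask T u) x) d)) (sq≥0 (toℚ f - α - linear (mask T u) x))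
  where
  ring : ∀ e d → e *ℚ e - d *ℚ (1ℚ - (1ℚ +ℚ 0ℚ)) ≡ e *ℚ e
  ring = solve-∀ ℚ-ring
... | low h _ _ = by (≡.trans (cong (λ j → sq (toℚ f - α - linear (mask T u) x) - d *ℚ (1ℚ - q j)) h) (ring (toℚ f - α - linear (mask T u) x) d)) (sq≥0 (toℚ f - α - linear (mask T u) x))
  where
  ring : ∀ e d → e *ℚ e - d *ℚ (1ℚ - (1ℚ +ℚ 0ℚ)) ≡ e *ℚ e
  ring = solve-∀ ℚ-ring
... | many j h = by (≡.trans (cong (λ j → sq (toℚ f - α - linear (mask T u) x) - d *ℚ (1ℚ - q j)) h) (ring (toℚ f - α - linear (mask T u) x) d (q j)))
    (sq≥0 (toℚ f - α - linear (mask T u) x) ⊕ 0≤d ⊗ (pos {1ℚ} ⊕ q≥0 j))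
  where
  ring : ∀ e d j → e *ℚ e - d *ℚ (1ℚ - (1ℚ +ℚ (1ℚ +ℚ j))) ≡ e *ℚ e +ℚ d *ℚ (1ℚ +ℚ j)
  ring = solve-∀ ℚ-ring

nearest : ∀ α → ∃ λ s → ∀ b → sq (toℚ s - α) ≤ℚ sq (toℚ b - α)
nearest α with ℚₚ.≤-total ½ α
... | inj₁ ½≤α = true , λ { true → ℚₚ.≤-refl ; false → by (ring α) (pos {2ℚ} ⊗ gap ½≤α) }
  where
  ring : ∀ a → (0ℚ - a) *ℚ (0ℚ - a) - (1ℚ - a) *ℚ (1ℚ - a) ≡ 2ℚ *ℚ (a - ½)
  ring = solve-∀ ℚ-ring
... | inj₂ α≤½ = false , λ { false → ℚₚ.≤-refl ; true → by (ring α) (pos {2ℚ} ⊗ gap α≤½) }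
  where
  ring : ∀ a → (1ℚ - a) *ℚ (1ℚ - a) - (0ℚ - a) *ℚ (0ℚ - a) ≡ 2ℚ *ℚ (½ - a)
  ring = solve-∀ ℚ-ring

record CloseToMax (n : ℕ) (w : ℕ → ℚ) (p bound τ : ℚ) (f : Vec Bool n → Bool) : Set where
  constructor close-to-max
  field
    S        : Vec Bool n
    few      : weight S ≤ 1 ⊎ sq (q (weight S) *ℚ p) ≤ℚ bound
    distance : E n w (λ x → sq (toℚ (f x) - toℚ (maxOn S x))) ≤ℚ τ
             ⊎ E n w (λ x → sq (toℚ (not (f x)) - toℚ (maxOn S x))) ≤ℚ τ

in₁≡ : ∀ {n w p} → SliceWeight n w p → in₁ n w ≡ p
in₁≡ {zero}  S with () ← SliceWeight.4≤n S
in₁≡ {suc n} S = SliceWeight.one-in S n ≡.refl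

in₂-nonneg : ∀ n {w} → NonNeg w → 0ℚ ≤ℚ in₂ n w
in₂-nonneg zero          w≥0 = ℚₚ.≤-refl
in₂-nonneg (suc zero)    w≥0 = ℚₚ.≤-refl
in₂-nonneg (suc (suc n)) w≥0 = mass-nonneg n (w≥0 ∘ suc ∘ suc)

in₂≤ : ∀ {n w p} → SliceWeight n w p → in₂ n w ≤ℚ p *ℚ p
in₂≤ {zero}        S with () ← SliceWeight.4≤n S
in₂≤ {suc zero}    S with s≤s () ← SliceWeight.4≤n S
in₂≤ {suc (suc n)} S = SliceWeight.two-in≤ S n ≡.refl

-- With t the mass of two prescribed ones, the left side equals (p - t) Σ vᵢ² - (p² - t) (Σ vᵢ)².
-- Coordinates of the slice are negatively correlated, that is t ≤ p², so the last term may be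
-- dropped.
variance≤ : ∀ {n w p} → SliceWeight n w p → (v : Vec ℚ n) →
  E n w (λ x → sq (linear v x - p *ℚ sum v)) ≤ℚ p *ℚ sumsq v
variance≤ {n} {w} {p} S v = by (≡.trans (cong (λ t → p *ℚ Q - t) moment) (≡.trans
    (cong (λ c → p *ℚ Q - (Q *ℚ p +ℚ c *ℚ t +ℚ (- 2ℚ *ℚ p *ℚ s *ℚ (s *ℚ p) +ℚ sq (p *ℚ s) *ℚ 1ℚ))) (cross-eq Q X (sq s) (sum-sq v)))
    (ring p Q s t)))
  (sumsq-nonneg v ⊗ in₂-nonneg n w≥0 ⊕ sq≥0 s ⊗ gap (in₂≤ S))
  where
  open SliceWeight S
  Q = sumsq v
  X = cross v
  s = sum v
  t = in₂ n w
  sumsq-nonneg : ∀ {n} (v : Vec ℚ n) → 0ℚ ≤ℚ sumsq v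
  sumsq-nonneg []      = ℚₚ.≤-refl
  sumsq-nonneg (a ∷ v) = sq≥0 a ⊕ sumsq-nonneg v
  cross-eq : ∀ Q X s² → s² ≡ Q +ℚ 2ℚ *ℚ X → 2ℚ *ℚ X ≡ s² - Q
  cross-eq Q X _ ≡.refl = ring₀ Q X
    where
    ring₀ : ∀ Q X → 2ℚ *ℚ X ≡ Q +ℚ 2ℚ *ℚ X - Q
    ring₀ = solve-∀ ℚ-ring
  expand : ∀ l p s → (l - p *ℚ s) *ℚ (l - p *ℚ s) ≡ 1ℚ *ℚ (l *ℚ l) +ℚ 1ℚ *ℚ (- 2ℚ *ℚ p *ℚ s *ℚ l +ℚ p *ℚ s *ℚ (p *ℚ s) *ℚ 1ℚ)
  expand = solve-∀ ℚ-ring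
  moment : E n w (λ x → sq (linear v x - p *ℚ s)) ≡ Q *ℚ p +ℚ 2ℚ *ℚ X *ℚ t +ℚ (- 2ℚ *ℚ p *ℚ s *ℚ (s *ℚ p) +ℚ sq (p *ℚ s) *ℚ 1ℚ)
  moment = begin
    E n w (λ x → sq (linear v x - p *ℚ s))
      ≡⟨ E-cong n (λ x → expand (linear v x) p s) ⟩
    E n w (λ x → 1ℚ *ℚ sq (linear v x) +ℚ 1ℚ *ℚ (- 2ℚ *ℚ p *ℚ s *ℚ linear v x +ℚ sq (p *ℚ s) *ℚ 1ℚ))
      ≡⟨ E-lin n 1ℚ 1ℚ (sq ∘ linear v) (λ x → - 2ℚ *ℚ p *ℚ s *ℚ linear v x +ℚ sq (p *ℚ s) *ℚ 1ℚ) ⟩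
    1ℚ *ℚ E n w (sq ∘ linear v) +ℚ 1ℚ *ℚ E n w (λ x → - 2ℚ *ℚ p *ℚ s *ℚ linear v x +ℚ sq (p *ℚ s) *ℚ 1ℚ)
      ≡⟨ cong₂ _+ℚ_ (ℚₚ.*-identityˡ (E n w (sq ∘ linear v))) (≡.trans (ℚₚ.*-identityˡ (E n w (λ x → - 2ℚ *ℚ p *ℚ s *ℚ linear v x +ℚ sq (p *ℚ s) *ℚ 1ℚ))) (E-lin n {w} (- 2ℚ *ℚ p *ℚ s) (sq (p *ℚ s)) (linear v) (λ _ → 1ℚ))) ⟩
    E n w (sq ∘ linear v) +ℚ (- 2ℚ *ℚ p *ℚ s *ℚ E n w (linear v) +ℚ sq (p *ℚ s) *ℚ mass n w)
      ≡⟨ cong₂ (λ a b → a +ℚ (- 2ℚ *ℚ p *ℚ s *ℚ b +ℚ sq (p *ℚ s) *ℚ mass n w)) (linear-moment₂ v w) (linear-moment₁ v w) ⟩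
    Q *ℚ in₁ n w +ℚ 2ℚ *ℚ X *ℚ t +ℚ (- 2ℚ *ℚ p *ℚ s *ℚ (s *ℚ in₁ n w) +ℚ sq (p *ℚ s) *ℚ mass n w)
      ≡⟨ cong₂ (λ i m → Q *ℚ i +ℚ 2ℚ *ℚ X *ℚ t +ℚ (- 2ℚ *ℚ p *ℚ s *ℚ (s *ℚ i) +ℚ sq (p *ℚ s) *ℚ m)) (in₁≡ S) mass-n ⟩
    _ ∎
    where open ≡-Reasoning
  ring : ∀ p Q s t → p *ℚ Q - (Q *ℚ p +ℚ (s *ℚ s - Q) *ℚ t +ℚ (- 2ℚ *ℚ p *ℚ s *ℚ (s *ℚ p) +ℚ p *ℚ s *ℚ (p *ℚ s) *ℚ 1ℚ)) ≡ Q *ℚ t +ℚ s *ℚ s *ℚ (p *ℚ p - t)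
  ring = solve-∀ ℚ-ring

hits-moment₁ : ∀ {n w p} → SliceWeight n w p → (T : Vec Bool n) → E n w (λ x → q (hits T x)) ≡ q (weight T) *ℚ p
hits-moment₁ {n} {w} S T = ≡.trans (E-cong n (λ x → sym (linear-indicator T x)))
  (≡.trans (linear-moment₁ (indicator T) w) (cong₂ _*ℚ_ (sum-indicator T) (in₁≡ S)))

-- The integrand counts ordered pairs of distinct hits, and each such pair of places has mass `in₂`.
hits-moment₂ : ∀ {n w p} → SliceWeight n w p → (T : Vec Bool n) →
  E n w (λ x → sq (q (hits T x)) - q (hits T x)) ≡ (sq (q (weight T)) - q (weight T)) *ℚ in₂ n w
hits-moment₂ {n} {w} {p} S T = begin
  E n w (λ x → sq (q (hits T x)) - q (hits T x))
    ≡⟨ E-cong n (λ x → ≡.trans (cong (λ t → sq t - t) (sym (linear-indicator T x))) (ring₀ (linear v x))) ⟩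
  E n w (λ x → 1ℚ *ℚ sq (linear v x) +ℚ - 1ℚ *ℚ linear v x)
    ≡⟨ E-lin n 1ℚ (- 1ℚ) (sq ∘ linear v) (linear v) ⟩
  1ℚ *ℚ E n w (sq ∘ linear v) +ℚ - 1ℚ *ℚ E n w (linear v)
    ≡⟨ cong₂ (λ a b → 1ℚ *ℚ a +ℚ - 1ℚ *ℚ b) (linear-moment₂ v w) (linear-moment₁ v w) ⟩
  1ℚ *ℚ (sumsq v *ℚ in₁ n w +ℚ 2ℚ *ℚ cross v *ℚ in₂ n w) +ℚ - 1ℚ *ℚ (sum v *ℚ in₁ n w)
    ≡⟨ ring₁ (sumsq v) (cross v) (sum v) (in₁ n w) (in₂ n w) ⟩
  ((sumsq v +ℚ 2ℚ *ℚ cross v) - sumsq v) *ℚ in₂ n w +ℚ (sumsq v - sum v) *ℚ in₁ n w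
    ≡⟨ cong₂ (λ a b → (a - b) *ℚ in₂ n w +ℚ (b - sum v) *ℚ in₁ n w) (sym (sum-sq v)) (sumsq-indicator T) ⟩
  (sq (sum v) - q (weight T)) *ℚ in₂ n w +ℚ (q (weight T) - sum v) *ℚ in₁ n w
    ≡⟨ cong (λ a → (sq a - q (weight T)) *ℚ in₂ n w +ℚ (q (weight T) - a) *ℚ in₁ n w) (sum-indicator T) ⟩
  (sq (q (weight T)) - q (weight T)) *ℚ in₂ n w +ℚ (q (weight T) - q (weight T)) *ℚ in₁ n w
    ≡⟨ ring₂ (q (weight T)) (in₁ n w) (in₂ n w) ⟩
  _ ∎
  where
  open ≡-Reasoning
  v = indicator T
  ring₀ : ∀ l → l *ℚ l - l ≡ 1ℚ *ℚ (l *ℚ l) +ℚ - 1ℚ *ℚ l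
  ring₀ = solve-∀ ℚ-ring
  ring₁ : ∀ Q X s i j → 1ℚ *ℚ (Q *ℚ i +ℚ 2ℚ *ℚ X *ℚ j) +ℚ - 1ℚ *ℚ (s *ℚ i) ≡ ((Q +ℚ 2ℚ *ℚ X) - Q) *ℚ j +ℚ (Q - s) *ℚ i
  ring₁ = solve-∀ ℚ-ring
  ring₂ : ∀ s i j → (s *ℚ s - s) *ℚ j +ℚ (s - s) *ℚ i ≡ (s *ℚ s - s) *ℚ j
  ring₂ = solve-∀ ℚ-ring

double-hits≤ : ∀ {n w p η} → SliceWeight n w p → (T : Vec Bool n) → 0ℚ ≤ℚ η →
  weight T ≤ 1 ⊎ sq (q (weight T) *ℚ p) ≤ℚ η → E n w (λ x → sq (q (hits T x)) - q (hits T x)) ≤ℚ η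
double-hits≤ {n} {w} {p} {η} S T 0≤η small = subst (_≤ℚ η) (sym (hits-moment₂ S T)) (go (weight T) small)
  where
  open SliceWeight S
  go : ∀ j → j ≤ 1 ⊎ sq (q j *ℚ p) ≤ℚ η → (sq (q j) - q j) *ℚ in₂ n w ≤ℚ η
  go zero    (inj₁ _) = subst (_≤ℚ η) (sym (ℚₚ.*-zeroˡ (in₂ n w))) 0≤η
  go (suc zero)    (inj₁ _) = subst (_≤ℚ η) (sym (ℚₚ.*-zeroˡ (in₂ n w))) 0≤η
  go (suc (suc j)) (inj₁ (s≤s ()))
  go j       (inj₂ h) = by (ring (q j) p (in₂ n w) η) (gap h ⊕ sq≥0 (q j) ⊗ gap (in₂≤ S) ⊕ q≥0 j ⊗ in₂-nonneg n w≥0)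
    where
    ring : ∀ j p t η → η - (j *ℚ j - j) *ℚ t ≡ (η - j *ℚ p *ℚ (j *ℚ p)) +ℚ j *ℚ j *ℚ (p *ℚ p - t) +ℚ j *ℚ t
    ring = solve-∀ ℚ-ring

-- 34 = 2 + 2 · 16 adds the error of ℓ and the variance off T; 6 = 2 + 2 · 2 pays for moving α to
-- the nearest bit.
6ℚ 34ℚ : ℚ
6ℚ = + 6 / 1
34ℚ = + 34 / 1

module Rounding {c w p ε k} (S : SliceWeight (length c) w p)
  (supported : ∀ F G → (∀ x → weight x ≡ k → F x ≡ G x) → E (length c) w F ≡ E (length c) w G)
  (η : ℚ) (η≥0 : 0ℚ ≤ℚ η) (conc : Concentrated p η (16ℚ *ℚ ε) c)
  (f : Bits c → Bool) (near : E (length c) w (λ x → sq (err c f x)) ≤ℚ ε) where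
  open SliceWeight S
  open Concentrated conc

  n = length c
  u = shift μ c
  v = unmask T u
  on = linear (mask T u)
  -- On the slice μ Σ xᵢ equals μ k, and p Σ vᵢ is the mean of the part off T.
  α = μ *ℚ q k +ℚ p *ℚ sum v
  N = λ x → q (hits T x)

  deviation : E n w (λ x → sq (toℚ (f x) - α - on x)) ≤ℚ 34ℚ *ℚ ε
  deviation = begin
    E n w (λ x → sq (toℚ (f x) - α - on x))
      ≡⟨ supported _ _ (λ x wt → cong sq (split x wt)) ⟩
    E n w (λ x → sq (err c f x +ℚ ρ x))
      ≤⟨ E-mono n w≥0 (λ x → by (ring (err c f x) (ρ x)) (sq≥0 (err c f x - ρ x))) ⟩
    E n w (λ x → 2ℚ *ℚ sq (err c f x) +ℚ 2ℚ *ℚ sq (ρ x))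
      ≡⟨ E-lin n 2ℚ 2ℚ (sq ∘ err c f) (sq ∘ ρ) ⟩
    2ℚ *ℚ E n w (sq ∘ err c f) +ℚ 2ℚ *ℚ E n w (sq ∘ ρ)
      ≤⟨ by (ring′ (E n w (sq ∘ err c f)) (E n w (sq ∘ ρ)) (p *ℚ sumsq v) ε)
           (pos {2ℚ} ⊗ gap near ⊕ pos {2ℚ} ⊗ gap (variance≤ S v)
            ⊕ pos {2ℚ} ⊗ gap (subst (λ o → p *ℚ o ≤ℚ 16ℚ *ℚ ε) (sym (sumsq-unmask μ c T)) off≤)) ⟩
    34ℚ *ℚ ε ∎
    where
    open ℚₚ.≤-Reasoning
    ρ = λ x → linear v x - p *ℚ sum v
    split : ∀ x → weight x ≡ k → toℚ (f x) - α - on x ≡ err c f x +ℚ ρ x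
    split x ≡.refl = ≡.trans (ring₀ (toℚ (f x)) (μ *ℚ q (weight x)) (p *ℚ sum v) (linear v x) (on x))
      (cong (λ l → toℚ (f x) - l +ℚ ρ x) (sym (lin-split μ c T x)))
      where
      ring₀ : ∀ f a b l o → f - (a +ℚ b) - o ≡ f - (a +ℚ l +ℚ o) +ℚ (l - b)
      ring₀ = solve-∀ ℚ-ring
    ring : ∀ e r → 2ℚ *ℚ (e *ℚ e) +ℚ 2ℚ *ℚ (r *ℚ r) - (e +ℚ r) *ℚ (e +ℚ r) ≡ (e - r) *ℚ (e - r)
    ring = solve-∀ ℚ-ring
    ring′ : ∀ e r g ε → 34ℚ *ℚ ε - (2ℚ *ℚ e +ℚ 2ℚ *ℚ r) ≡ 2ℚ *ℚ (ε - e) +ℚ 2ℚ *ℚ (g - r) +ℚ 2ℚ *ℚ (16ℚ *ℚ ε - g)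
    ring′ = solve-∀ ℚ-ring

  s : Bool
  s = proj₁ (nearest α)

  d : ℚ
  d = sq (toℚ s - α)

  -- 1 - N is at most the indicator that x misses T and has mean 1 - |T| p ≥ 1/2, while each missing
  -- point has squared deviation at least d.
  d≤ : d ≤ℚ 2ℚ *ℚ (34ℚ *ℚ ε)
  d≤ = by (ring d (q (weight T) *ℚ p) (34ℚ *ℚ ε)) (pos {2ℚ} ⊗ gap through ⊕ pos {2ℚ} ⊗ d≥0 ⊗ gap sparse)
    where
    d≥0 : 0ℚ ≤ℚ d
    d≥0 = sq≥0 (toℚ s - α)
    through : d *ℚ (1ℚ - q (weight T) *ℚ p) ≤ℚ 34ℚ *ℚ ε
    through = begin
      d *ℚ (1ℚ - q (weight T) *ℚ p)
        ≡⟨ ring₀ d (q (weight T) *ℚ p) ⟩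
      d *ℚ 1ℚ +ℚ - d *ℚ (q (weight T) *ℚ p)
        ≡⟨ cong₂ (λ a b → d *ℚ a +ℚ - d *ℚ b) mass-n (hits-moment₁ S T) ⟨
      d *ℚ mass n w +ℚ - d *ℚ E n w N
        ≡⟨ E-lin n d (- d) (λ _ → 1ℚ) N ⟨
      E n w (λ x → d *ℚ 1ℚ +ℚ - d *ℚ N x)
        ≡⟨ E-cong n (λ x → ring₀ d (N x)) ⟨
      E n w (λ x → d *ℚ (1ℚ - N x))
        ≤⟨ E-mono n w≥0 (λ x → miss-error (f x) T u x α d (proj₂ (nearest α)) d≥0) ⟩
      E n w (λ x → sq (toℚ (f x) - α - on x))
        ≤⟨ deviation ⟩
      34ℚ *ℚ ε ∎
      where
      open ℚₚ.≤-Reasoning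
      ring₀ : ∀ d t → d *ℚ (1ℚ - t) ≡ d *ℚ 1ℚ +ℚ - d *ℚ t
      ring₀ = solve-∀ ℚ-ring
    ring : ∀ d t e → 2ℚ *ℚ e - d ≡ 2ℚ *ℚ (e - d *ℚ (1ℚ - t)) +ℚ 2ℚ *ℚ d *ℚ (½ - t)
    ring = solve-∀ ℚ-ring

  rounded : E n w (λ x → sq (toℚ (f x) - toℚ s - on x)) ≤ℚ 6ℚ *ℚ (34ℚ *ℚ ε)
  rounded = begin
    E n w (λ x → sq (toℚ (f x) - toℚ s - on x))
      ≤⟨ E-mono n w≥0 (λ x → by (ring (toℚ (f x)) (toℚ s) α (on x)) (sq≥0 (toℚ (f x) - α - on x +ℚ (toℚ s - α)))) ⟩
    E n w (λ x → 2ℚ *ℚ sq (toℚ (f x) - α - on x) +ℚ 2ℚ *ℚ d *ℚ 1ℚ)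
      ≡⟨ E-lin n 2ℚ (2ℚ *ℚ d) (λ x → sq (toℚ (f x) - α - on x)) (λ _ → 1ℚ) ⟩
    2ℚ *ℚ E n w (λ x → sq (toℚ (f x) - α - on x)) +ℚ 2ℚ *ℚ d *ℚ mass n w
      ≡⟨ cong (λ m → 2ℚ *ℚ E n w (λ x → sq (toℚ (f x) - α - on x)) +ℚ 2ℚ *ℚ d *ℚ m) mass-n ⟩
    2ℚ *ℚ E n w (λ x → sq (toℚ (f x) - α - on x)) +ℚ 2ℚ *ℚ d *ℚ 1ℚ
      ≤⟨ by (ring′ (E n w (λ x → sq (toℚ (f x) - α - on x))) d (34ℚ *ℚ ε)) (pos {2ℚ} ⊗ gap deviation ⊕ pos {2ℚ} ⊗ gap d≤) ⟩
    6ℚ *ℚ (34ℚ *ℚ ε) ∎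
    where
    open ℚₚ.≤-Reasoning
    ring : ∀ f s a o → 2ℚ *ℚ ((f - a - o) *ℚ (f - a - o)) +ℚ 2ℚ *ℚ ((s - a) *ℚ (s - a)) *ℚ 1ℚ - (f - s - o) *ℚ (f - s - o)
      ≡ (f - a - o +ℚ (s - a)) *ℚ (f - a - o +ℚ (s - a))
    ring = solve-∀ ℚ-ring
    ring′ : ∀ e d t → 6ℚ *ℚ t - (2ℚ *ℚ e +ℚ 2ℚ *ℚ d *ℚ 1ℚ) ≡ 2ℚ *ℚ (t - e) +ℚ 2ℚ *ℚ (2ℚ *ℚ t - d)
    ring′ = solve-∀ ℚ-ring

  τ : ℚ
  τ = 4ℚ *ℚ (6ℚ *ℚ (34ℚ *ℚ ε)) +ℚ η

  -- Generic in `g` and `u′` so as to serve f with u when s is 0, and 1 - f with the negated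
  -- coefficients when s is 1.
  max-distance : ∀ (g : Bits c → Bool) u′ → (∀ x → sq (toℚ (g x) - linear (mask T u′) x) ≡ sq (toℚ (f x) - toℚ s - on x)) →
    E n w (λ x → sq (toℚ (g x) - toℚ (maxOn (large T u′) x))) ≤ℚ τ
  max-distance g u′ same = begin
    E n w (λ x → sq (toℚ (g x) - toℚ (maxOn (large T u′) x)))
      ≤⟨ E-mono n w≥0 (λ x → round-error (g x) T u′ x) ⟩
    E n w (λ x → 4ℚ *ℚ sq (toℚ (g x) - linear (mask T u′) x) +ℚ (sq (N x) - N x))
      ≡⟨ E-+ n (λ x → 4ℚ *ℚ sq (toℚ (g x) - linear (mask T u′) x)) (λ x → sq (N x) - N x) ⟩
    E n w (λ x → 4ℚ *ℚ sq (toℚ (g x) - linear (mask T u′) x)) +ℚ E n w (λ x → sq (N x) - N x)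
      ≡⟨ cong (_+ℚ E n w (λ x → sq (N x) - N x)) (≡.trans (E-* n 4ℚ (λ x → sq (toℚ (g x) - linear (mask T u′) x)))
           (cong (4ℚ *ℚ_) (E-cong n same))) ⟩
    4ℚ *ℚ E n w (λ x → sq (toℚ (f x) - toℚ s - on x)) +ℚ E n w (λ x → sq (N x) - N x)
      ≤⟨ ℚₚ.+-mono-≤ (ℚₚ.*-monoˡ-≤-nonNeg 4ℚ rounded) (double-hits≤ S T η≥0 small) ⟩
    τ ∎
    where open ℚₚ.≤-Reasoning

  few-large : ∀ u′ → weight (large T u′) ≤ 1 ⊎ sq (q (weight (large T u′)) *ℚ p) ≤ℚ η
  few-large u′ = go small
    where
    go : weight T ≤ 1 ⊎ sq (q (weight T) *ℚ p) ≤ℚ η → weight (large T u′) ≤ 1 ⊎ sq (q (weight (large T u′)) *ℚ p) ≤ℚ η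
    go (inj₁ h) = inj₁ (ℕₚ.≤-trans (weight-large T u′) h)
    go (inj₂ h) = inj₂ (ℚₚ.≤-trans (sq-mono (q≥0 (weight (large T u′)) ⊗ p≥0)
      (ℚₚ.*-monoʳ-≤-nonNeg p {{ℚ.nonNegative p≥0}} (q-mono (weight-large T u′)))) h)

  conclusion : CloseToMax n w p η τ f
  conclusion = go s ≡.refl
    where
    go : ∀ b → s ≡ b → CloseToMax n w p η τ f
    go false s≡ = close-to-max (large T u) (few-large u) (inj₁ (max-distance f u
      (λ x → ≡.trans (cong sq (ring (toℚ (f x)) (on x))) (cong (λ b → sq (toℚ (f x) - toℚ b - on x)) (sym s≡)))))
      where
      ring : ∀ f o → f - o ≡ f - 0ℚ - o
      ring = solve-∀ ℚ-ring
    go true s≡ = close-to-max (large T (negate u)) (few-large (negate u)) (inj₂ (max-distance (not ∘ f) (negate u)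
      (λ x → ≡.trans (cong (λ l → sq (toℚ (not (f x)) - l)) (linear-negate T u x))
        (≡.trans (flip (f x) (on x)) (cong (λ b → sq (toℚ (f x) - toℚ b - on x)) (sym s≡))))))
      where
      flip : ∀ b o → sq (toℚ (not b) - - o) ≡ sq (toℚ b - 1ℚ - o)
      flip true = ring
        where
        ring : ∀ o → (0ℚ - - o) *ℚ (0ℚ - - o) ≡ (1ℚ - 1ℚ - o) *ℚ (1ℚ - 1ℚ - o)
        ring = solve-∀ ℚ-ring
      flip false = ring
        where
        ring : ∀ o → (1ℚ - - o) *ℚ (1ℚ - - o) ≡ (0ℚ - 1ℚ - o) *ℚ (0ℚ - 1ℚ - o)
        ring = solve-∀ ℚ-ring

-- The weight of a slice

-- Replaces division: ratios of binomial coefficients become polynomial identities once multiplied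
-- by n, n - 1 and so on, and the positive factor is cancelled afterwards.
cancel-pos : ∀ {a x r} → 0ℚ <ℚ a → a *ℚ x ≡ r → 0ℚ ≤ℚ r → 0ℚ ≤ℚ x
cancel-pos {a} {x} 0<a eq 0≤r = ℚₚ.*-cancelˡ-≤-pos a {{ℚ.positive 0<a}}
  (subst (_≤ℚ a *ℚ x) (sym (ℚₚ.*-zeroʳ a)) (0≤* eq 0≤r))

cancel-≤ : ∀ {a x y r} → 0ℚ <ℚ a → a *ℚ (y - x) ≡ r → 0ℚ ≤ℚ r → x ≤ℚ y
cancel-≤ 0<a eq 0≤r = by ≡.refl (cancel-pos 0<a eq 0≤r)

q-pos : ∀ n → 0ℚ <ℚ q (suc n)
q-pos n = ℚₚ.<-≤-trans (ℚₚ.positive⁻¹ 1ℚ) (by (ring (q n)) (q≥0 n))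
  where
  ring : ∀ a → 1ℚ +ℚ a - 1ℚ ≡ a
  ring = solve-∀ ℚ-ring

-- w vanishes outside κ, in a form that is stable under w ↦ w ∘ suc, κ ↦ κ - 1.
record At (κ : ℚ) (w : ℕ → ℚ) : Set where
  constructor at-all
  field eigen : ∀ j → q j *ℚ w j ≡ κ *ℚ w j

open At

At-suc : ∀ {κ w} → At κ w → At (κ - 1ℚ) (w ∘ suc)
At-suc {κ} {w} at = at-all λ j → ≡.trans (ring (q j) (w (suc j))) (≡.trans (cong (_- w (suc j)) (eigen at (suc j))) (ring′ κ (w (suc j))))
  where
  ring : ∀ j v → j *ℚ v ≡ (1ℚ +ℚ j) *ℚ v - v
  ring = solve-∀ ℚ-ring
  ring′ : ∀ k v → k *ℚ v - v ≡ (k - 1ℚ) *ℚ v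
  ring′ = solve-∀ ℚ-ring

-- (n + 1) C(n, k - 1) = k C(n + 1, k)
absorption : ∀ n {κ w} → At κ w → q (suc n) *ℚ mass n (w ∘ suc) ≡ κ *ℚ mass (suc n) w
absorption zero {κ} {w} at = ≡.trans (ring (w 0) (w 1)) (≡.trans (cong₂ _+ℚ_ (eigen at 0) (eigen at 1)) (ring′ κ (w 0) (w 1)))
  where
  ring : ∀ a b → (1ℚ +ℚ 0ℚ) *ℚ (b *ℚ 1ℚ) ≡ 0ℚ *ℚ a +ℚ (1ℚ +ℚ 0ℚ) *ℚ b
  ring = solve-∀ ℚ-ring
  ring′ : ∀ k a b → k *ℚ a +ℚ k *ℚ b ≡ k *ℚ (a *ℚ 1ℚ +ℚ b *ℚ 1ℚ)
  ring′ = solve-∀ ℚ-ring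
absorption (suc n) {κ} {w} at = begin
  (1ℚ +ℚ q (suc n)) *ℚ (mass n (w ∘ suc) +ℚ mass n (w ∘ suc ∘ suc))
    ≡⟨ ring (q (suc n)) (mass n (w ∘ suc)) (mass n (w ∘ suc ∘ suc)) ⟩
  mass (suc n) (w ∘ suc) +ℚ (q (suc n) *ℚ mass n (w ∘ suc) +ℚ q (suc n) *ℚ mass n (w ∘ suc ∘ suc))
    ≡⟨ cong (mass (suc n) (w ∘ suc) +ℚ_) (cong₂ _+ℚ_ (absorption n at) (absorption n (At-suc at))) ⟩
  mass (suc n) (w ∘ suc) +ℚ (κ *ℚ mass (suc n) w +ℚ (κ - 1ℚ) *ℚ mass (suc n) (w ∘ suc))
    ≡⟨ ring′ κ (mass (suc n) w) (mass (suc n) (w ∘ suc)) ⟩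
  κ *ℚ (mass (suc n) w +ℚ mass (suc n) (w ∘ suc)) ∎
  where
  open ≡-Reasoning
  ring : ∀ n a b → (1ℚ +ℚ n) *ℚ (a +ℚ b) ≡ (a +ℚ b) +ℚ (n *ℚ a +ℚ n *ℚ b)
  ring = solve-∀ ℚ-ring
  ring′ : ∀ k a b → b +ℚ (k *ℚ a +ℚ (k - 1ℚ) *ℚ b) ≡ k *ℚ (a +ℚ b)
  ring′ = solve-∀ ℚ-ring

-- (n + 1) C(n, k) = (n + 1 - k) C(n + 1, k)
absorption-0 : ∀ n {κ w} → At κ w → q (suc n) *ℚ mass n w ≡ (q (suc n) - κ) *ℚ mass (suc n) w
absorption-0 n {κ} {w} at = ≡.trans (ring (q (suc n)) (mass n w) (mass n (w ∘ suc)))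
  (≡.trans (cong (λ t → q (suc n) *ℚ mass (suc n) w - t) (absorption n at)) (ring′ (q (suc n)) κ (mass (suc n) w)))
  where
  ring : ∀ n a b → n *ℚ a ≡ n *ℚ (a +ℚ b) - n *ℚ b
  ring = solve-∀ ℚ-ring
  ring′ : ∀ n k m → n *ℚ m - k *ℚ m ≡ (n - k) *ℚ m
  ring′ = solve-∀ ℚ-ring

-- The dimension is written 4 + n, so that four coordinates can be prescribed without case
-- distinctions.
module SliceFacts (n k : ℕ) {w : ℕ → ℚ} {p : ℚ} (2≤k : 2 ≤ k) (2k≤n : 2 * k ≤ 4 + n) (w≥0 : NonNeg w)
  (at : At (q k) w) (mass≡1 : mass (4 + n) w ≡ 1ℚ) (np≡k : q (4 + n) *ℚ p ≡ q k) where

  κ N a₂ b₁ b₂ : ℚ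
  κ = q k
  N = q (4 + n)
  a₂ = mass (2 + n) (w ∘ suc ∘ suc)
  b₁ = mass (2 + n) (w ∘ suc)
  b₂ = mass n (w ∘ suc ∘ suc)

  κ≥2 : 2ℚ ≤ℚ κ
  κ≥2 = q-mono 2≤k

  N≥2κ : 2ℚ *ℚ κ ≤ℚ N
  N≥2κ = subst (_≤ℚ N) (q-* 2 k) (q-mono 2k≤n)

  p≥0 : 0ℚ ≤ℚ p
  p≥0 = cancel-pos (q-pos (3 + n)) np≡k (q≥0 k)

  p≤½ : p ≤ℚ ½
  p≤½ = cancel-≤ (q-pos (3 + n)) (≡.trans (ring N p) (cong (λ t → ½ *ℚ (N - 2ℚ *ℚ t)) np≡k)) (pos {½} ⊗ gap N≥2κ)
    where
    ring : ∀ N p → N *ℚ (½ - p) ≡ ½ *ℚ (N - 2ℚ *ℚ (N *ℚ p))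
    ring = solve-∀ ℚ-ring

  1-p≥0 : 0ℚ ≤ℚ 1ℚ - p
  1-p≥0 = gap (ℚₚ.≤-trans p≤½ (by ≡.refl (pos {½})))

  one-in : mass (3 + n) (w ∘ suc) ≡ p
  one-in = ℚₚ.≤-antisym
    (cancel-≤ (q-pos (3 + n)) (zero-diff _ _ Na₁≡Np) ℚₚ.≤-refl)
    (cancel-≤ (q-pos (3 + n)) (zero-diff _ _ (sym Na₁≡Np)) ℚₚ.≤-refl)
    where
    Na₁≡Np : N *ℚ mass (3 + n) (w ∘ suc) ≡ N *ℚ p
    Na₁≡Np = ≡.trans (absorption (3 + n) at) (≡.trans (cong (κ *ℚ_) mass≡1) (≡.trans (ℚₚ.*-identityʳ κ) (sym np≡k)))
    zero-diff : ∀ x y → N *ℚ x ≡ N *ℚ y → N *ℚ (y - x) ≡ 0ℚ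
    zero-diff x y eq = ≡.trans (ring N x y) (≡.trans (cong (λ t → N *ℚ y - t) eq) (ℚₚ.+-inverseʳ (N *ℚ y)))
      where
      ring : ∀ N x y → N *ℚ (y - x) ≡ N *ℚ y - N *ℚ x
      ring = solve-∀ ℚ-ring

  eq-a₂ : q (3 + n) *ℚ a₂ ≡ (κ - 1ℚ) *ℚ p
  eq-a₂ = ≡.trans (absorption (2 + n) (At-suc at)) (cong ((κ - 1ℚ) *ℚ_) one-in)

  eq-a₃ : q (2 + n) *ℚ mass (1 + n) (w ∘ suc ∘ suc ∘ suc) ≡ (κ - 1ℚ - 1ℚ) *ℚ a₂
  eq-a₃ = absorption (1 + n) (At-suc (At-suc at))

  eq-b₁ : q (3 + n) *ℚ b₁ ≡ (q (3 + n) - (κ - 1ℚ)) *ℚ p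
  eq-b₁ = ≡.trans (absorption-0 (2 + n) (At-suc at)) (cong ((q (3 + n) - (κ - 1ℚ)) *ℚ_) one-in)

  c₁ : ℚ
  c₁ = mass (1 + n) (w ∘ suc ∘ suc)

  eq-c₁ : q (2 + n) *ℚ c₁ ≡ (κ - 1ℚ) *ℚ b₁
  eq-c₁ = absorption (1 + n) (At-suc at)

  eq-b₂ : q (1 + n) *ℚ b₂ ≡ (q (1 + n) - (κ - 1ℚ - 1ℚ)) *ℚ c₁
  eq-b₂ = absorption-0 n (At-suc (At-suc at))

  a₂≥0 : 0ℚ ≤ℚ a₂
  a₂≥0 = mass-nonneg (2 + n) (w≥0 ∘ suc ∘ suc)

  b₁≥0 : 0ℚ ≤ℚ b₁
  b₁≥0 = mass-nonneg (2 + n) (w≥0 ∘ suc)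

  two-in≤ : a₂ ≤ℚ p *ℚ p
  two-in≤ = cancel-≤ (q-pos (2 + n)) (≡.trans (ring (q (3 + n)) p a₂)
    (≡.trans (cong₂ (λ s t → s *ℚ p - p *ℚ p - t) np≡k eq-a₂) (ring′ κ p))) (p≥0 ⊗ 1-p≥0)
    where
    ring : ∀ M p a → M *ℚ (p *ℚ p - a) ≡ (1ℚ +ℚ M) *ℚ p *ℚ p - p *ℚ p - M *ℚ a
    ring = solve-∀ ℚ-ring
    ring′ : ∀ k p → k *ℚ p - p *ℚ p - (k - 1ℚ) *ℚ p ≡ p *ℚ (1ℚ - p)
    ring′ = solve-∀ ℚ-ring

  -- With N the dimension, (N - 1) (2 a₂ - p²) = p (k - 2 + p), which is nonnegative because k ≥ 2.
  two-in≥ : p *ℚ p ≤ℚ 2ℚ *ℚ a₂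
  two-in≥ = cancel-≤ (q-pos (2 + n)) (≡.trans (ring (q (3 + n)) p a₂)
    (≡.trans (cong₂ (λ s t → 2ℚ *ℚ t - (s *ℚ p - p *ℚ p)) np≡k eq-a₂) (ring′ κ p))) (p≥0 ⊗ (gap κ≥2 ⊕ p≥0))
    where
    ring : ∀ M p a → M *ℚ (2ℚ *ℚ a - p *ℚ p) ≡ 2ℚ *ℚ (M *ℚ a) - ((1ℚ +ℚ M) *ℚ p *ℚ p - p *ℚ p)
    ring = solve-∀ ℚ-ring
    ring′ : ∀ k p → 2ℚ *ℚ ((k - 1ℚ) *ℚ p) - (k *ℚ p - p *ℚ p) ≡ p *ℚ (k - 2ℚ +ℚ p)
    ring′ = solve-∀ ℚ-ring

  split≥ : p ≤ℚ 2ℚ *ℚ b₁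
  split≥ = cancel-≤ (q-pos (2 + n)) (≡.trans (ring (q (3 + n)) p b₁)
    (≡.trans (cong (λ t → 2ℚ *ℚ t - q (3 + n) *ℚ p) eq-b₁) (ring′ (q (3 + n)) κ p))) (p≥0 ⊗ (gap N≥2κ ⊕ pos {1ℚ}))
    where
    ring : ∀ M p b → M *ℚ (2ℚ *ℚ b - p) ≡ 2ℚ *ℚ (M *ℚ b) - M *ℚ p
    ring = solve-∀ ℚ-ring
    ring′ : ∀ M k p → 2ℚ *ℚ ((M - (k - 1ℚ)) *ℚ p) - M *ℚ p ≡ p *ℚ ((1ℚ +ℚ M) - 2ℚ *ℚ k +ℚ 1ℚ)
    ring′ = solve-∀ ℚ-ring

  three-in : mass (1 + n) (w ∘ suc ∘ suc ∘ suc) ≤ℚ p *ℚ a₂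
  three-in = cancel-≤ (q-pos (1 + n)) (≡.trans (ring (q (2 + n)) p a₂ (mass (1 + n) (w ∘ suc ∘ suc ∘ suc)))
    (≡.trans (cong₂ (λ s t → (s - 2ℚ *ℚ p) *ℚ a₂ - t) np≡k eq-a₃) (ring′ κ p a₂))) (pos {2ℚ} ⊗ a₂≥0 ⊗ 1-p≥0)
    where
    ring : ∀ M p a b → M *ℚ (p *ℚ a - b) ≡ ((1ℚ +ℚ (1ℚ +ℚ M)) *ℚ p - 2ℚ *ℚ p) *ℚ a - M *ℚ b
    ring = solve-∀ ℚ-ring
    ring′ : ∀ k p a → (k - 2ℚ *ℚ p) *ℚ a - (k - 1ℚ - 1ℚ) *ℚ a ≡ 2ℚ *ℚ a *ℚ (1ℚ - p)
    ring′ = solve-∀ ℚ-ring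

  split₂≤ : b₂ ≤ℚ p *ℚ b₁
  split₂≤ = cancel-≤ (q-pos n) ≡.refl (cancel-pos (q-pos (1 + n))
    (≡.trans (ring (q (1 + n)) p b₁ b₂) (≡.trans (cong₂ (λ s t → M *ℚ (s - 2ℚ *ℚ p) *ℚ b₁ - (1ℚ +ℚ M) *ℚ t) np≡k eq-b₂)
      (≡.trans (ring′ M κ p b₁ c₁) (≡.trans (cong (λ t → M *ℚ (κ - 2ℚ *ℚ p) *ℚ b₁ - (M - (κ - 1ℚ - 1ℚ)) *ℚ t) eq-c₁) (ring″ M κ p b₁)))))
    (b₁≥0 ⊗ (pos {2ℚ} ⊗ q≥0 (1 + n) ⊗ gap p≤½ ⊕ (gap κ≥2 ⊕ pos {1ℚ}) ⊗ gap κ≥2)))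
    where
    M = q (1 + n)
    ring : ∀ M p b b₂ → (1ℚ +ℚ M) *ℚ (M *ℚ (p *ℚ b - b₂)) ≡
      M *ℚ ((1ℚ +ℚ (1ℚ +ℚ (1ℚ +ℚ M))) *ℚ p - 2ℚ *ℚ p) *ℚ b - (1ℚ +ℚ M) *ℚ (M *ℚ b₂)
    ring = solve-∀ ℚ-ring
    ring′ : ∀ M k p b c → M *ℚ (k - 2ℚ *ℚ p) *ℚ b - (1ℚ +ℚ M) *ℚ ((M - (k - 1ℚ - 1ℚ)) *ℚ c) ≡
      M *ℚ (k - 2ℚ *ℚ p) *ℚ b - (M - (k - 1ℚ - 1ℚ)) *ℚ ((1ℚ +ℚ M) *ℚ c)
    ring′ = solve-∀ ℚ-ring
    ring″ : ∀ M k p b → M *ℚ (k - 2ℚ *ℚ p) *ℚ b - (M - (k - 1ℚ - 1ℚ)) *ℚ ((k - 1ℚ) *ℚ b) ≡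
      b *ℚ (2ℚ *ℚ M *ℚ (½ - p) +ℚ (k - 2ℚ +ℚ 1ℚ) *ℚ (k - 2ℚ))
    ring″ = solve-∀ ℚ-ring

  -- b₂ = p (k - 1) (N - k) (N - k - 1) / ((N - 1) (N - 2) (N - 3)). A factor 2 is lost in k - 1 ≥ k
  -- / 2, which needs k ≥ 2, and one more in each of the other two numerator factors, as k ≤ N / 2.
  split₂≥ : p *ℚ p ≤ℚ 8ℚ *ℚ b₂
  split₂≥ = cancel-≤ (q-pos n) ≡.refl (cancel-pos (q-pos (1 + n)) ≡.refl (cancel-pos (q-pos (2 + n))
    (≡.trans (ring M p b₂) (≡.trans (cong₂ (λ s t → expr s t) np≡k eq-b₂) (≡.trans (ring₁ M κ p c₁)
      (≡.trans (cong (expr₁ κ) eq-c₁) (≡.trans (ring₂ M κ p b₁) (≡.trans (cong (expr₂ κ) eq-b₁) (ring₃ M κ p)))))))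
    (p≥0 ⊗ (A≥0 ⊗ (κ≥0 ⊕ gap κ≥2) ⊗ (q≥0 (1 + n) ⊕ B≥0) ⊕ q≥0 (2 + n) ⊗ gap κ≥2 ⊗ (q≥0 (1 + n) ⊕ B≥0)
      ⊕ q≥0 (2 + n) ⊗ κ≥0 ⊗ B≥0 ⊕ p≥0 ⊗ q≥0 (2 + n) ⊗ q≥0 (1 + n)))))
    where
    M = q (1 + n)
    κ≥0 = q≥0 k
    B≥0 : 0ℚ ≤ℚ N - 2ℚ *ℚ κ +ℚ 1ℚ
    B≥0 = gap N≥2κ ⊕ pos {1ℚ}
    A≥0 : 0ℚ ≤ℚ N - 2ℚ *ℚ κ +ℚ 2ℚ
    A≥0 = gap N≥2κ ⊕ pos {2ℚ}
    expr : ℚ → ℚ → ℚ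
    expr s t = 8ℚ *ℚ ((1ℚ +ℚ (1ℚ +ℚ M)) *ℚ ((1ℚ +ℚ M) *ℚ t)) - (s - p) *ℚ p *ℚ (1ℚ +ℚ M) *ℚ M
    expr₁ : ℚ → ℚ → ℚ
    expr₁ κ t = 8ℚ *ℚ ((1ℚ +ℚ (1ℚ +ℚ M)) *ℚ (M - (κ - 1ℚ - 1ℚ)) *ℚ t) - (κ - p) *ℚ p *ℚ (1ℚ +ℚ M) *ℚ M
    expr₂ : ℚ → ℚ → ℚ
    expr₂ κ t = 8ℚ *ℚ ((M - (κ - 1ℚ - 1ℚ)) *ℚ (κ - 1ℚ) *ℚ t) - (κ - p) *ℚ p *ℚ (1ℚ +ℚ M) *ℚ M
    ring : ∀ M p b → (1ℚ +ℚ (1ℚ +ℚ M)) *ℚ ((1ℚ +ℚ M) *ℚ (M *ℚ (8ℚ *ℚ b - p *ℚ p))) ≡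
      8ℚ *ℚ ((1ℚ +ℚ (1ℚ +ℚ M)) *ℚ ((1ℚ +ℚ M) *ℚ (M *ℚ b))) - ((1ℚ +ℚ (1ℚ +ℚ (1ℚ +ℚ M))) *ℚ p - p) *ℚ p *ℚ (1ℚ +ℚ M) *ℚ M
    ring = solve-∀ ℚ-ring
    ring₁ : ∀ M k p c → 8ℚ *ℚ ((1ℚ +ℚ (1ℚ +ℚ M)) *ℚ ((1ℚ +ℚ M) *ℚ ((M - (k - 1ℚ - 1ℚ)) *ℚ c))) - (k - p) *ℚ p *ℚ (1ℚ +ℚ M) *ℚ M ≡
      8ℚ *ℚ ((1ℚ +ℚ (1ℚ +ℚ M)) *ℚ (M - (k - 1ℚ - 1ℚ)) *ℚ ((1ℚ +ℚ M) *ℚ c)) - (k - p) *ℚ p *ℚ (1ℚ +ℚ M) *ℚ M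
    ring₁ = solve-∀ ℚ-ring
    ring₂ : ∀ M k p b → 8ℚ *ℚ ((1ℚ +ℚ (1ℚ +ℚ M)) *ℚ (M - (k - 1ℚ - 1ℚ)) *ℚ ((k - 1ℚ) *ℚ b)) - (k - p) *ℚ p *ℚ (1ℚ +ℚ M) *ℚ M ≡
      8ℚ *ℚ ((M - (k - 1ℚ - 1ℚ)) *ℚ (k - 1ℚ) *ℚ ((1ℚ +ℚ (1ℚ +ℚ M)) *ℚ b)) - (k - p) *ℚ p *ℚ (1ℚ +ℚ M) *ℚ M
    ring₂ = solve-∀ ℚ-ring
    ring₃ : ∀ M k p →
      8ℚ *ℚ ((M - (k - 1ℚ - 1ℚ)) *ℚ (k - 1ℚ) *ℚ (((1ℚ +ℚ (1ℚ +ℚ M)) - (k - 1ℚ)) *ℚ p)) - (k - p) *ℚ p *ℚ (1ℚ +ℚ M) *ℚ M ≡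
      p *ℚ (((1ℚ +ℚ (1ℚ +ℚ (1ℚ +ℚ M))) - 2ℚ *ℚ k +ℚ 2ℚ) *ℚ (k +ℚ (k - 2ℚ)) *ℚ (M +ℚ ((1ℚ +ℚ (1ℚ +ℚ (1ℚ +ℚ M))) - 2ℚ *ℚ k +ℚ 1ℚ))
        +ℚ (1ℚ +ℚ M) *ℚ (k - 2ℚ) *ℚ (M +ℚ ((1ℚ +ℚ (1ℚ +ℚ (1ℚ +ℚ M))) - 2ℚ *ℚ k +ℚ 1ℚ))
        +ℚ (1ℚ +ℚ M) *ℚ k *ℚ ((1ℚ +ℚ (1ℚ +ℚ (1ℚ +ℚ M))) - 2ℚ *ℚ k +ℚ 1ℚ)
        +ℚ p *ℚ (1ℚ +ℚ M) *ℚ M)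
    ring₃ = solve-∀ ℚ-ring

sliceWeight : ∀ n k {w p} → 2 ≤ k → 2 * k ≤ n → NonNeg w → At (q k) w → mass n w ≡ 1ℚ →
  q n *ℚ p ≡ q k → SliceWeight n w p
sliceWeight n k {w} {p} 2≤k 2k≤n w≥0 at mass≡1 np≡k = go n (ℕₚ.≤-trans (ℕₚ.*-monoʳ-≤ 2 2≤k) 2k≤n) 2k≤n mass≡1 np≡k
  where
  go : ∀ n → 4 ≤ n → 2 * k ≤ n → mass n w ≡ 1ℚ → q n *ℚ p ≡ q k → SliceWeight n w p
  go (suc (suc (suc (suc n)))) 4≤n 2k≤n mass≡1 np≡k = record
    { w≥0 = w≥0 ; p≥0 = p≥0 ; p≤½ = p≤½ ; 4≤n = 4≤n ; mass-n = mass≡1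
    ; one-in   = λ { _ ≡.refl → one-in }
    ; two-in≤  = λ { _ ≡.refl → two-in≤ }
    ; two-in≥  = λ { _ ≡.refl → two-in≥ }
    ; split≥   = λ { _ ≡.refl → split≥ }
    ; three-in = λ { _ ≡.refl → three-in }
    ; split₂≤  = λ { _ ≡.refl → split₂≤ }
    ; split₂≥  = λ { _ ≡.refl → split₂≥ }
    }
    where open SliceFacts n k 2≤k 2k≤n w≥0 at mass≡1 np≡k
  go zero () _ _ _
  go (suc zero) (s≤s ()) _ _ _
  go (suc (suc zero)) (s≤s (s≤s ())) _ _ _
  go (suc (suc (suc zero))) (s≤s (s≤s (s≤s ()))) _ _ _

-- Transfer to the slice

sumℚ-++ : ∀ xs ys → sumℚ (xs ++ ys) ≡ sumℚ xs +ℚ sumℚ ys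
sumℚ-++ []       ys = sym (ℚₚ.+-identityˡ (sumℚ ys))
sumℚ-++ (x ∷ xs) ys = ≡.trans (cong (x +ℚ_) (sumℚ-++ xs ys)) (sym (ℚₚ.+-assoc x (sumℚ xs) (sumℚ ys)))

sumℚ-cube : ∀ n w F → sumℚ (map (λ x → w (weight x) *ℚ F x) (cube n)) ≡ E n w F
sumℚ-cube zero    w F = ℚₚ.+-identityʳ (w 0 *ℚ F [])
sumℚ-cube (suc n) w F = begin
  sumℚ (map G (map (false ∷_) (cube n) ++ map (true ∷_) (cube n)))
    ≡⟨ cong sumℚ (map-++ G (map (false ∷_) (cube n)) (map (true ∷_) (cube n))) ⟩
  sumℚ (map G (map (false ∷_) (cube n)) ++ map G (map (true ∷_) (cube n)))
    ≡⟨ sumℚ-++ (map G (map (false ∷_) (cube n))) (map G (map (true ∷_) (cube n))) ⟩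
  sumℚ (map G (map (false ∷_) (cube n))) +ℚ sumℚ (map G (map (true ∷_) (cube n)))
    ≡⟨ cong₂ (λ xs ys → sumℚ xs +ℚ sumℚ ys) (map-∘ (cube n)) (map-∘ (cube n)) ⟨
  sumℚ (map (G ∘ (false ∷_)) (cube n)) +ℚ sumℚ (map (G ∘ (true ∷_)) (cube n))
    ≡⟨ cong₂ _+ℚ_ (sumℚ-cube n w (F ∘ (false ∷_))) (sumℚ-cube n (w ∘ suc) (F ∘ (true ∷_))) ⟩
  E (suc n) w F ∎
  where
  open ≡-Reasoning
  G = λ x → w (weight x) *ℚ F x

δ : ℕ → ℕ → ℚ
δ k j = if does (j ℕ.≟ k) then 1ℚ else 0ℚ

δ-diagonal : ∀ k → δ k k ≡ 1ℚ
δ-diagonal zero    = ≡.refl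
δ-diagonal (suc k) = δ-diagonal k

δ-off : ∀ k j → j ≡ k ⊎ δ k j ≡ 0ℚ
δ-off zero    zero    = inj₁ ≡.refl
δ-off zero    (suc j) = inj₂ ≡.refl
δ-off (suc k) zero    = inj₂ ≡.refl
δ-off (suc k) (suc j) with δ-off k j
... | inj₁ j≡k = inj₁ (cong suc j≡k)
... | inj₂ z   = inj₂ z

δ≥0 : ∀ k → NonNeg (δ k)
δ≥0 k j with does (j ℕ.≟ k)
... | true  = pos {1ℚ}
... | false = ℚₚ.≤-refl

sumℚ-filter : ∀ {n} k (h : Vec Bool n → ℚ) xs →
  sumℚ (map h (filter (λ x → weight x ℕ.≟ k) xs)) ≡ sumℚ (map (λ x → δ k (weight x) *ℚ h x) xs)
sumℚ-filter k h []       = ≡.refl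
sumℚ-filter k h (x ∷ xs) with does (weight x ℕ.≟ k)
... | true  = cong₂ _+ℚ_ (sym (ℚₚ.*-identityˡ (h x))) (sumℚ-filter k h xs)
... | false = ≡.trans (sumℚ-filter k h xs) (≡.trans (sym (ℚₚ.+-identityˡ _)) (cong (_+ℚ _) (sym (ℚₚ.*-zeroˡ (h x)))))

sumℚ-slice : ∀ n k h → sumℚ (map h (slice n k)) ≡ E n (δ k) h
sumℚ-slice n k h = ≡.trans (sumℚ-filter k h (cube n)) (sumℚ-cube n (δ k) h)

mass-δ-pos : ∀ n k → k ≤ n → 0ℚ <ℚ mass n (δ k)
mass-δ-pos zero    zero    _ = ℚₚ.positive⁻¹ (1ℚ *ℚ 1ℚ)
mass-δ-pos (suc n) zero    _ = ℚₚ.+-mono-<-≤ (mass-δ-pos n zero z≤n) (mass-nonneg n (δ≥0 zero ∘ suc))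
mass-δ-pos (suc n) (suc k) (s≤s k≤n) = ℚₚ.+-mono-≤-< (mass-nonneg n (δ≥0 (suc k))) (mass-δ-pos n k k≤n)

E-scale : ∀ n w β F → E n (λ j → w j *ℚ β) F ≡ E n w F *ℚ β
E-scale zero    w β F = ring (w 0) β (F [])
  where
  ring : ∀ w b f → w *ℚ b *ℚ f ≡ w *ℚ f *ℚ b
  ring = solve-∀ ℚ-ring
E-scale (suc n) w β F = ≡.trans (cong₂ _+ℚ_ (E-scale n w β (F ∘ (false ∷_))) (E-scale n (w ∘ suc) β (F ∘ (true ∷_))))
  (sym (ℚₚ.*-distribʳ-+ β (E n w (F ∘ (false ∷_))) (E n (w ∘ suc) (F ∘ (true ∷_)))))

q*frac : ∀ k m → q (suc m) *ℚ (+ k / suc m) ≡ q k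
q*frac k m = ≡.trans (cong (_*ℚ (+ k / suc m)) (sym (/1≡q (suc m)))) (≡.trans (ℚₚ.toℚᵘ-injective (begin
  ℚ.toℚᵘ ((+ suc m / 1) *ℚ (+ k / suc m))              ≈⟨ ℚₚ.toℚᵘ-homo-* (+ suc m / 1) (+ k / suc m) ⟩
  ℚ.toℚᵘ (+ suc m / 1) ℚᵘ.* ℚ.toℚᵘ (+ k / suc m)        ≈⟨ ℚᵘₚ.*-cong (ℚₚ.toℚᵘ-fromℚᵘ (ℚᵘ.mkℚᵘ (+ suc m) 0)) (ℚₚ.toℚᵘ-fromℚᵘ (ℚᵘ.mkℚᵘ (+ k) m)) ⟩
  ℚᵘ.mkℚᵘ (+ suc m) 0 ℚᵘ.* ℚᵘ.mkℚᵘ (+ k) m              ≈⟨ ℚᵘ.*≡* lemma ⟩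
  ℚᵘ.mkℚᵘ (+ k) 0                                       ≈⟨ ℚₚ.toℚᵘ-fromℚᵘ (ℚᵘ.mkℚᵘ (+ k) 0) ⟨
  ℚ.toℚᵘ (+ k / 1)                                      ∎)) (/1≡q k))
  where
  open ℚᵘₚ.≃-Reasoning
  lemma : + suc m ℤ.* + k ℤ.* + 1 ≡ + k ℤ.* + (suc m + 0)
  lemma = ≡.trans (ℤₚ.*-identityʳ (+ suc m ℤ.* + k)) (≡.trans (ℤₚ.*-comm (+ suc m) (+ k))
    (cong (λ j → + k ℤ.* + j) (sym (ℕₚ.+-identityʳ (suc m)))))

-- Stated for any list with the sums of the slice, since `mean` unfolds only after a case split on
-- the list. β is 1 over the number of points; an empty list contradicts the positive mass.
normaliser : ∀ n k (xs : List (Vec Bool n)) → k ≤ n → (∀ h → sumℚ (map h xs) ≡ E n (δ k) h) →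
  Σ ℚ λ β → 0ℚ ≤ℚ β × (mass n (δ k) *ℚ β ≡ 1ℚ) × (∀ h → mean (map h xs) ≡ E n (δ k) h *ℚ β)
normaliser n k []       k≤n sums = ⊥-elim (ℚₚ.<-irrefl (sums (λ _ → 1ℚ)) (mass-δ-pos n k k≤n))
normaliser n k (x ∷ xs) k≤n sums = β , β≥0 , mass-β , λ h →
  ≡.trans (cong (λ j → sumℚ (map h (x ∷ xs)) *ℚ (+ 1 / suc j)) (length-map h xs)) (cong (_*ℚ β) (sums h))
  where
  m = length xs
  β = + 1 / suc m
  qβ : q (suc m) *ℚ β ≡ 1ℚ
  qβ = ≡.trans (q*frac 1 m) (ℚₚ.+-identityʳ 1ℚ)
  β≥0 : 0ℚ ≤ℚ β
  β≥0 = cancel-pos (q-pos m) qβ (pos {1ℚ})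
  ones : ∀ (ys : List (Vec Bool n)) → sumℚ (map (λ _ → 1ℚ) ys) ≡ q (length ys)
  ones []       = ≡.refl
  ones (_ ∷ ys) = cong (1ℚ +ℚ_) (ones ys)
  mass-β : mass n (δ k) *ℚ β ≡ 1ℚ
  mass-β = ≡.trans (cong (_*ℚ β) (≡.trans (sym (sums (λ _ → 1ℚ))) (ones (x ∷ xs)))) qβ

record Uniform (n k : ℕ) : Set where
  field
    w      : ℕ → ℚ
    w≥0    : NonNeg w
    off-k  : ∀ j → j ≡ k ⊎ w j ≡ 0ℚ
    mass≡1 : mass n w ≡ 1ℚ
    mean≡E : ∀ h → mean (map h (slice n k)) ≡ E n w h

uniform : ∀ n k → k ≤ n → Uniform n k
uniform n k k≤n with normaliser n k (slice n k) k≤n (sumℚ-slice n k)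
... | β , β≥0 , mass-β , means = record
  { w      = λ j → δ k j *ℚ β
  ; w≥0    = λ j → δ≥0 k j ⊗ β≥0
  ; off-k  = off-k
  ; mass≡1 = ≡.trans (E-scale n (δ k) β (λ _ → 1ℚ)) mass-β
  ; mean≡E = λ h → ≡.trans (means h) (sym (E-scale n (δ k) β h))
  }
  where
  off-k : ∀ j → j ≡ k ⊎ δ k j *ℚ β ≡ 0ℚ
  off-k j with δ-off k j
  ... | inj₁ j≡k = inj₁ j≡k
  ... | inj₂ z   = inj₂ (≡.trans (cong (_*ℚ β) z) (ℚₚ.*-zeroˡ β))

OffZero : ℕ → (ℕ → ℚ) → Set
OffZero k w = ∀ j → j ≡ k ⊎ w j ≡ 0ℚ

off⇒At : ∀ {k w} → OffZero k w → At (q k) w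
off⇒At {k} {w} off-k = at-all λ j → go j (off-k j)
  where
  go : ∀ j → j ≡ k ⊎ w j ≡ 0ℚ → q j *ℚ w j ≡ q k *ℚ w j
  go j (inj₁ ≡.refl) = ≡.refl
  go j (inj₂ z) = ≡.trans (cong (q j *ℚ_) z) (≡.trans (ℚₚ.*-zeroʳ (q j)) (sym (≡.trans (cong (q k *ℚ_) z) (ℚₚ.*-zeroʳ (q k)))))

E-cong-weighted : ∀ n {w} F G → (∀ x → w (weight x) *ℚ F x ≡ w (weight x) *ℚ G x) → E n w F ≡ E n w G
E-cong-weighted zero    F G eq = eq []
E-cong-weighted (suc n) F G eq = cong₂ _+ℚ_ (E-cong-weighted n (F ∘ (false ∷_)) (G ∘ (false ∷_)) (eq ∘ (false ∷_)))
  (E-cong-weighted n (F ∘ (true ∷_)) (G ∘ (true ∷_)) (eq ∘ (true ∷_)))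

E-supported : ∀ n {k w} → OffZero k w → ∀ F G → (∀ x → weight x ≡ k → F x ≡ G x) → E n w F ≡ E n w G
E-supported n {k} {w} off-k F G eq = E-cong-weighted n F G λ x → go x (off-k (weight x))
  where
  go : ∀ x → weight x ≡ k ⊎ w (weight x) ≡ 0ℚ → w (weight x) *ℚ F x ≡ w (weight x) *ℚ G x
  go x (inj₁ h) = cong (w (weight x) *ℚ_) (eq x h)
  go x (inj₂ z) = ≡.trans (cong (_*ℚ F x) z) (≡.trans (ℚₚ.*-zeroˡ (F x)) (sym (≡.trans (cong (_*ℚ G x) z) (ℚₚ.*-zeroˡ (G x)))))

-- Complementing the points

complement : ∀ {n} → Vec Bool n → Vec Bool n
complement []      = []
complement (b ∷ x) = not b ∷ complement x

E-cong-w : ∀ n {w w′} F → (∀ j → j ≤ n → w j ≡ w′ j) → E n w F ≡ E n w′ F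
E-cong-w zero    F eq = cong (_*ℚ F []) (eq 0 z≤n)
E-cong-w (suc n) F eq = cong₂ _+ℚ_ (E-cong-w n (F ∘ (false ∷_)) (λ j j≤n → eq j (ℕₚ.m≤n⇒m≤1+n j≤n)))
  (E-cong-w n (F ∘ (true ∷_)) (λ j j≤n → eq (suc j) (s≤s j≤n)))

E-complement : ∀ n w F → E n w F ≡ E n (λ j → w (n ℕ.∸ j)) (F ∘ complement)
E-complement zero    w F = ≡.refl
E-complement (suc n) w F = begin
  E n w (F ∘ (false ∷_)) +ℚ E n (w ∘ suc) (F ∘ (true ∷_))
    ≡⟨ cong₂ _+ℚ_ (E-complement n w (F ∘ (false ∷_))) (E-complement n (w ∘ suc) (F ∘ (true ∷_))) ⟩
  E n (λ j → w (n ℕ.∸ j)) (F ∘ (false ∷_) ∘ complement) +ℚ E n (λ j → w (suc (n ℕ.∸ j))) (F ∘ (true ∷_) ∘ complement)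
    ≡⟨ cong (E n (λ j → w (n ℕ.∸ j)) (F ∘ (false ∷_) ∘ complement) +ℚ_)
         (E-cong-w n (F ∘ (true ∷_) ∘ complement) (λ j j≤n → cong w (sym (ℕₚ.+-∸-assoc 1 j≤n)))) ⟩
  E n (λ j → w (n ℕ.∸ j)) (F ∘ (false ∷_) ∘ complement) +ℚ E n (λ j → w (suc n ℕ.∸ j)) (F ∘ (true ∷_) ∘ complement)
    ≡⟨ ℚₚ.+-comm (E n (λ j → w (n ℕ.∸ j)) (F ∘ (false ∷_) ∘ complement)) _ ⟩
  E n (λ j → w (suc n ℕ.∸ j)) (F ∘ (true ∷_) ∘ complement) +ℚ E n (λ j → w (n ℕ.∸ j)) (F ∘ (false ∷_) ∘ complement) ∎
  where open ≡-Reasoning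

off-complement : ∀ {n k w} → k ≤ n → 1 ≤ k → OffZero k w → OffZero (n ℕ.∸ k) (λ j → w (n ℕ.∸ j))
off-complement {n} {k} {w} k≤n 1≤k off-k j with off-k (n ℕ.∸ j)
... | inj₂ z = inj₂ z
... | inj₁ n∸j≡k with ℕₚ.≤-total j n
...   | inj₁ j≤n = inj₁ (≡.trans (sym (ℕₚ.m∸[m∸n]≡n j≤n)) (cong (n ℕ.∸_) n∸j≡k))
-- For j ≥ n truncated subtraction gives 0, which differs from k because 1 ≤ k.
...   | inj₂ n≤j = ⊥-elim (ℕₚ.<⇒≱ 1≤k (ℕₚ.≤-reflexive (≡.trans (sym n∸j≡k) (ℕₚ.m≤n⇒m∸n≡0 n≤j))))

minOn-complement : ∀ {n} (S x : Vec Bool n) → minOn S (complement x) ≡ not (maxOn S x)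
minOn-complement []      []      = ≡.refl
minOn-complement (s ∷ S) (b ∷ x) = ≡.trans (cong ((not s ∨ not b) ∧_) (minOn-complement S x)) (de-morgan s b (maxOn S x))
  where
  de-morgan : ∀ s b m → (not s ∨ not b) ∧ not m ≡ not ((s ∧ b) ∨ m)
  de-morgan false b     m = ≡.refl
  de-morgan true  false m = ≡.refl
  de-morgan true  true  m = ≡.refl

-- Complementing x turns Σ cᵢ xᵢ into Σ cᵢ - Σ cᵢ xᵢ. On a slice the constant can be written as κ Σ
-- xᵢ, which makes the form homogeneous again, with coefficients κ - cᵢ.
reflect : ∀ {n} → ℚ → Vec ℚ n → Vec ℚ n
reflect κ []      = []
reflect κ (a ∷ c) = κ - a ∷ reflect κ c

linear-reflect : ∀ {n} κ (c : Vec ℚ n) x → linear (reflect κ c) x ≡ κ *ℚ q (weight x) - sum c +ℚ linear c (complement x)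
linear-reflect κ []      []          = ring κ
  where
  ring : ∀ k → 0ℚ ≡ k *ℚ 0ℚ - 0ℚ +ℚ 0ℚ
  ring = solve-∀ ℚ-ring
linear-reflect κ (a ∷ c) (true ∷ x)  = ≡.trans (cong ((κ - a) *ℚ 1ℚ +ℚ_) (linear-reflect κ c x))
  (ring κ a (q (weight x)) (sum c) (linear c (complement x)))
  where
  ring : ∀ k a w s l → (k - a) *ℚ 1ℚ +ℚ (k *ℚ w - s +ℚ l) ≡ k *ℚ (1ℚ +ℚ w) - (a +ℚ s) +ℚ (a *ℚ 0ℚ +ℚ l)
  ring = solve-∀ ℚ-ring
linear-reflect κ (a ∷ c) (false ∷ x) = ≡.trans (cong ((κ - a) *ℚ 0ℚ +ℚ_) (linear-reflect κ c x))
  (ring κ a (q (weight x)) (sum c) (linear c (complement x)))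
  where
  ring : ∀ k a w s l → (k - a) *ℚ 0ℚ +ℚ (k *ℚ w - s +ℚ l) ≡ k *ℚ w - (a +ℚ s) +ℚ (a *ℚ 1ℚ +ℚ l)
  ring = solve-∀ ℚ-ring

-- Absolute constants and the two ranges of ε

-- C is 1 / `ε₀`, as the case ε ≥ `ε₀` demands; the remaining two requirements, K ≤ C² and 816 + K ≤
-- C, then hold with room to spare.
opaque
  unfolding K

  C : ℚ
  C = + 10000000 / 1

  C>0 : 0ℚ <ℚ C
  C>0 = ℚₚ.positive⁻¹ (+ 10000000 / 1)

  K≤C² : K ≤ℚ C *ℚ C
  K≤C² = by {K} {C *ℚ C} ≡.refl pos

  rounding≤C : 4ℚ *ℚ (6ℚ *ℚ 34ℚ) +ℚ K ≤ℚ C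
  rounding≤C = by {4ℚ *ℚ (6ℚ *ℚ 34ℚ) +ℚ K} {C} ≡.refl pos

  1≤Cε₀ : 1ℚ ≤ℚ C *ℚ ε₀
  1≤Cε₀ = by {1ℚ} {C *ℚ ε₀} ≡.refl pos

-- Bridges the vectors of the statement and the lists on which permutations act.
data FromList : ∀ {n} → Vec ℚ n → Set where
  from-list : ∀ c → FromList (fromList c)

from-list? : ∀ {n} (c : Vec ℚ n) → FromList c
from-list? []      = from-list []
from-list? (a ∷ c) with from-list? c
... | from-list c′ = from-list (a ∷ c′)

weight-replicate : ∀ n → weight (replicate n false) ≡ 0
weight-replicate zero    = ≡.refl
weight-replicate (suc n) = weight-replicate n

module _ {k : ℕ} {w : ℕ → ℚ} {p : ℚ} where

  -- Two Boolean functions are at squared distance at most 1 ≤ C ε, so the empty set will do.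
  trivial : ∀ {n ε} f → SliceWeight n w p → ε₀ ≤ℚ ε → CloseToMax n w p (C *ℚ C *ℚ ε) (C *ℚ ε) f
  trivial {n} {ε} f S ε₀≤ε = close-to-max (replicate n false) (inj₁ (ℕₚ.≤-trans (ℕₚ.≤-reflexive (weight-replicate n)) z≤n)) (inj₁ (begin
    E n w (λ x → sq (toℚ (f x) - toℚ (maxOn (replicate n false) x)))
      ≤⟨ E-mono n (SliceWeight.w≥0 S) (λ x → bool-dist≤1 (f x) (maxOn (replicate n false) x)) ⟩
    mass n w     ≡⟨ SliceWeight.mass-n S ⟩
    1ℚ           ≤⟨ 1≤Cε₀ ⟩
    C *ℚ ε₀      ≤⟨ ℚₚ.*-monoˡ-≤-nonNeg C {{ℚ.nonNegative (ℚₚ.<⇒≤ C>0)}} ε₀≤ε ⟩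
    C *ℚ ε       ∎))
    where open ℚₚ.≤-Reasoning

  nontrivial : ∀ c {ε} f → SliceWeight (length c) w p → OffZero k w → ε ≤ℚ ε₀ →
    E (length c) w (λ x → sq (err c f x)) ≤ℚ ε → CloseToMax (length c) w p (C *ℚ C *ℚ ε) (C *ℚ ε) f
  nontrivial c {ε} f S off-k ε≤ε₀ near = weaken (Rounding.conclusion {c = c} S (E-supported (length c) off-k) (K *ℚ ε) (K≥0 ⊗ ε≥0)
    (Structure.concentration S ε≤ε₀ c ≡.refl (f , near)) f near)
    where
    ε≥0 : 0ℚ ≤ℚ ε
    ε≥0 = Near-ε≥0 {c = c} (SliceWeight.w≥0 S) (f , near)
    few≤ : K *ℚ ε ≤ℚ C *ℚ C *ℚ ε
    few≤ = ℚₚ.*-monoʳ-≤-nonNeg ε {{ℚ.nonNegative ε≥0}} K≤C²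
    dist≤ : 4ℚ *ℚ (6ℚ *ℚ (34ℚ *ℚ ε)) +ℚ K *ℚ ε ≤ℚ C *ℚ ε
    dist≤ = by (ring 4ℚ 6ℚ 34ℚ K C ε) (gap rounding≤C ⊗ ε≥0)
      where
      ring : ∀ a b d k c ε → c *ℚ ε - (a *ℚ (b *ℚ (d *ℚ ε)) +ℚ k *ℚ ε) ≡ (c - (a *ℚ (b *ℚ d) +ℚ k)) *ℚ ε
      ring = solve-∀ ℚ-ring
    weaken : CloseToMax (length c) w p (K *ℚ ε) (4ℚ *ℚ (6ℚ *ℚ (34ℚ *ℚ ε)) +ℚ K *ℚ ε) f →
      CloseToMax (length c) w p (C *ℚ C *ℚ ε) (C *ℚ ε) f
    weaken (close-to-max S few distance) = close-to-max S
      (Sum.map₂ (λ h → ℚₚ.≤-trans h few≤) few)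
      (Sum.map (λ h → ℚₚ.≤-trans h dist≤) (λ h → ℚₚ.≤-trans h dist≤) distance)

  approximate : ∀ {n} → SliceWeight n w p → OffZero k w → ∀ ε f (c : Vec ℚ n) →
    E n w (λ x → sq (toℚ (f x) - linear c x)) ≤ℚ ε → CloseToMax n w p (C *ℚ C *ℚ ε) (C *ℚ ε) f
  approximate {n} S off-k ε f c near = go (ℚₚ.≤-total ε ε₀) (from-list? c) S f near
    where
    go : ε ≤ℚ ε₀ ⊎ ε₀ ≤ℚ ε → ∀ {n} {c : Vec ℚ n} → FromList c → SliceWeight n w p → ∀ f →
      E n w (λ x → sq (toℚ (f x) - linear c x)) ≤ℚ ε → CloseToMax n w p (C *ℚ C *ℚ ε) (C *ℚ ε) f
    go (inj₂ ε₀≤ε) _             S f near = trivial f S ε₀≤ε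
    go (inj₁ ε≤ε₀) (from-list c) S f near = nontrivial c f S off-k ε≤ε₀ near

-- Size of S and the two ranges of k

∣_∣≡weight : ∀ {n} (S : Subset n) → ∣ S ∣ ≡ weight S
∣ [] ∣≡weight        = ≡.refl
∣ true ∷ S ∣≡weight  = cong suc ∣ S ∣≡weight
∣ false ∷ S ∣≡weight = ∣ S ∣≡weight

q*frac′ : ∀ k n → 1 ≤ n → q n *ℚ frac k n ≡ q k
q*frac′ k (suc m) _ = q*frac k m

frac≥0 : ∀ k n → 0ℚ ≤ℚ frac k n
frac≥0 k zero    = ℚₚ.≤-refl
frac≥0 k (suc m) = cancel-pos (q-pos m) (q*frac k m) (q≥0 k)

q*[1-frac] : ∀ k n → 1 ≤ n → k ≤ n → q n *ℚ (1ℚ - frac k n) ≡ q (n ℕ.∸ k)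
q*[1-frac] k n 1≤n k≤n = begin
  q n *ℚ (1ℚ - frac k n)      ≡⟨ ring (q n) (frac k n) ⟩
  q n - q n *ℚ frac k n       ≡⟨ cong₂ _-_ (≡.trans (cong q (sym (ℕₚ.m+[n∸m]≡n k≤n))) (q-+ k (n ℕ.∸ k))) (q*frac′ k n 1≤n) ⟩
  q k +ℚ q (n ℕ.∸ k) - q k    ≡⟨ ring′ (q k) (q (n ℕ.∸ k)) ⟩
  q (n ℕ.∸ k)                 ∎
  where
  open ≡-Reasoning
  ring : ∀ n f → n *ℚ (1ℚ - f) ≡ n - n *ℚ f
  ring = solve-∀ ℚ-ring
  ring′ : ∀ k j → k +ℚ j - k ≡ j
  ring′ = solve-∀ ℚ-ring

pOf≥0 : ∀ n k → 1 ≤ n → k ≤ n → 0ℚ ≤ℚ pOf n k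
pOf≥0 n@(suc m) k 1≤n k≤n with ℚₚ.⊓-sel (frac k n) (1ℚ - frac k n)
... | inj₁ eq = 0≤* eq (frac≥0 k n)
... | inj₂ eq = 0≤* eq (cancel-pos (q-pos m) (q*[1-frac] k n 1≤n k≤n) (q≥0 (n ℕ.∸ k)))

-- Passes from k / n, or 1 - k / n, to their minimum `pOf`, which can only decrease the left side.
size-bound : ∀ {n p r b} (S : Subset n) → 0ℚ ≤ℚ r → r ≤ℚ p → weight S ≤ 1 ⊎ sq (q (weight S) *ℚ p) ≤ℚ b →
  ∣ S ∣ ≤ 1 ⊎ ((+ ∣ S ∣ / 1) *ℚ r) *ℚ ((+ ∣ S ∣ / 1) *ℚ r) ≤ℚ b
size-bound {p = p} {r} {b} S 0≤r r≤p few = subst₂ (λ j s → j ≤ 1 ⊎ sq (s *ℚ r) ≤ℚ b) (sym ∣ S ∣≡weight)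
  (sym (≡.trans (cong (λ j → + j / 1) ∣ S ∣≡weight) (/1≡q (weight S))))
  (Sum.map₂ (ℚₚ.≤-trans (sq-mono (q≥0 (weight S) ⊗ 0≤r) (ℚₚ.*-monoˡ-≤-nonNeg (q (weight S)) {{ℚ.nonNegative (q≥0 (weight S))}} r≤p))) few)

Conclusion : (n k : ℕ) (ε : ℚ) (f : Vec Bool n → Bool) (on : Subset n → Vec Bool n → Bool) → Set
Conclusion n k ε f on = Σ (Subset n) λ S →
  (∣ S ∣ ≤ 1 ⊎ ((+ ∣ S ∣ / 1) *ℚ pOf n k) *ℚ ((+ ∣ S ∣ / 1) *ℚ pOf n k) ≤ℚ (C *ℚ C) *ℚ ε) ×
  (distSq n k f (on S) ≤ℚ C *ℚ ε ⊎ distSq n k (λ x → not (f x)) (on S) ≤ℚ C *ℚ ε)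

module _ (n k : ℕ) (2≤k : 2 ≤ k) (k+2≤n : k + 2 ≤ n) (f : Vec Bool n → Bool) (ε : ℚ) (c : Vec ℚ n)
  (near : normSq n k (λ x → toℚ (f x) - linear c x) ≤ℚ ε) where

  k≤n : k ≤ n
  k≤n = ℕₚ.≤-trans (ℕₚ.m≤m+n k 2) k+2≤n

  1≤n : 1 ≤ n
  1≤n = ℕₚ.≤-trans (ℕₚ.≤-trans (s≤s z≤n) 2≤k) k≤n

  open Uniform (uniform n k k≤n)

  near-E : E n w (λ x → sq (toℚ (f x) - linear c x)) ≤ℚ ε
  near-E = subst (_≤ℚ ε) (mean≡E (λ x → sq (toℚ (f x) - linear c x))) near

  dist-E : ∀ a b {r} → E n w (λ x → sq (toℚ (a x) - toℚ (b x))) ≤ℚ r → distSq n k a b ≤ℚ r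
  dist-E a b {r} = subst (_≤ℚ r) (sym (mean≡E (λ x → sq (toℚ (a x) - toℚ (b x)))))

  lower-half : 2 * k ≤ n → Conclusion n k ε f maxOn
  lower-half 2k≤n = finish (approximate
    (sliceWeight n k 2≤k 2k≤n w≥0 (off⇒At off-k) mass≡1 (q*frac′ k n 1≤n)) off-k ε f c near-E)
    where
    finish : CloseToMax n w (frac k n) (C *ℚ C *ℚ ε) (C *ℚ ε) f → Conclusion n k ε f maxOn
    finish (close-to-max S few distance) = S
      , size-bound S (pOf≥0 n k 1≤n k≤n) (ℚₚ.p⊓q≤p (frac k n) (1ℚ - frac k n)) few
      , Sum.map (dist-E f (maxOn S)) (dist-E (not ∘ f) (maxOn S)) distance

  upper-half : n ≤ 2 * k → Conclusion n k ε f minOn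
  upper-half n≤2k = finish (approximate
    (sliceWeight n l 2≤l 2l≤n (λ j → w≥0 (n ℕ.∸ j)) (off⇒At off-l)
      (≡.trans (sym (E-complement n w (λ _ → 1ℚ))) mass≡1) (q*[1-frac] k n 1≤n k≤n)) off-l ε (f ∘ complement) c′ near′)
    where
    l = n ℕ.∸ k
    w′ : ℕ → ℚ
    w′ j = w (n ℕ.∸ j)
    off-l : OffZero l w′
    off-l = off-complement k≤n (ℕₚ.≤-trans (s≤s z≤n) 2≤k) off-k
    2≤l : 2 ≤ l
    2≤l = ℕₚ.m+n≤o⇒m≤o∸n 2 (ℕₚ.≤-trans (ℕₚ.≤-reflexive (ℕₚ.+-comm 2 k)) k+2≤n)
    2l≤n : 2 * l ≤ n
    2l≤n = begin
      l + (l + 0)       ≡⟨ cong (_+_ l) (ℕₚ.+-identityʳ l) ⟩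
      l + l             ≤⟨ ℕₚ.+-monoʳ-≤ l l≤k ⟩
      l + k             ≡⟨ ℕₚ.m∸n+n≡m k≤n ⟩
      n                 ∎
      where
      open ℕₚ.≤-Reasoning
      l≤k : l ≤ k
      l≤k = ℕₚ.m≤n+o⇒m∸n≤o n k (ℕₚ.≤-trans n≤2k (ℕₚ.≤-reflexive (cong (_+_ k) (ℕₚ.+-identityʳ k))))
    -- κ is chosen so that κ Σ x = Σ c on the complementary slice.
    κ : ℚ
    κ = sum c *ℚ frac 1 l
    c′ : Vec ℚ n
    c′ = reflect κ c
    reflects : ∀ x → weight x ≡ l → linear c (complement x) ≡ linear c′ x
    reflects x wt = sym (≡.trans (linear-reflect κ c x) (≡.trans
      (cong (λ t → t - sum c +ℚ linear c (complement x)) κ*l) (ring (sum c) (linear c (complement x)))))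
      where
      κ*l : κ *ℚ q (weight x) ≡ sum c
      κ*l = ≡.trans (cong (λ j → κ *ℚ q j) wt) (≡.trans (ring₀ (sum c) (frac 1 l) (q l))
        (≡.trans (cong (sum c *ℚ_) (q*frac′ 1 l (ℕₚ.≤-trans (s≤s z≤n) 2≤l))) (ring₁ (sum c))))
        where
        ring₀ : ∀ s f l → s *ℚ f *ℚ l ≡ s *ℚ (l *ℚ f)
        ring₀ = solve-∀ ℚ-ring
        ring₁ : ∀ s → s *ℚ (1ℚ +ℚ 0ℚ) ≡ s
        ring₁ = solve-∀ ℚ-ring
      ring : ∀ s l → s - s +ℚ l ≡ l
      ring = solve-∀ ℚ-ring
    near′ : E n w′ (λ x → sq (toℚ (f (complement x)) - linear c′ x)) ≤ℚ ε
    near′ = subst (_≤ℚ ε) (≡.trans (E-complement n w (λ x → sq (toℚ (f x) - linear c x)))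
      (E-supported n off-l _ _ (λ x wt → cong (λ t → sq (toℚ (f (complement x)) - t)) (reflects x wt)))) near-E
    back : ∀ (a b : Vec Bool n → Bool) {r} → E n w′ (λ x → sq (toℚ (a (complement x)) - toℚ (b (complement x)))) ≤ℚ r →
      distSq n k a b ≤ℚ r
    back a b {r} h = dist-E a b (subst (_≤ℚ r) (sym (E-complement n w (λ x → sq (toℚ (a x) - toℚ (b x))))) h)
    not-not : ∀ a b → sq (toℚ a - toℚ b) ≡ sq (toℚ (not a) - toℚ (not b))
    not-not true  true  = ≡.refl
    not-not true  false = ≡.refl
    not-not false true  = ≡.refl
    not-not false false = ≡.refl
    finish : CloseToMax n w′ (1ℚ - frac k n) (C *ℚ C *ℚ ε) (C *ℚ ε) (f ∘ complement) → Conclusion n k ε f minOn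
    finish (close-to-max S few distance) = S
      , size-bound S (pOf≥0 n k 1≤n k≤n) (ℚₚ.p⊓q≤q (frac k n) (1ℚ - frac k n)) few
      -- The minimum over S at the complement of x is 1 minus the maximum over S at x, so the
      -- alternatives for f and 1 - f trade places.
      , Sum.swap (Sum.map
          (λ h → back (not ∘ f) (minOn S) (subst (_≤ℚ C *ℚ ε) (E-cong n (λ x →
            ≡.trans (not-not (f (complement x)) (maxOn S x))
              (cong (λ b → sq (toℚ (not (f (complement x))) - toℚ b)) (sym (minOn-complement S x))))) h))
          (λ h → back f (minOn S) (subst (_≤ℚ C *ℚ ε) (E-cong n (λ x →
            ≡.trans (not-not (not (f (complement x))) (maxOn S x))
              (cong₂ (λ a b → sq (toℚ a - toℚ b)) (not-involutive (f (complement x))) (sym (minOn-complement S x))))) h))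
          distance)

theorem2 : Σ ℚ λ C → (0ℚ <ℚ C) ×
    ((n k : ℕ) → 2 ≤ k → k + 2 ≤ n →
    (f : Vec Bool n → Bool) → (ε : ℚ) → (c : Vec ℚ n) →
    normSq n k (λ x → toℚ (f x) - linear c x) ≤ℚ ε →
    ((2 * k ≤ n →
    Σ (Subset n) λ S →
    (∣ S ∣ ≤ 1 ⊎ ((+ ∣ S ∣ / 1) *ℚ pOf n k) *ℚ ((+ ∣ S ∣ / 1) *ℚ pOf n k) ≤ℚ (C *ℚ C) *ℚ ε) ×
    (distSq n k f (maxOn S) ≤ℚ C *ℚ ε ⊎ distSq n k (λ x → not (f x)) (maxOn S) ≤ℚ C *ℚ ε))
    ×
    (n ≤ 2 * k →
    Σ (Subset n) λ S →
    (∣ S ∣ ≤ 1 ⊎ ((+ ∣ S ∣ / 1) *ℚ pOf n k) *ℚ ((+ ∣ S ∣ / 1) *ℚ pOf n k) ≤ℚ (C *ℚ C) *ℚ ε) ×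
    (distSq n k f (minOn S) ≤ℚ C *ℚ ε ⊎ distSq n k (λ x → not (f x)) (minOn S) ≤ℚ C *ℚ ε))))
theorem2 = C , C>0 , λ n k 2≤k k+2≤n f ε c near →
  lower-half n k 2≤k k+2≤n f ε c near , upper-half n k 2≤k k+2≤n f ε c near
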